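{- Let $a$ be a weak composition. The Young key polynomials are generated using the words in $\mathcal{YW}(a)$ as follows: $$\hat\kappa_a = \sum_{w \in \mathcal{YW}(a)} x_w.$$
   Context: Let $n=\ell(a)$. The Young key polynomial is $\hat\kappa_a(x_1,\ldots,x_n)=\kappa_{\mathrm{rev}(a)}(x_n,\ldots,x_1)$, where $\kappa_b$ is the key polynomial (Demazure character) and $\mathrm{rev}$ denotes reversal. For a word $u$, $\mathrm{frev}(u)$ is obtained by reversing $u$ and replacing each letter $j$ by $n+1-j$. $\mathrm{key}(b)$ is the unique key (semistandard Young tableau whose columns' entry sets are nested, each containing the next) of weight $b$, and $\mathrm{std}(T)$ is the standardization of an SSYT $T$ (replace the 1's from left to right by $1,\ldots,\gamma_1$, then the 2's by $\gamma_1+1,\ldots$, etc.). $\mathcal{YW}(a)$ is the set of words $u=\cdots u^{(2)}u^{(1)}$ factored into weakly increasing row-words (possibly empty) with $u^{(i)}$ having $a_i$ letters, such that (1) $\mathrm{frev}(u)$ maps to a pair $(P,\mathrm{std}(\mathrm{key}(\mathrm{rev}(a))))$ under the column insertion of Reiner–Shimozono ("Key polynomials and a flagged Littlewood–Richardson rule"), and (2) every letter $j$ of $u^{(i)}$ satisfies $i\le j\le \ell(a)$. For a word $w$, $x_w=\prod_{\text{letters } j \text{ of } w}x_j$. -}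

module Defs where

open import Data.Nat using (ℕ; zero; suc; _+_; _*_; _∸_; _≤_; _<_; _⊔_; _≤ᵇ_; _<ᵇ_; _≡ᵇ_)
open import Data.Bool using (Bool; true; false; if_then_else_)
open import Data.Integer using (ℤ; -_) renaming (_+_ to _+ℤ_; 0ℤ to 0z; 1ℤ to 1z)
open import Data.List using (List; []; _∷_; _++_; map; concat; concatMap; reverse; length; upTo; foldr; filter)
open import Data.List.Relation.Unary.All using (All)
open import Data.List.Relation.Unary.Linked using (Linked)
open import Data.Maybe using (Maybe; just; nothing)
open import Data.Product using (_×_; _,_; Σ-syntax)
open import Data.Unit using (⊤)
open import Data.Empty using (⊥)
open import Relation.Binary.PropositionalEquality using (_≡_)

-- Basic conventions
--  * a weak composition is a list of naturals; n = ℓ(a) = length a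
--  * words are lists of positive naturals (letters)
--  * exponent vectors are lists of naturals of length n
--    (entry k is the exponent of x_{k+1})

Word : Set
Word = List ℕ

at : List ℕ → ℕ → ℕ
at []       _       = 0
at (x ∷ xs) zero    = x
at (x ∷ xs) (suc i) = at xs i

setAt : List ℕ → ℕ → ℕ → List ℕ
setAt []       _       _ = []
setAt (x ∷ xs) zero    v = v ∷ xs
setAt (x ∷ xs) (suc i) v = x ∷ setAt xs i v

oneTo : ℕ → List ℕ
oneTo m = map suc (upTo m)

-- Polynomials with integer coefficients in n variables, as finite
-- formal sums of terms  c · x^e .  Two polynomials are equal when all
-- coefficients agree.

Poly : Set
Poly = List (ℤ × List ℕ)

eqList : List ℕ → List ℕ → Bool
eqList []       []       = true
eqList (x ∷ xs) (y ∷ ys) = if x ≡ᵇ y then eqList xs ys else false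
eqList _        _        = false

coeff : Poly → List ℕ → ℤ
coeff []             e = 0z
coeff ((c , e') ∷ p) e = if eqList e' e then c +ℤ coeff p e else coeff p e

_≈P_ : Poly → Poly → Set
p ≈P q = ∀ (e : List ℕ) → coeff p e ≡ coeff q e

-- Demazure (isobaric divided difference) operator
--   π_i f = ∂_i (x_i f) = (x_i f − x_{i+1} s_i f) / (x_i − x_{i+1})
-- acting on the variables x_{i+1}, x_{i+2} (i is 0-based here).
-- On a monomial with exponents p (of x_{i+1}) and q (of x_{i+2}):
--   p ≥ q :  Σ_{k=0}^{p−q}     x^{..., p−k, q+k, ...}
--   p < q : −Σ_{k=1}^{q−p−1}   x^{..., p+k, q−k, ...}

set2 : List ℕ → ℕ → ℕ → ℕ → List ℕ
set2 e i u v = setAt (setAt e i u) (suc i) v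

piTerm : ℕ → ℤ × List ℕ → Poly
piTerm i (c , e) with at e (suc i) ≤ᵇ at e i
... | true  = map (λ k → (c , set2 e i (at e i ∸ k) (at e (suc i) + k)))
                  (upTo (suc (at e i ∸ at e (suc i))))
... | false = map (λ k → (- c , set2 e i (at e i + suc k) (at e (suc i) ∸ suc k)))
                  (upTo (at e (suc i) ∸ at e i ∸ 1))

piOp : ℕ → Poly → Poly
piOp i p = concatMap (piTerm i) p

-- Key polynomials (Demazure characters)
--   κ_b = x^b                 if b is weakly decreasing,
--   κ_b = π_i κ_{s_i b}       if b_i < b_{i+1}.
-- We always use the first ascent i.  Each step lowers the number of
-- pairs i<j with b_i<b_j by one, so length b * length b steps of fuel
-- always suffice (the fuel-exhausted branch is never reached).

firstAscentFrom : ℕ → List ℕ → Maybe ℕ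
firstAscentFrom x []       = nothing
firstAscentFrom x (y ∷ zs) = if x <ᵇ y then just 0 else Data.Maybe.map suc (firstAscentFrom y zs)

firstAscent : List ℕ → Maybe ℕ
firstAscent []       = nothing
firstAscent (x ∷ xs) = firstAscentFrom x xs

swapAt : ℕ → List ℕ → List ℕ
swapAt i b = set2 b i (at b (suc i)) (at b i)

keyPolyFuel : ℕ → List ℕ → Poly
keyPolyFuel zero    b = (1z , b) ∷ []
keyPolyFuel (suc f) b with firstAscent b
... | nothing = (1z , b) ∷ []
... | just i  = piOp i (keyPolyFuel f (swapAt i b))

keyPoly : List ℕ → Poly
keyPoly b = keyPolyFuel (length b * length b) b

-- Young key polynomial:  κ̂_a(x_1,…,x_n) = κ_{rev a}(x_n,…,x_1)
youngKeyPoly : List ℕ → Poly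
youngKeyPoly a = map (λ { (c , e) → (c , reverse e) }) (keyPoly (reverse a))

content : ℕ → Word → List ℕ
content n w = map (λ j → length (filter (λ l → Data.Nat._≟_ l j) w)) (oneTo n)

monomialOf : ℕ → Word → Poly
monomialOf n w = (1z , content n w) ∷ []

sumMonomials : ℕ → List Word → Poly
sumMonomials n L = concatMap (monomialOf n) L

-- Tableaux (English convention), stored as the list of their columns
-- from left to right, each column read from top to bottom.

Tableau : Set
Tableau = List (List ℕ)

insertIntoColumn : List ℕ → ℕ → Maybe ℕ × List ℕ
insertIntoColumn []       x = nothing , x ∷ []
insertIntoColumn (y ∷ ys) x with x ≤ᵇ y
... | true  = just y , x ∷ ys
... | false with insertIntoColumn ys x
...   | (r , ys') = r , y ∷ ys'

-- Schensted column insertion of x into T; returns the new tableau and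
-- the (0-based) index of the column in which the new cell was created
-- (the new cell is always at the bottom of that column).
colInsert : Tableau → ℕ → Tableau × ℕ
colInsert []       x = (x ∷ []) ∷ [] , 0
colInsert (c ∷ cs) x with insertIntoColumn c x
... | (nothing , c') = c' ∷ cs , 0
... | (just y  , c') with colInsert cs y
...   | (cs' , j) = c' ∷ cs' , suc j

addCell : Tableau → ℕ → ℕ → Tableau
addCell []       _       v = (v ∷ []) ∷ []
addCell (c ∷ cs) zero    v = (c ++ (v ∷ [])) ∷ cs
addCell (c ∷ cs) (suc j) v = c ∷ addCell cs j v

insertAll : List ℕ → ℕ → Tableau → Tableau → Tableau × Tableau
insertAll []       k P Q = P , Q
insertAll (x ∷ xs) k P Q with colInsert P x
... | (P' , j) = insertAll xs (suc k) P' (addCell Q j k)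

-- Reiner–Shimozono column insertion of a word u = u_1 … u_m:
-- P(u) = u_1 → (u_2 → ( … → (u_m → ∅))) , i.e. the letters are column
-- inserted from right to left, and Q(u) records the cell created at
-- the k-th insertion by k.
rsColumnInsertion : Word → Tableau × Tableau
rsColumnInsertion u = insertAll (reverse u) 1 [] []

recordingTableau : Word → Tableau
recordingTableau u = Data.Product.proj₂ (rsColumnInsertion u)

frev : ℕ → Word → Word
frev n u = reverse (map (λ j → suc n ∸ j) u)

maxList : List ℕ → ℕ
maxList = foldr _⊔_ 0

keyColumn : List ℕ → ℕ → List ℕ
keyColumn b c = filter (λ i → Data.Nat._≤?_ c (at b (i ∸ 1))) (oneTo (length b))

keyTableau : List ℕ → Tableau
keyTableau b = map (keyColumn b) (oneTo (maxList b))

-- standardization: the entries equal to v are relabelled, from left to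
-- right, by (#entries < v) + 1, (#entries < v) + 2, …  In a
-- semistandard tableau equal entries lie in distinct columns, so the
-- cell in column c with entry v gets
--   #{entries < v} + #{entries = v in columns left of c} + 1.
countLess : Tableau → ℕ → ℕ
countLess T v = length (filter (λ y → Data.Nat._<?_ y v) (concat T))

countEqual : Tableau → ℕ → ℕ
countEqual T v = length (filter (λ y → Data.Nat._≟_ y v) (concat T))

stdAux : Tableau → Tableau → Tableau
stdAux T []       = []
stdAux T (c ∷ cs) = map (λ v → countLess T v + suc (countEqual (take' T) v)) c ∷ stdAux T cs
  where
  -- columns of T strictly left of the current column c
  take' : Tableau → Tableau
  take' U = Data.List.take (length U ∸ length (c ∷ cs)) U

std : Tableau → Tableau
std T = stdAux T T

-- The set 𝒴𝒲(a).
-- u = ⋯ u⁽²⁾ u⁽¹⁾ ; the factor list fs = u⁽¹⁾ ∷ u⁽²⁾ ∷ … ∷ u⁽ⁿ⁾ ∷ [].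

-- conditions on the i-th factor (i is 1-based)
FactorOK : ℕ → ℕ → ℕ → Word → Set
FactorOK n i ai f = (length f ≡ ai) × Linked _≤_ f × All (λ j → (i ≤ j) × (j ≤ n)) f

GoodFactors : ℕ → ℕ → List ℕ → List Word → Set
GoodFactors n i []        []        = ⊤
GoodFactors n i (ai ∷ as) (f ∷ fs)  = FactorOK n i ai f × GoodFactors n (suc i) as fs
GoodFactors n i []        (_ ∷ _)   = ⊥
GoodFactors n i (_ ∷ _)   []        = ⊥

InYW : List ℕ → Word → Set
InYW a u =
  Σ[ fs ∈ List Word ]
    ( GoodFactors (length a) 1 a fs
    × (u ≡ concat (reverse fs))
    × (recordingTableau (frev (length a) u) ≡ std (keyTableau (reverse a))) )

{-# OPTIONS --safe #-}

-- Complementing the letters turns a word of 𝒴𝒲(a) into a word v = v⁽¹⁾v⁽²⁾⋯ whose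
-- k-th row has b_k letters, is weakly decreasing and bounded by k, where b = reverse a;
-- the condition on the recording tableau says that inserting the k-th row creates cells
-- in the columns 0, …, b_k − 1, in this order.  The generating functions of these words
-- satisfy the recursion κ_b = π_i κ_{s_i b} at the first ascent b_i < b_{i+1} of b:
-- there the conditions on columns force the first i rows to be 1^{b_1}, …, i^{b_i}, and
-- row i + 1 to be (i+1)^{b_i} x.  The words with x ≤ i correspond to those for s_i b
-- by exchanging x with (i+1)^{b_i}.  The crystal operators for the letters i, i + 1
-- preserve the created cells, hence all words for b form full strings; the words with
-- x ≤ i contain the top of each string and of the rest all or nothing, and π_i maps both
-- a full string and its top to the sum of the string.
module Submission where

open import Defs
open import Data.Nat using (ℕ; zero; suc; _+_; _*_; _∸_; _⊔_; _⊓_; _≤_; _<_; _≥_; _≤ᵇ_; _<ᵇ_; _≡ᵇ_; z≤n; s≤s; s≤s⁻¹; _≟_; _≤?_; _<?_)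
open import Data.Nat.Properties
open import Data.Nat.ListAction using (sum)
open import Data.Bool using (true; false; T; if_then_else_)
open import Data.Integer using (ℤ; 0ℤ; 1ℤ; -_) renaming (_+_ to _+ℤ_; _*_ to _*ℤ_)
import Data.Integer.Properties as ℤ
open import Data.List using (List; []; _∷_; _++_; length; replicate; map; take; drop; filter; reverse; concat; concatMap; upTo; applyUpTo; applyDownFrom)
open import Data.List.Properties using (++-assoc; ++-identityʳ; ++-cancelˡ; ∷-injective; ≡-dec; length-++; length-map; length-replicate; length-take; length-drop; length-reverse; length-upTo; length-filter; filter-accept; filter-reject; filter-++; map-++; map-∘; map-cong; map-cong-local; map-id-local; map-upTo; map-applyUpTo; concat-++; concatMap-++; take++drop≡id; unfold-reverse; reverse-involutive; reverse-applyUpTo)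
open import Data.List.Membership.Propositional using (_∈_; find; lose)
open import Data.List.Membership.Propositional.Properties using (∈-++⁺ˡ; ∈-++⁺ʳ; ∈-++⁻; ∈-map⁺; ∈-map⁻; ∈-filter⁺; ∈-filter⁻; ∈-concatMap⁺; ∈-concatMap⁻)
open import Data.List.Membership.Propositional.Properties.WithK using (unique∧set⇒bag)
open import Data.List.Relation.Binary.BagAndSetEquality using (∼bag⇒↭)
open import Data.List.Relation.Binary.Disjoint.Propositional using (Disjoint)
open import Data.List.Relation.Binary.Permutation.Propositional as Perm using (_↭_)
open import Data.List.Relation.Binary.Pointwise using (Pointwise; []; _∷_)
open import Data.List.Relation.Unary.All as All using (All; []; _∷_)
import Data.List.Relation.Unary.All.Properties as All
open import Data.List.Relation.Unary.AllPairs as AllPairs using (AllPairs; []; _∷_)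
import Data.List.Relation.Unary.AllPairs.Properties as AllPairs
open import Data.List.Relation.Unary.Any as Any using (here; there)
open import Data.List.Relation.Unary.Linked as Linked using (Linked; []; [-]; _∷_)
import Data.List.Relation.Unary.Linked.Properties as Linked
open import Data.List.Relation.Unary.Unique.Propositional using (Unique)
import Data.List.Relation.Unary.Unique.Propositional.Properties as Unique
open import Data.Maybe as Maybe using (Maybe; just; nothing)
open import Data.Product using (_×_; _,_; ∃; ∃₂; proj₁; proj₂; Σ-syntax)
open import Data.Sum using (_⊎_; inj₁; inj₂)
open import Data.Empty using (⊥-elim)
open import Function.Base using (_∘_; case_of_)
open import Function.Bundles using (_⇔_; mk⇔)
open import Relation.Nullary using (¬_; Dec; yes; no; contradiction)
open import Relation.Unary using (Decidable)
open import Relation.Binary.Definitions using (tri<; tri≈; tri>)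
open import Relation.Binary.PropositionalEquality

-- Column insertion

-- The exchange works because after the first i rows the tableau starts with b_i columns 1, ..., i.
-- A letter at most i passes such a column, and also a column 1, ..., i + 1, without changing it,
-- while the letters i + 1 only extend these columns; so the two blocks act on disjoint sets of
-- columns. The cells are invariant under the crystal operators because a raising step can be
-- followed through each single bump: the state is the word consisting of the reading of the tableau
-- and the letters still to be inserted, and a bump rearranges one factor of it without destroying
-- the step. All or nothing: the letters i^{b_i} (i+1)^{b_i} of the prefix match each other, so the
-- operators act only on x and the rows behind it. A letter of x can be raised only at the top of a
-- string, and this produces a letter i + 1 in x, which leaves the smaller set. So the first step of
-- a string decides about all its later words. Polynomials are formal sums compared by coefficients,
-- so π_i has to be shown to respect this comparison, and sets of words have to be carried as lists
-- without repetition.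

≤⇒≤ᵇ≡true : ∀ {m n} → m ≤ n → (m ≤ᵇ n) ≡ true
≤⇒≤ᵇ≡true {m} {n} m≤n with m ≤ᵇ n in eq
... | true  = refl
... | false = ⊥-elim (subst T eq (≤⇒≤ᵇ m≤n))

>⇒≤ᵇ≡false : ∀ {m n} → n < m → (m ≤ᵇ n) ≡ false
>⇒≤ᵇ≡false {m} {n} n<m with m ≤ᵇ n in eq
... | false = refl
... | true  = contradiction (≤ᵇ⇒≤ m n (subst T (sym eq) _)) (<⇒≱ n<m)

-- Exposes the split of a column at the entry that `x` bumps, in place of the boolean tests and
-- nested matches of `insertIntoColumn`.
data ColumnView (x : ℕ) : List ℕ → Set where
  fits  : ∀ {c} → All (_< x) c → ColumnView x c
  bumps : ∀ c₁ h c₂ → All (_< x) c₁ → x ≤ h → ColumnView x (c₁ ++ h ∷ c₂)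

columnView : ∀ x c → ColumnView x c
columnView x [] = fits []
columnView x (y ∷ c) with x ≤? y
... | yes x≤y = bumps [] y c [] x≤y
... | no x≰y with columnView x c
...   | fits a            = fits (≰⇒> x≰y ∷ a)
...   | bumps c₁ h c₂ a p = bumps (y ∷ c₁) h c₂ (≰⇒> x≰y ∷ a) p

insertIntoColumn-fits : ∀ {x c} → All (_< x) c → insertIntoColumn c x ≡ (nothing , c ++ x ∷ [])
insertIntoColumn-fits [] = refl
insertIntoColumn-fits (y<x ∷ a) rewrite >⇒≤ᵇ≡false y<x | insertIntoColumn-fits a = refl

insertIntoColumn-bumps : ∀ {x h c₂} c₁ → All (_< x) c₁ → x ≤ h →
  insertIntoColumn (c₁ ++ h ∷ c₂) x ≡ (just h , c₁ ++ x ∷ c₂)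
insertIntoColumn-bumps [] [] x≤h rewrite ≤⇒≤ᵇ≡true x≤h = refl
insertIntoColumn-bumps {c₂ = c₂} (y ∷ c₁) (y<x ∷ a) x≤h
  rewrite >⇒≤ᵇ≡false y<x | insertIntoColumn-bumps {c₂ = c₂} c₁ a x≤h = refl

inserted : Tableau → ℕ → Tableau
inserted P x = proj₁ (colInsert P x)

newColumn : Tableau → ℕ → ℕ
newColumn P x = proj₂ (colInsert P x)

colInsert-fits : ∀ {x c} cs → All (_< x) c → colInsert (c ∷ cs) x ≡ ((c ++ x ∷ []) ∷ cs , 0)
colInsert-fits cs a rewrite insertIntoColumn-fits a = refl

colInsert-bumps : ∀ {x h c₂} c₁ cs → All (_< x) c₁ → x ≤ h →
  colInsert ((c₁ ++ h ∷ c₂) ∷ cs) x ≡ ((c₁ ++ x ∷ c₂) ∷ inserted cs h , suc (newColumn cs h))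
colInsert-bumps {c₂ = c₂} c₁ cs a x≤h rewrite insertIntoColumn-bumps {c₂ = c₂} c₁ a x≤h = refl

run : Tableau → Word → Tableau
run P []      = P
run P (x ∷ w) = run (inserted P x) w

-- Stands in for the recording tableau, which can be rebuilt from this list. Unlike a tableau, the
-- list can be cut at the ends of rows by `cells-++`.
cells : Tableau → Word → List ℕ
cells P []      = []
cells P (x ∷ w) = newColumn P x ∷ cells (inserted P x) w

run-++ : ∀ P u v → run P (u ++ v) ≡ run (run P u) v
run-++ P []      v = refl
run-++ P (x ∷ u) v = run-++ (inserted P x) u v

cells-++ : ∀ P u v → cells P (u ++ v) ≡ cells P u ++ cells (run P u) v
cells-++ P []      v = refl
cells-++ P (x ∷ u) v = cong (newColumn P x ∷_) (cells-++ (inserted P x) u v)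

length-cells : ∀ P w → length (cells P w) ≡ length w
length-cells P []      = refl
length-cells P (x ∷ w) = cong suc (length-cells (inserted P x) w)

Strict : List ℕ → Set
Strict = AllPairs _<_

record StrictAt (c₁ : List ℕ) (h : ℕ) (c₂ : List ℕ) : Set where
  constructor strictAt
  field
    strictˡ : Strict c₁
    below   : All (_< h) c₁
    above   : All (h <_) c₂
    strictʳ : Strict c₂

splitStrict : ∀ c₁ {h c₂} → Strict (c₁ ++ h ∷ c₂) → StrictAt c₁ h c₂
splitStrict []       (a ∷ s) = strictAt [] [] a s
splitStrict (y ∷ c₁) (a ∷ s) with splitStrict c₁ s
... | strictAt s₁ b a' s₂ =
  strictAt (All.++⁻ˡ c₁ a ∷ s₁) (All.head (All.++⁻ʳ c₁ a) ∷ b) a' s₂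

joinStrict : ∀ {c₁ h c₂} → StrictAt c₁ h c₂ → Strict (c₁ ++ h ∷ c₂)
joinStrict (strictAt s₁ b a s₂) =
  AllPairs.++⁺ s₁ (a ∷ s₂) (All.map (λ y<h → y<h ∷ All.map (<-trans y<h) a) b)

strict-fits : ∀ {x c} → Strict c → All (_< x) c → Strict (c ++ x ∷ [])
strict-fits s a = joinStrict (strictAt s a [] [])

strict-bumps : ∀ {x h c₂} c₁ → Strict (c₁ ++ h ∷ c₂) → All (_< x) c₁ → x ≤ h → Strict (c₁ ++ x ∷ c₂)
strict-bumps c₁ s a x≤h with splitStrict c₁ s
... | strictAt s₁ b a' s₂ = joinStrict (strictAt s₁ a (All.map (≤-<-trans x≤h) a') s₂)

inserted-strict : ∀ P x → All Strict P → All Strict (inserted P x)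
inserted-strict []       x []      = ([] ∷ []) ∷ []
inserted-strict (c ∷ cs) x (s ∷ ss) with columnView x c
... | fits a rewrite colInsert-fits cs a = strict-fits s a ∷ ss
... | bumps c₁ h c₂ a p rewrite colInsert-bumps {c₂ = c₂} c₁ cs a p =
  strict-bumps c₁ s a p ∷ inserted-strict cs h ss

-- Reading the columns from right to left gives a word which is Knuth
-- equivalent to every word inserting to the tableau.
reading : Tableau → Word
reading []       = []
reading (c ∷ cs) = reading cs ++ c

-- Crystal operators

count : ℕ → Word → ℕ
count j w = length (filter (_≟ j) w)

count-≡ : ∀ j w → count j (j ∷ w) ≡ suc (count j w)
count-≡ j w = cong length (filter-accept (_≟ j) {j} {w} refl)

count-≢ : ∀ {x j} w → x ≢ j → count j (x ∷ w) ≡ count j w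
count-≢ {x} {j} w p = cong length (filter-reject (_≟ j) {x} {w} p)

indicator : ℕ → ℕ → ℕ
indicator j x = count j (x ∷ [])

count-++ : ∀ j u v → count j (u ++ v) ≡ count j u + count j v
count-++ j u v = trans (cong length (filter-++ (_≟ j) u v)) (length-++ (filter (_≟ j) u))

count-∷ : ∀ j x w → count j (x ∷ w) ≡ indicator j x + count j w
count-∷ j x w = count-++ j (x ∷ []) w

++-injective : ∀ (u u′ : Word) {v v′ : Word} → length u ≡ length u′ → u ++ v ≡ u′ ++ v′ → u ≡ u′ × v ≡ v′
++-injective [] [] _ q = refl , q
++-injective (x ∷ u) (y ∷ u′) p q with ∷-injective q
... | refl , q′ with ++-injective u u′ (suc-injective p) q′
...   | refl , r = refl , r

module Crystal (i : ℕ) where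

  -- In the bracketing rule i is an opening and suc i a closing bracket.
  data Kind : ℕ → Set where
    opening : Kind i
    closing : Kind (suc i)
    neutral : ∀ {x} → x ≢ i → x ≢ suc i → Kind x

  kind : ∀ x → Kind x
  kind x with x ≟ i
  ... | yes refl = opening
  ... | no x≢i with x ≟ suc i
  ...   | yes refl = closing
  ...   | no x≢si  = neutral x≢i x≢si

  closeBy : ∀ {x} → Kind x → ℕ → ℕ
  closeBy opening       l = l ∸ 1
  closeBy closing       l = suc l
  closeBy (neutral _ _) l = l

  openBy : ∀ {x} → Kind x → ℕ → ℕ
  openBy opening       k = suc k
  openBy closing       k = k ∸ 1
  openBy (neutral _ _) k = k

  -- The number of unmatched closing brackets of w ++ z, where z has l of them.
  ε : Word → ℕ → ℕ
  ε []      l = l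
  ε (x ∷ w) l = closeBy (kind x) (ε w l)

  -- The number of unmatched opening brackets of z ++ w, where z has k of them.
  φ : ℕ → Word → ℕ
  φ k []      = k
  φ k (x ∷ w) = φ (openBy (kind x) k) w

  -- For a variable `i` the term `kind i` does not reduce to `opening`, so the effects of two kinds
  -- are compared instead of the kinds themselves.
  kind-irrelevant : ∀ {x} (p q : Kind x) l → closeBy p l ≡ closeBy q l × openBy p l ≡ openBy q l
  kind-irrelevant opening       opening       l = refl , refl
  kind-irrelevant opening       (neutral p _) l = contradiction refl p
  kind-irrelevant closing       closing       l = refl , refl
  kind-irrelevant closing       (neutral _ p) l = contradiction refl p
  kind-irrelevant (neutral p _) opening       l = contradiction refl p
  kind-irrelevant (neutral _ p) closing       l = contradiction refl p
  kind-irrelevant (neutral _ _) (neutral _ _) l = refl , refl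

  close-opening : ∀ l → closeBy (kind i) l ≡ l ∸ 1
  close-opening l = proj₁ (kind-irrelevant (kind i) opening l)
  close-closing : ∀ l → closeBy (kind (suc i)) l ≡ suc l
  close-closing l = proj₁ (kind-irrelevant (kind (suc i)) closing l)
  open-opening : ∀ l → openBy (kind i) l ≡ suc l
  open-opening l = proj₂ (kind-irrelevant (kind i) opening l)
  open-closing : ∀ l → openBy (kind (suc i)) l ≡ l ∸ 1
  open-closing l = proj₂ (kind-irrelevant (kind (suc i)) closing l)

  Neutral : ℕ → Set
  Neutral x = x ≢ i × x ≢ suc i

  close-neutral : ∀ {x} → Neutral x → ∀ l → closeBy (kind x) l ≡ l
  close-neutral (p , q) l = proj₁ (kind-irrelevant (kind _) (neutral p q) l)
  open-neutral : ∀ {x} → Neutral x → ∀ l → openBy (kind x) l ≡ l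
  open-neutral (p , q) l = proj₂ (kind-irrelevant (kind _) (neutral p q) l)

  small-neutral : ∀ {x} → x < i → Neutral x
  small-neutral x<i = (λ { refl → <-irrefl refl x<i }) , (λ { refl → <-asym x<i ≤-refl })

  large-neutral : ∀ {x} → suc i < x → Neutral x
  large-neutral i<x = (λ { refl → <-asym i<x ≤-refl }) , (λ { refl → <-irrefl refl i<x })

  ε-++ : ∀ u v l → ε (u ++ v) l ≡ ε u (ε v l)
  ε-++ []      v l = refl
  ε-++ (x ∷ u) v l = cong (closeBy (kind x)) (ε-++ u v l)

  φ-++ : ∀ k u v → φ k (u ++ v) ≡ φ (φ k u) v
  φ-++ k []      v = refl
  φ-++ k (x ∷ u) v = φ-++ (openBy (kind x) k) u v

  ε-neutral : ∀ {w} → All Neutral w → ∀ l → ε w l ≡ l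
  ε-neutral []      l = refl
  ε-neutral {x ∷ w} (n ∷ a) l = trans (close-neutral n (ε w l)) (ε-neutral a l)

  φ-neutral : ∀ {w} → All Neutral w → ∀ k → φ k w ≡ k
  φ-neutral []      k = refl
  φ-neutral {x ∷ w} (n ∷ a) k = trans (cong (λ k → φ k w) (open-neutral n k)) (φ-neutral a k)

  -- Step k l w w′: w′ arises from w by raising to suc i the leftmost unmatched i,
  -- in a context with k unmatched opening brackets on the left and l unmatched
  -- closing brackets on the right.  The brackets left of that i have no unmatched
  -- opening one, those right of it no unmatched closing one.
  data Step : ℕ → ℕ → Word → Word → Set where
    here  : ∀ {k l v} → k ≡ 0 → ε v l ≡ 0 → Step k l (i ∷ v) (suc i ∷ v)
    there : ∀ {k l x w w′} → Step (openBy (kind x) k) l w w′ → Step k l (x ∷ w) (x ∷ w′)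

  step-length : ∀ {k l w w′} → Step k l w w′ → length w ≡ length w′
  step-length (here _ _) = refl
  step-length (there s)  = cong suc (step-length s)

  -- Gives direct access to the raised letter, which the constructors of `Step` reach only one
  -- letter at a time.
  record Unstep (k l : ℕ) (w w′ : Word) : Set where
    constructor unstepped
    field
      u v : Word
      eq  : w ≡ u ++ i ∷ v
      eq′ : w′ ≡ u ++ suc i ∷ v
      φ≡0 : φ k u ≡ 0
      ε≡0 : ε v l ≡ 0

  unstep : ∀ {k l w w′} → Step k l w w′ → Unstep k l w w′
  unstep (here {v = v} p q) = unstepped [] v refl refl p q
  unstep (there {x = x} s) with unstep s
  ... | unstepped u v e e′ p q = unstepped (x ∷ u) v (cong (x ∷_) e) (cong (x ∷_) e′) p q

  restep : ∀ {k l} u v → φ k u ≡ 0 → ε v l ≡ 0 → Step k l (u ++ i ∷ v) (u ++ suc i ∷ v)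
  restep []      v p q = here p q
  restep (x ∷ u) v p q = there (restep u v p q)

  stepˡ : ∀ {k l A A′} B → Step k (ε B l) A A′ → Step k l (A ++ B) (A′ ++ B)
  stepˡ B (here {v = v} p q) = here p (trans (ε-++ v B _) q)
  stepˡ B (there s)          = there (stepˡ B s)

  stepʳ : ∀ {k l B B′} A → Step (φ k A) l B B′ → Step k l (A ++ B) (A ++ B′)
  stepʳ []      s = s
  stepʳ (x ∷ A) s = there (stepʳ A s)

  -- The raised letter lies in one of the two factors, and the other factor matters only through its
  -- unmatched brackets. The indices `k` and `l` of `Step` exist for this localization.
  split↑ : ∀ {k l} A {B w′} → Step k l (A ++ B) w′ →
    (∃ λ A′ → w′ ≡ A′ ++ B × Step k (ε B l) A A′) ⊎ (∃ λ B′ → w′ ≡ A ++ B′ × Step (φ k A) l B B′)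
  split↑ []      s = inj₂ (_ , refl , s)
  split↑ (_ ∷ A) {B} (here p q) = inj₁ (_ , refl , here p (trans (sym (ε-++ A B _)) q))
  split↑ (x ∷ A) (there s) with split↑ A s
  ... | inj₁ (A′ , refl , t) = inj₁ (x ∷ A′ , refl , there t)
  ... | inj₂ (B′ , refl , t) = inj₂ (B′ , refl , t)

  split↓ : ∀ {k l} A {B w} → Step k l w (A ++ B) →
    (∃ λ A′ → w ≡ A′ ++ B × Step k (ε B l) A′ A) ⊎ (∃ λ B′ → w ≡ A ++ B′ × Step (φ k A) l B′ B)
  split↓ []      s = inj₂ (_ , refl , s)
  split↓ (_ ∷ A) {B} (here p q) = inj₁ (_ , refl , here p (trans (sym (ε-++ A B _)) q))
  split↓ (x ∷ A) (there s) with split↓ A s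
  ... | inj₁ (A′ , refl , t) = inj₁ (x ∷ A′ , refl , there t)
  ... | inj₂ (B′ , refl , t) = inj₂ (B′ , refl , t)

  splitStep : ∀ {k l} A A′ {B B′} → length A ≡ length A′ → Step k l (A ++ B) (A′ ++ B′) →
    (B ≡ B′ × Step k (ε B l) A A′) ⊎ (A ≡ A′ × Step (φ k A) l B B′)
  splitStep A A′ {B} e s with split↑ A s
  ... | inj₁ (C , eq , t) with ++-injective A′ C (trans (sym e) (step-length t)) eq
  ...   | refl , refl = inj₁ (refl , t)
  splitStep A A′ {B} e s | inj₂ (C , eq , t) with ++-injective A′ A (sym e) eq
  ...   | refl , refl = inj₂ (refl , t)

  -- No opening bracket stays unmatched left of the raised letter. Hence all `k` openings of the
  -- context are closed inside `w`, and the new closing bracket finds no partner.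
  ε-step : ∀ {k l w w′} → Step k l w w′ → k ≤ ε w l × ε w′ l ≡ suc (ε w l)
  ε-step {l = l} (here {v = v} refl q) =
    z≤n , trans (close-closing (ε v l)) (cong suc (trans q (sym (trans (close-opening (ε v l)) (cong (_∸ 1) q)))))
  ε-step (there {x = x} s) with kind x
  ... | neutral _ _ = ε-step s
  ... | closing with ε-step s
  ...   | p , e = ≤-trans (m≤n+m∸n _ 1) (s≤s p) , cong suc e
  ε-step {l = l} (there {w = w} s) | opening with ε w l | ε-step s
  ...   | suc m | s≤s p , e = p , cong (_∸ 1) e

  no-step : ∀ {k l v w} → ε v l ≡ 0 → ¬ Step (suc k) l v w
  no-step q t with ε-step t
  ... | p , _ = contradiction (subst (_ ≤_) q p) λ ()

  step-functional : ∀ {k l w w₁ w₂} → Step k l w w₁ → Step k l w w₂ → w₁ ≡ w₂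
  step-functional (here _ _)    (here _ _)    = refl
  step-functional (there s)     (there t)     = cong (_ ∷_) (step-functional s t)
  step-functional (here {k} _ q) (there t)    = ⊥-elim (no-step q (subst (λ k → Step k _ _ _) (open-opening k) t))
  step-functional (there t) (here {k} _ q)    = ⊥-elim (no-step q (subst (λ k → Step k _ _ _) (open-opening k) t))

  step-injective : ∀ {k l w w₁ w₂} → Step k l w₁ w → Step k l w₂ w → w₁ ≡ w₂
  step-injective (here _ _) (here _ _) = refl
  step-injective (there s)  (there t)  = cong (_ ∷_) (step-injective s t)
  step-injective (here _ q) (there t)  = contradiction (trans (sym (proj₂ (ε-step t))) q) λ ()
  step-injective (there t)  (here _ q) = contradiction (trans (sym (proj₂ (ε-step t))) q) λ ()

  -- The bound `k ≤ ε w 0` says that `w` closes all openings of the context, so the leftmost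
  -- unmatched opening lies in `w` itself.
  raise : ∀ k w → k ≤ ε w 0 → 0 < φ k w → ∃ (Step k 0 w)
  raise k []      k≤0 0<k = contradiction 0<k (≤⇒≯ k≤0)
  raise k (x ∷ w) k≤ 0< with kind x in eq
  raise k (x ∷ w) k≤ 0< | neutral _ _ with raise k w k≤ 0<
  ... | w′ , s = x ∷ w′ , there (subst (λ p → Step (openBy p k) 0 w w′) (sym eq) s)
  raise k (x ∷ w) k≤ 0< | closing with raise (k ∸ 1) w (∸-monoˡ-≤ 1 k≤) 0<
  ... | w′ , s = x ∷ w′ , there (subst (λ p → Step (openBy p k) 0 w w′) (sym eq) s)
  raise k (x ∷ w) k≤ 0< | opening with ε w 0 in e
  ... | zero  = _ , here (n≤0⇒n≡0 k≤) e
  ... | suc m with raise (suc k) w (subst (suc k ≤_) (sym e) (s≤s k≤)) 0<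
  ...   | w′ , s = x ∷ w′ , there (subst (λ p → Step (openBy p k) 0 w w′) (sym eq) s)

  -- More than `k` unmatched closing brackets cannot all be absorbed by the context; the rightmost
  -- of them is lowered.
  lower : ∀ k w → k < ε w 0 → ∃ λ w₀ → Step k 0 w₀ w
  lower k []      ()
  lower k (x ∷ w) k< with kind x in eq
  lower k (x ∷ w) k< | neutral _ _ with lower k w k<
  ... | w′ , s = x ∷ w′ , there (subst (λ p → Step (openBy p k) 0 w′ w) (sym eq) s)
  lower k (x ∷ w) k< | opening with ε w 0 in e
  ... | suc m with lower (suc k) w (subst (suc k <_) (sym e) (s≤s k<))
  ...   | w′ , s = x ∷ w′ , there (subst (λ p → Step (openBy p k) 0 w′ w) (sym eq) s)
  lower zero (x ∷ w) k< | closing with ε w 0 in e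
  ... | zero = _ , here refl e
  ... | suc m with lower 0 w (subst (0 <_) (sym e) (s≤s z≤n))
  ...   | w′ , s = x ∷ w′ , there (subst (λ p → Step (openBy p 0) 0 w′ w) (sym eq) s)
  lower (suc k) (x ∷ w) k< | closing with lower k w (s≤s⁻¹ k<)
  ...   | w′ , s = x ∷ w′ , there (subst (λ p → Step (openBy p (suc k)) 0 w′ w) (sym eq) s)

  -- Crystal operators commute with column insertion

  data Bump (c : List ℕ) (x : ℕ) : ℕ → List ℕ → Set where
    bump : ∀ {h} c₁ c₂ → c ≡ c₁ ++ h ∷ c₂ → All (_< x) c₁ → x ≤ h → Bump c x h (c₁ ++ x ∷ c₂)

  smalls-neutral : ∀ {h w} → All (_< h) w → h ≤ i → All Neutral w
  smalls-neutral a h≤i = All.map (λ y<h → small-neutral (<-≤-trans y<h h≤i)) a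

  larges-neutral : ∀ {h w} → All (h <_) w → suc i ≤ h → All Neutral w
  larges-neutral a i<h = All.map (λ h<y → large-neutral (≤-<-trans i<h h<y)) a

  -- Strictness leaves room for a single bracket in a column above `i`, at its start. `Below` is the
  -- dual, with the bracket at the end.
  data Above (c : List ℕ) : Set where
    neutrals : All Neutral c → Above c
    closes   : ∀ {d} → c ≡ suc i ∷ d → All Neutral d → Above c

  above : ∀ {c} → All (i <_) c → Strict c → Above c
  above {[]}    _ _ = neutrals []
  above {y ∷ c} (i<y ∷ _) (a ∷ _) with m≤n⇒m<n∨m≡n i<y
  ... | inj₁ si<y = neutrals (large-neutral si<y ∷ larges-neutral a i<y)
  ... | inj₂ refl = closes refl (larges-neutral a ≤-refl)

  data Below (c : List ℕ) : Set where
    neutrals : All Neutral c → Below c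
    opens    : ∀ {d} → c ≡ d ++ i ∷ [] → All Neutral d → Below c

  below : ∀ {c} → All (_< suc i) c → Strict c → Below c
  below {c} b s with columnView i c
  ... | fits a = neutrals (smalls-neutral a ≤-refl)
  ... | bumps c₁ h c₂ a i≤h with All.++⁻ʳ c₁ b
  ...   | h<si ∷ b₂ with ≤-antisym i≤h (s≤s⁻¹ h<si)
  ...     | refl with c₂ | StrictAt.above (splitStrict c₁ s) | b₂
  ...       | []    | _       | _          = opens refl (smalls-neutral a ≤-refl)
  ...       | y ∷ _ | i<y ∷ _ | y<si ∷ _ = contradiction (s≤s⁻¹ y<si) (<⇒≱ i<y)

  data Position (x : ℕ) : Set where
    small : x < i → Position x
    at-i  : x ≡ i → Position x
    at-si : x ≡ suc i → Position x
    large : suc i < x → Position x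

  position : ∀ x → Position x
  position x with <-cmp x i
  ... | tri< p _ _ = small p
  ... | tri≈ _ p _ = at-i p
  ... | tri> _ _ p with m≤n⇒m<n∨m≡n p
  ...   | inj₁ q    = large q
  ...   | inj₂ refl = at-si refl

  -- The words `c₁ h c₂ x` and `h c₁ x c₂` are Knuth equivalent. Restricted to the letters i and i +
  -- 1 they are equal, or differ by one of the relations i (i+1) i ~ i i (i+1), when x = h = i, and
  -- i (i+1) (i+1) ~ (i+1) i (i+1), when x = h = i + 1. Both relations keep the numbers of unmatched
  -- brackets.
  bump-ε : ∀ {x h} c₁ c₂ → Strict (c₁ ++ h ∷ c₂) → All (_< x) c₁ → x ≤ h → ∀ l →
    ε c₁ (closeBy (kind h) (ε c₂ (closeBy (kind x) l))) ≡ closeBy (kind h) (ε c₁ (closeBy (kind x) (ε c₂ l)))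
  bump-ε {x} {h} c₁ c₂ s a x≤h l with splitStrict c₁ s | position x
  ... | _ | small x<i
    rewrite ε-neutral (smalls-neutral a (<⇒≤ x<i)) (closeBy (kind h) (ε c₂ (closeBy (kind x) l)))
          | ε-neutral (smalls-neutral a (<⇒≤ x<i)) (closeBy (kind x) (ε c₂ l))
          | close-neutral (small-neutral x<i) l | close-neutral (small-neutral x<i) (ε c₂ l) = refl
  ... | strictAt _ _ b _ | large si<x
    rewrite ε-neutral (larges-neutral b (≤-trans (<⇒≤ si<x) x≤h)) (closeBy (kind x) l)
          | ε-neutral (larges-neutral b (≤-trans (<⇒≤ si<x) x≤h)) l
          | close-neutral (large-neutral (<-≤-trans si<x x≤h)) (closeBy (kind x) l)
          | close-neutral (large-neutral (<-≤-trans si<x x≤h)) (ε c₁ (closeBy (kind x) l)) = refl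
  ... | strictAt _ _ b s₂ | at-i refl
    rewrite ε-neutral (smalls-neutral a ≤-refl) (closeBy (kind h) (ε c₂ (closeBy (kind i) l)))
          | ε-neutral (smalls-neutral a ≤-refl) (closeBy (kind i) (ε c₂ l))
          | close-opening l | close-opening (ε c₂ l) = at-opening (m≤n⇒m<n∨m≡n x≤h)
    where
    at-opening : i < h ⊎ i ≡ h → closeBy (kind h) (ε c₂ (l ∸ 1)) ≡ closeBy (kind h) (ε c₂ l ∸ 1)
    at-opening (inj₁ i<h)
      rewrite ε-neutral (larges-neutral b i<h) (l ∸ 1) | ε-neutral (larges-neutral b i<h) l = refl
    at-opening (inj₂ refl) with above b s₂
    ... | neutrals n rewrite ε-neutral n (l ∸ 1) | ε-neutral n l = refl
    ... | closes {d} refl n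
      rewrite ε-neutral n (l ∸ 1) | ε-neutral n l | close-closing (l ∸ 1) | close-closing l
            | close-opening (suc (l ∸ 1)) | close-opening l = refl
  ... | strictAt s₁ _ b _ | at-si refl
    rewrite ε-neutral (larges-neutral b x≤h) (closeBy (kind (suc i)) l) | ε-neutral (larges-neutral b x≤h) l
          | close-closing l = at-closing (m≤n⇒m<n∨m≡n x≤h)
    where
    at-closing : suc i < h ⊎ suc i ≡ h → ε c₁ (closeBy (kind h) (suc l)) ≡ closeBy (kind h) (ε c₁ (suc l))
    at-closing (inj₁ si<h)
      rewrite close-neutral (large-neutral si<h) (suc l) | close-neutral (large-neutral si<h) (ε c₁ (suc l)) = refl
    at-closing (inj₂ refl) rewrite close-closing (suc l) | close-closing (ε c₁ (suc l)) with below a s₁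
    ... | neutrals n rewrite ε-neutral n (suc (suc l)) | ε-neutral n (suc l) = refl
    ... | opens {d} refl n
      rewrite ε-++ d (i ∷ []) (suc (suc l)) | ε-++ d (i ∷ []) (suc l)
            | close-opening (suc (suc l)) | close-opening (suc l) | ε-neutral n (suc l) | ε-neutral n l = refl

  bump-φ : ∀ {x h} c₁ c₂ → Strict (c₁ ++ h ∷ c₂) → All (_< x) c₁ → x ≤ h → ∀ k →
    openBy (kind x) (φ (openBy (kind h) (φ k c₁)) c₂) ≡ φ (openBy (kind x) (φ (openBy (kind h) k) c₁)) c₂
  bump-φ {x} {h} c₁ c₂ s a x≤h k with splitStrict c₁ s | position x
  ... | _ | small x<i
    rewrite φ-neutral (smalls-neutral a (<⇒≤ x<i)) k
          | φ-neutral (smalls-neutral a (<⇒≤ x<i)) (openBy (kind h) k)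
          | open-neutral (small-neutral x<i) (openBy (kind h) k)
          | open-neutral (small-neutral x<i) (φ (openBy (kind h) k) c₂) = refl
  ... | strictAt _ _ b _ | large si<x
    rewrite φ-neutral (larges-neutral b (≤-trans (<⇒≤ si<x) x≤h)) (openBy (kind h) (φ k c₁))
          | φ-neutral (larges-neutral b (≤-trans (<⇒≤ si<x) x≤h)) (openBy (kind x) (φ (openBy (kind h) k) c₁))
          | open-neutral (large-neutral (<-≤-trans si<x x≤h)) (φ k c₁)
          | open-neutral (large-neutral (<-≤-trans si<x x≤h)) k = refl
  ... | strictAt _ _ b s₂ | at-i refl
    rewrite φ-neutral (smalls-neutral a ≤-refl) k
          | φ-neutral (smalls-neutral a ≤-refl) (openBy (kind h) k)
          | open-opening (openBy (kind h) k)
          | open-opening (φ (openBy (kind h) k) c₂) = at-opening (m≤n⇒m<n∨m≡n x≤h)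
    where
    at-opening : i < h ⊎ i ≡ h → suc (φ (openBy (kind h) k) c₂) ≡ φ (suc (openBy (kind h) k)) c₂
    at-opening (inj₁ i<h)
      rewrite φ-neutral (larges-neutral b i<h) (openBy (kind h) k)
            | φ-neutral (larges-neutral b i<h) (suc (openBy (kind h) k)) = refl
    at-opening (inj₂ refl) rewrite open-opening k with above b s₂
    ... | neutrals n rewrite φ-neutral n (suc k) | φ-neutral n (suc (suc k)) = refl
    ... | closes {d} refl n
      rewrite open-closing (suc k) | open-closing (suc (suc k)) | φ-neutral n k | φ-neutral n (suc k) = refl
  ... | strictAt s₁ _ b _ | at-si refl
    rewrite φ-neutral (larges-neutral b x≤h) (openBy (kind h) (φ k c₁))
          | φ-neutral (larges-neutral b x≤h) (openBy (kind (suc i)) (φ (openBy (kind h) k) c₁))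
          | open-closing (openBy (kind h) (φ k c₁))
          | open-closing (φ (openBy (kind h) k) c₁) = at-closing (m≤n⇒m<n∨m≡n x≤h)
    where
    at-closing : suc i < h ⊎ suc i ≡ h → openBy (kind h) (φ k c₁) ∸ 1 ≡ φ (openBy (kind h) k) c₁ ∸ 1
    at-closing (inj₁ si<h)
      rewrite open-neutral (large-neutral si<h) (φ k c₁) | open-neutral (large-neutral si<h) k = refl
    at-closing (inj₂ refl) rewrite open-closing (φ k c₁) | open-closing k with below a s₁
    ... | neutrals n rewrite φ-neutral n k | φ-neutral n (k ∸ 1) = refl
    ... | opens {d} refl n
      rewrite φ-++ k d (i ∷ []) | φ-++ (k ∸ 1) d (i ∷ []) | φ-neutral n k | φ-neutral n (k ∸ 1)
            | open-opening k | open-opening (k ∸ 1) = refl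

  bump-ε′ : ∀ {x h c d} → Strict c → Bump c x h d → ∀ l → ε (c ++ x ∷ []) l ≡ ε (h ∷ d) l
  bump-ε′ {x} {h} s (bump c₁ c₂ refl a x≤h) l
    rewrite ε-++ (c₁ ++ h ∷ c₂) (x ∷ []) l | ε-++ c₁ (h ∷ c₂) (closeBy (kind x) l) | ε-++ c₁ (x ∷ c₂) l
    = bump-ε c₁ c₂ s a x≤h l

  bump-φ′ : ∀ {x h c d} → Strict c → Bump c x h d → ∀ k → φ k (c ++ x ∷ []) ≡ φ k (h ∷ d)
  bump-φ′ {x} {h} s (bump c₁ c₂ refl a x≤h) k
    rewrite φ-++ k (c₁ ++ h ∷ c₂) (x ∷ []) | φ-++ k c₁ (h ∷ c₂) | φ-++ (openBy (kind h) k) c₁ (x ∷ c₂)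
    = bump-φ c₁ c₂ s a x≤h k

  data ColumnStep (k l : ℕ) (c : List ℕ) (x : ℕ) (c′ : List ℕ) (x′ : ℕ) : Set where
    bothFit  : All (_< x) c → All (_< x′) c′ → ColumnStep k l c x c′ x′
    bothBump : ∀ {h d h′ d′} → Bump c x h d → Bump c′ x′ h′ d′ → Step k l (h ∷ d) (h′ ∷ d′) → ColumnStep k l c x c′ x′

  suc≢0 : ∀ {m n} → n ≡ suc m → n ≢ 0
  suc≢0 refl ()

  Step-cong : ∀ {k k′ l l′ w w′} → k ≡ k′ → l ≡ l′ → Step k l w w′ → Step k′ l′ w w′
  Step-cong refl refl s = s

  -- In general the raised letter is carried along: it stays in the column, is the bumped entry, or
  -- is the inserted letter. Its role changes only when an inserted `i` bumps an `i` standing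
  -- directly above an `i + 1`.
  columnStep : ∀ {k l c x c′ x′} → Strict c → Strict c′ → length c ≡ length c′ →
    Step k l (c ++ x ∷ []) (c′ ++ x′ ∷ []) → ColumnStep k l c x c′ x′
  columnStep {k} {l} {c} {x} {c′} {x′} sc sc′ len st with splitStep c c′ len st | columnView x c
  columnStep {k} {l} {c} {x} sc sc′ len st | inj₁ (refl , t) | fits a with unstep t
  ... | unstepped u v refl refl p q with position x | All.++⁻ʳ u a
  ...   | small x<i | i<x ∷ _ = contradiction i<x (<⇒≯ x<i)
  ...   | at-i refl | i<x ∷ _ = contradiction i<x (<-irrefl refl)
  -- The inserted `suc i` would be an unmatched closing bracket right of the raised letter.
  ...   | at-si refl | _ = contradiction q (suc≢0 (trans
            (ε-neutral (larges-neutral (StrictAt.above (splitStrict u sc′)) ≤-refl) _) (close-closing l)))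
  ...   | large si<x | _ ∷ av = bothFit a (All.++⁺ (All.++⁻ˡ u a) (si<x ∷ av))
  columnStep sc sc′ len st | inj₂ (refl , here _ _) | fits a =
    bothFit a (All.map (λ y<i → <-trans y<i (n<1+n i)) a)
  columnStep {l = l} {x = x} sc sc′ len st | inj₁ (refl , t) | bumps c₁ h c₂ a x≤h with split↑ c₁ t
  ... | inj₁ (c₁′ , refl , t₁) with unstep t₁
  ...   | unstepped u v refl refl p q with position x | All.++⁻ʳ u a
  ...     | small x<i | i<x ∷ _ = contradiction i<x (<⇒≯ x<i)
  ...     | at-i refl | i<x ∷ _ = contradiction i<x (<-irrefl refl)
  ...     | at-si refl | _ = contradiction q (suc≢0
              (trans (ε-neutral (All.++⁻ˡ v n) _)
              (trans (ε-neutral (All.++⁻ʳ v n) _) (close-closing l))))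
    where
    n : All Neutral (v ++ h ∷ c₂)
    n = larges-neutral (StrictAt.above (splitStrict u
          (subst Strict (++-assoc u (suc i ∷ v) (h ∷ c₂)) sc′))) ≤-refl
  ...     | large si<x | _ ∷ av =
    bothBump (bump c₁ c₂ refl a x≤h)
             (bump (u ++ suc i ∷ v) c₂ refl (All.++⁺ (All.++⁻ˡ u a) (si<x ∷ av)) x≤h)
             (there (Step-cong (sym (open-neutral nh _)) refl
               (stepˡ (x ∷ c₂) (Step-cong refl (trans (close-neutral nh _)
                 (trans (trans (ε-neutral nc (closeBy (kind x) l)) (close-neutral nx l))
                   (sym (trans (close-neutral nx _) (ε-neutral nc l))))) t₁))))
    where
    nx = large-neutral si<x
    nh = large-neutral (<-≤-trans si<x x≤h)
    nc = larges-neutral (StrictAt.above (splitStrict (u ++ i ∷ v) sc)) (≤-trans (<⇒≤ si<x) x≤h)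
  columnStep {k} {l} {x = x} sc sc′ len st | inj₁ (refl , t) | bumps c₁ h c₂ a x≤h
      | inj₂ (_ , refl , here p q) =
    bothBump (bump c₁ c₂ refl a x≤h) (bump c₁ c₂ refl a (m≤n⇒m≤1+n x≤h))
             (here (trans (sym (φ-neutral nc₁ k)) p)
               (trans (ε-++ c₁ (x ∷ c₂) l) (trans (ε-neutral nc₁ _)
                 (trans (cong (closeBy (kind x)) (ε-neutral nc₂ l)) (trans (sym (ε-neutral nc₂ _)) q)))))
    where
    nc₁ = smalls-neutral a x≤h
    nc₂ = larges-neutral (StrictAt.above (splitStrict c₁ sc′)) ≤-refl
  columnStep {k} {l} {x = x} sc sc′ len st | inj₁ (refl , t) | bumps c₁ h c₂ a x≤h
      | inj₂ (_ , refl , there t₂) with unstep t₂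
  ... | unstepped u v refl refl p q =
    bothBump (bump c₁ _ refl a x≤h) (bump c₁ _ refl a x≤h)
             (there (stepʳ c₁ (there (Step-cong
               (trans (open-neutral nh _) (trans (φ-neutral nc₁ k)
                 (sym (trans (open-neutral nx _) (trans (φ-neutral nc₁ _) (open-neutral nh k))))))
               (close-neutral nx l) t₂))))
    where
    h<i = All.head (All.++⁻ʳ u (StrictAt.above (splitStrict c₁ sc)))
    nh  = small-neutral h<i
    nx  = small-neutral (≤-<-trans x≤h h<i)
    nc₁ = smalls-neutral a (≤-trans x≤h (<⇒≤ h<i))
  columnStep {k} {l} sc sc′ len st | inj₂ (refl , here φ≡0 l≡0) | bumps c₁ h c₂ a x≤h
    with splitStrict c₁ sc | m≤n⇒m<n∨m≡n x≤h
  ... | strictAt _ _ b _ | inj₁ i<h =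
    bothBump (bump c₁ c₂ refl a x≤h) (bump c₁ c₂ refl (All.map m<n⇒m<1+n a) i<h)
             (restep (h ∷ c₁) c₂ (trans (φ-neutral nc₁ _) op≡0)
               (trans (ε-neutral (larges-neutral b i<h) l) l≡0))
    where
    nc₁  = smalls-neutral a ≤-refl
    op≡0 : openBy (kind h) k ≡ 0
    op≡0 = trans (cong (openBy (kind h)) (sym (φ-neutral nc₁ k)))
      (trans (sym (φ-neutral (larges-neutral b i<h) _)) (trans (sym (φ-++ k c₁ (h ∷ c₂))) φ≡0))
  ... | strictAt _ _ b s₂ | inj₂ refl = at-opening (above b s₂)
    where
    nc₁ = smalls-neutral a ≤-refl
    φ₂  : φ (suc k) c₂ ≡ 0
    φ₂  = trans (cong (λ m → φ m c₂) (sym (trans (cong (openBy (kind i)) (φ-neutral nc₁ k)) (open-opening k))))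
            (trans (sym (φ-++ k c₁ (i ∷ c₂))) φ≡0)
    at-opening : Above c₂ → ColumnStep k l (c₁ ++ i ∷ c₂) i (c₁ ++ i ∷ c₂) (suc i)
    at-opening (neutrals n) = contradiction φ₂ (suc≢0 (φ-neutral n (suc k)))
    -- Before the step `i` bumps `i`, after it `i + 1` bumps `i + 1`. Both columns stay as they
    -- were, so the step now raises the bumped letter.
    at-opening (closes {d} refl n) =
      bothBump (bump c₁ (suc i ∷ d) refl a ≤-refl)
               (bump (c₁ ++ i ∷ []) d (sym (++-assoc c₁ (i ∷ []) (suc i ∷ d)))
                     (All.++⁺ (All.map m<n⇒m<1+n a) (≤-refl ∷ [])) ≤-refl)
               (subst (Step k l (i ∷ c₁ ++ i ∷ suc i ∷ d)) (cong (suc i ∷_) (sym (++-assoc c₁ (i ∷ []) (suc i ∷ d))))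
                 (here k≡0 (trans (ε-++ c₁ (i ∷ suc i ∷ d) l) (trans (ε-neutral nc₁ _) ε≡0))))
      where
      k≡0 : k ≡ 0
      k≡0 = trans (sym (trans (cong (λ m → φ m d) (open-closing (suc k))) (φ-neutral n k))) φ₂
      ε≡0 : closeBy (kind i) (closeBy (kind (suc i)) (ε d l)) ≡ 0
      ε≡0 rewrite ε-neutral n l | close-closing l | close-opening (suc l) = l≡0

  data ContextStep (A A′ c : Word) (x : ℕ) (c′ : Word) (x′ : ℕ) (z z′ : Word) : Set where
    bothFit  : All (_< x) c → All (_< x′) c′ → ContextStep A A′ c x c′ x′ z z′
    bothBump : ∀ {h d h′ d′} → Bump c x h d → Bump c′ x′ h′ d′ →
      Step 0 0 (A ++ (h ∷ d) ++ z) (A′ ++ (h′ ∷ d′) ++ z′) → ContextStep A A′ c x c′ x′ z z′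

  length-snoc : ∀ (c c′ : Word) {x x′ : ℕ} → length c ≡ length c′ → length (c ++ x ∷ []) ≡ length (c′ ++ x′ ∷ [])
  length-snoc c c′ e = trans (length-++ c) (trans (cong (_+ 1) e) (sym (length-++ c′)))

  -- A step outside the column and the inserted letter leaves the bump the same on both sides; it
  -- survives because `bump-ε′` and `bump-φ′` keep the bracket counts that its context supplies.
  contextStep : ∀ A A′ {c x c′ x′ z z′} → length A ≡ length A′ → length c ≡ length c′ → Strict c → Strict c′ →
    Step 0 0 (A ++ (c ++ x ∷ []) ++ z) (A′ ++ (c′ ++ x′ ∷ []) ++ z′) → ContextStep A A′ c x c′ x′ z z′
  contextStep A A′ {c} {x} {c′} {x′} {z} {z′} lA lc sc sc′ st with splitStep A A′ lA st
  contextStep A A′ {c} {x} {c′} {x′} {z} {z′} lA lc sc sc′ st | inj₁ (e , t)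
    with ++-injective (c ++ x ∷ []) (c′ ++ x′ ∷ []) (length-snoc c c′ lc) e
  ... | e₁ , refl with ++-injective c c′ lc e₁
  ...   | refl , refl with columnView x c
  ...     | fits a = bothFit a a
  ...     | bumps c₁ h c₂ a p = bothBump b b (stepˡ _ (Step-cong refl same t))
    where
    b = bump c₁ c₂ refl a p
    same : ε ((c ++ x ∷ []) ++ z) 0 ≡ ε ((h ∷ c₁ ++ x ∷ c₂) ++ z) 0
    same = trans (ε-++ (c ++ x ∷ []) z 0) (trans (bump-ε′ sc b _) (sym (ε-++ (h ∷ c₁ ++ x ∷ c₂) z 0)))
  contextStep A A′ {c} {x} {c′} {x′} {z} lA lc sc sc′ st | inj₂ (refl , t)
    with splitStep (c ++ x ∷ []) (c′ ++ x′ ∷ []) (length-snoc c c′ lc) t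
  ... | inj₁ (refl , t₁) with columnStep sc sc′ lc t₁
  ...   | bothFit a a′    = bothFit a a′
  ...   | bothBump b b′ s = bothBump b b′ (stepʳ A (stepˡ z s))
  contextStep A A′ {c} {x} {c′} {x′} {z} lA lc sc sc′ st | inj₂ (refl , t) | inj₂ (e , t₁)
    with ++-injective c c′ lc e
  ... | refl , refl with columnView x c
  ...   | fits a = bothFit a a
  ...   | bumps c₁ h c₂ a p = bothBump b b (stepʳ A (stepʳ (h ∷ c₁ ++ x ∷ c₂) (Step-cong (bump-φ′ sc b _) refl t₁)))
    where
    b = bump c₁ c₂ refl a p

  SameShape : Tableau → Tableau → Set
  SameShape = Pointwise (λ c c′ → length c ≡ length c′)

  length-reading : ∀ {P P′} → SameShape P P′ → length (reading P) ≡ length (reading P′)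
  length-reading []             = refl
  length-reading {c ∷ cs} {c′ ∷ cs′} (e ∷ es) =
    trans (length-++ (reading cs)) (trans (cong₂ _+_ (length-reading es) e) (sym (length-++ (reading cs′))))

  record SameInsertion (P P′ : Tableau) (x x′ : ℕ) (z z′ : Word) : Set where
    constructor sameInsertion
    field
      column : newColumn P x ≡ newColumn P′ x′
      shape  : SameShape (inserted P x) (inserted P′ x′)
      step   : Step 0 0 (reading (inserted P x) ++ z) (reading (inserted P′ x′) ++ z′)

  insertions : ∀ {P P′ x x′ z z′ Q Q′ j j′} → colInsert P x ≡ (Q , j) → colInsert P′ x′ ≡ (Q′ , j′) → j ≡ j′ →
    SameShape Q Q′ → Step 0 0 (reading Q ++ z) (reading Q′ ++ z′) → SameInsertion P P′ x x′ z z′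
  insertions {z = z} {z′} p p′ refl es s =
    sameInsertion (trans (cong proj₂ p) (sym (cong proj₂ p′)))
      (subst₂ SameShape (sym (cong proj₁ p)) (sym (cong proj₁ p′)) es)
      (subst₂ (λ Q Q′ → Step 0 0 (reading Q ++ z) (reading Q′ ++ z′)) (sym (cong proj₁ p)) (sym (cong proj₁ p′)) s)

  -- After a bump the letter `h` is inserted into the remaining columns, and the changed first
  -- column stands behind it. The recursion therefore treats this column as part of the letters to
  -- come, which is why `z` is arbitrary.
  insertion-step : ∀ P P′ x x′ z z′ → All Strict P → All Strict P′ → SameShape P P′ →
    Step 0 0 (reading P ++ x ∷ z) (reading P′ ++ x′ ∷ z′) → SameInsertion P P′ x x′ z z′
  insertion-step [] [] x x′ z z′ _ _ [] st = sameInsertion refl (refl ∷ []) st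
  insertion-step (c ∷ cs) (c′ ∷ cs′) x x′ z z′ (sc ∷ ss) (sc′ ∷ ss′) (e ∷ es) st
    with contextStep (reading cs) (reading cs′) (length-reading es) e sc sc′
           (subst₂ (Step 0 0) (regroup (reading cs) c x z) (regroup (reading cs′) c′ x′ z′) st)
    where
    regroup : ∀ (A c : Word) x z → (A ++ c) ++ x ∷ z ≡ A ++ (c ++ x ∷ []) ++ z
    regroup A c x z = trans (++-assoc A c (x ∷ z)) (cong (A ++_) (sym (++-assoc c (x ∷ []) z)))
  ... | bothFit a a′ =
    insertions (colInsert-fits cs a) (colInsert-fits cs′ a′) refl (length-snoc c c′ e ∷ es)
      (subst₂ (Step 0 0) (regroup (reading cs) c x z) (regroup (reading cs′) c′ x′ z′) st)
    where
    regroup : ∀ (A c : Word) x z → (A ++ c) ++ x ∷ z ≡ (A ++ (c ++ x ∷ [])) ++ z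
    regroup A c x z = trans (++-assoc A c (x ∷ z))
      (trans (cong (A ++_) (sym (++-assoc c (x ∷ []) z))) (sym (++-assoc A _ z)))
  ... | bothBump (bump {h} c₁ c₂ refl a p) (bump {h′} c₁′ c₂′ refl a′ p′) s
    with insertion-step cs cs′ h h′ ((c₁ ++ x ∷ c₂) ++ z) ((c₁′ ++ x′ ∷ c₂′) ++ z′) ss ss′ es s
  ...   | sameInsertion q es′ t =
    insertions (colInsert-bumps {c₂ = c₂} c₁ cs a p) (colInsert-bumps {c₂ = c₂′} c₁′ cs′ a′ p′)
      (cong suc q) (replaced ∷ es′)
      (subst₂ (Step 0 0) (sym (++-assoc (reading (inserted cs h)) _ z)) (sym (++-assoc (reading (inserted cs′ h′)) _ z′)) t)
    where
    replaced : length (c₁ ++ x ∷ c₂) ≡ length (c₁′ ++ x′ ∷ c₂′)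
    replaced = trans (length-++ c₁) (trans (sym (length-++ c₁ {h ∷ c₂}))
      (trans e (trans (length-++ c₁′) (sym (length-++ c₁′ {x′ ∷ c₂′})))))

  cells-step : ∀ P P′ w w′ → All Strict P → All Strict P′ → SameShape P P′ → length w ≡ length w′ →
    Step 0 0 (reading P ++ w) (reading P′ ++ w′) → cells P w ≡ cells P′ w′
  cells-step P P′ [] [] _ _ _ _ _ = refl
  cells-step P P′ (x ∷ w) (x′ ∷ w′) s s′ e l st with insertion-step P P′ x x′ w w′ s s′ e st
  ... | sameInsertion q e′ t =
    cong₂ _∷_ q (cells-step _ _ w w′ (inserted-strict P x s) (inserted-strict P′ x′ s′) e′ (suc-injective l) t)

  step-cells : ∀ {w w′} → Step 0 0 w w′ → cells [] w ≡ cells [] w′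
  step-cells {w} {w′} st = cells-step [] [] w w′ [] [] [] (step-length st) st

  count-step : ∀ {k l w w′} → Step k l w w′ →
    count i w ≡ suc (count i w′) × count (suc i) w′ ≡ suc (count (suc i) w) ×
    (∀ {j} → j ≢ i → j ≢ suc i → count j w′ ≡ count j w)
  count-step {w = _ ∷ v} (here _ _)
    rewrite count-≡ i v | count-≢ {suc i} {i} v (1+n≢n) | count-≡ (suc i) v | count-≢ {i} {suc i} v (λ e → 1+n≢n (sym e)) =
    refl , refl , λ p q → trans (count-≢ v (≢-sym q)) (sym (count-≢ v (≢-sym p)))
  count-step (there {x = x} {w} {w′} s) with count-step s
  ... | p , q , r = trans (count-∷ i x w) (trans (cong (indicator i x +_) p) (trans (+-suc _ _) (cong suc (sym (count-∷ i x w′)))))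
                  , trans (count-∷ (suc i) x w′) (trans (cong (indicator (suc i) x +_) q) (trans (+-suc _ _) (cong suc (sym (count-∷ (suc i) x w)))))
                  , λ {j} a b → trans (count-∷ j x w′) (trans (cong (indicator j x +_) (r a b)) (sym (count-∷ j x w)))

  -- The weight identity of strings, φ - ε = #i - #(i+1), for `w` with `k` openings in front of it;
  -- these leave `ε w 0 ∸ k` closing brackets unmatched.
  balance : ∀ k w → k + count i w + (ε w 0 ∸ k) ≡ count (suc i) w + φ k w
  balance k [] rewrite 0∸n≡0 k | +-identityʳ (k + 0) = +-identityʳ k
  balance k (x ∷ w) with kind x
  ... | neutral p q rewrite count-≢ {x} {i} w p | count-≢ {x} {suc i} w q = balance k w
  ... | opening rewrite count-≡ i w | count-≢ {i} {suc i} w (λ e → 1+n≢n (sym e)) | ∸-+-assoc (ε w 0) 1 k | +-suc k (count i w) = balance (suc k) w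
  balance zero (x ∷ w) | closing
    rewrite count-≢ {suc i} {i} w 1+n≢n | count-≡ (suc i) w | +-suc (count i w) (ε w 0) = cong suc (balance 0 w)
  balance (suc k) (x ∷ w) | closing
    rewrite count-≢ {suc i} {i} w 1+n≢n | count-≡ (suc i) w = cong suc (balance k w)

  -- The changes of the two counts and of `ε` determine that of `φ` through `balance`.
  φ-step : ∀ {w w′} → Step 0 0 w w′ → φ 0 w ≡ suc (φ 0 w′)
  φ-step {w} {w′} s with count-step s | ε-step s | balance 0 w | balance 0 w′
  ... | p , q , _ | _ , r | b | b′ rewrite p | q | r | +-suc (count i w′) (ε w 0) =
    +-cancelˡ-≡ (count (suc i) w) _ _ (trans (sym b) (trans b′ (sym (+-suc _ _))))

-- Factored words

seg : ℕ → ℕ → List ℕ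
seg s zero    = []
seg s (suc m) = s ∷ seg (suc s) m

length-seg : ∀ s m → length (seg s m) ≡ m
length-seg s zero    = refl
length-seg s (suc m) = cong suc (length-seg (suc s) m)

seg-+ : ∀ s m n → seg s (m + n) ≡ seg s m ++ seg (s + m) n
seg-+ s zero    n rewrite +-identityʳ s = refl
seg-+ s (suc m) n rewrite +-suc s m = cong (s ∷_) (seg-+ (suc s) m n)

seg-bounded : ∀ s m → All (λ y → s ≤ y × y < s + m) (seg s m)
seg-bounded s zero    = []
seg-bounded s (suc m) rewrite +-suc s m =
  (≤-refl , s≤s (m≤m+n s m)) ∷ All.map (λ { (p , q) → <⇒≤ p , q }) (seg-bounded (suc s) m)

-- The columns in which the k-th row of a factored word must create cells
-- are 0, …, b_k ∸ 1.
keyCells : List ℕ → List ℕ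
keyCells []       = []
keyCells (b ∷ bs) = seg 0 b ++ keyCells bs

Decreasing : List ℕ → Set
Decreasing = Linked _≥_

Letters : ℕ → Word → Set
Letters k = All (λ x → 1 ≤ x × x ≤ k)

Row : ℕ → ℕ → Word → Set
Row k b r = length r ≡ b × Decreasing r × Letters k r

Rows : ℕ → List ℕ → Word → Set
Rows k []       w = w ≡ []
Rows k (b ∷ bs) w = ∃₂ λ r v → w ≡ r ++ v × Row k b r × Rows (suc k) bs v

-- The complements of the words of 𝒴𝒲(reverse b)
KeyWord : List ℕ → Word → Set
KeyWord b w = Rows 1 b w × cells [] w ≡ keyCells b

-- The superstandard word. For a weakly decreasing weight `b`, `sup 1 b` turns out to be the only
-- key word.
sup : ℕ → List ℕ → Word
sup k []       = []
sup k (b ∷ bs) = replicate b k ++ sup (suc k) bs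

decreasing-replicate : ∀ m k → Decreasing (replicate m k)
decreasing-replicate zero          k = []
decreasing-replicate (suc zero)    k = [-]
decreasing-replicate (suc (suc m)) k = ≤-refl ∷ decreasing-replicate (suc m) k

decreasing-replicate-++ : ∀ m k {x} → All (_≤ k) x → Decreasing x → Decreasing (replicate m k ++ x)
decreasing-replicate-++ zero          k a       d = d
decreasing-replicate-++ (suc zero)    k []      d = [-]
decreasing-replicate-++ (suc zero)    k (p ∷ a) d = p ∷ d
decreasing-replicate-++ (suc (suc m)) k a       d = ≤-refl ∷ decreasing-replicate-++ (suc m) k a d

decreasing-drop : ∀ u {v} → Decreasing (u ++ v) → Decreasing v
decreasing-drop []      d = d
decreasing-drop (x ∷ u) d = decreasing-drop u (Linked.tail d)

letters-replicate : ∀ m {j k} → 1 ≤ j → j ≤ k → Letters k (replicate m j)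
letters-replicate zero    p q = []
letters-replicate (suc m) p q = (p , q) ∷ letters-replicate m p q

letters-weaken : ∀ {j k x} → j ≤ k → Letters j x → Letters k x
letters-weaken j≤k = All.map (λ { (p , q) → p , ≤-trans q j≤k })

row-replicate : ∀ m k → Row (suc k) m (replicate m (suc k))
row-replicate m k = length-replicate m , decreasing-replicate m (suc k) , letters-replicate m (s≤s z≤n) ≤-refl

sup-rows : ∀ k bs {cs w} → Rows (suc k + length bs) cs w → Rows (suc k) (bs ++ cs) (sup (suc k) bs ++ w)
sup-rows k []       r rewrite +-identityʳ k = r
sup-rows k (b ∷ bs) {w = w} r rewrite +-suc k (length bs) =
  replicate b (suc k) , _ , ++-assoc (replicate b (suc k)) _ w , row-replicate b k , sup-rows (suc k) bs r

-- Insertion into tableaux starting with columns 1, …, k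

-- A letter bumps the first entry not below it, which here is the equal entry `x`; so the column is
-- unchanged and the same letter moves on.
pass : ∀ {x k} cs → 1 ≤ x → x ≤ k → colInsert (seg 1 k ∷ cs) x ≡ (seg 1 k ∷ inserted cs x , suc (newColumn cs x))
pass {suc y} {k} cs (s≤s _) y<k with m≤n⇒∃[o]m+o≡n y<k
... | d , e = subst (λ c → colInsert (c ∷ cs) (suc y) ≡ (c ∷ inserted cs (suc y) , suc (newColumn cs (suc y))))
  (trans (sym (seg-+ 1 y (suc d))) (cong (seg 1) (trans (+-suc y d) e)))
  (colInsert-bumps {c₂ = seg (suc (suc y)) d} (seg 1 y) cs (All.map proj₂ (seg-bounded 1 y)) ≤-refl)

place : ∀ k cs → colInsert (seg 1 k ∷ cs) (suc k) ≡ (seg 1 (suc k) ∷ cs , 0)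
place k cs = trans (colInsert-fits cs (All.map proj₂ (seg-bounded 1 k)))
  (cong (λ c → c ∷ cs , 0) (trans (sym (seg-+ 1 k 1)) (cong (seg 1) (+-comm k 1))))

passes : ∀ {x k} q R → 1 ≤ x → x ≤ k →
  inserted (replicate q (seg 1 k) ++ R) x ≡ replicate q (seg 1 k) ++ inserted R x ×
  newColumn (replicate q (seg 1 k) ++ R) x ≡ q + newColumn R x
passes zero    R p q = refl , refl
passes {x} {k} (suc n) R p q with passes n R p q
... | e , e′ rewrite pass (replicate n (seg 1 k) ++ R) p q = cong (seg 1 k ∷_) e , cong suc e′

passes-word : ∀ {k} q R w → Letters k w →
  run (replicate q (seg 1 k) ++ R) w ≡ replicate q (seg 1 k) ++ run R w ×
  cells (replicate q (seg 1 k) ++ R) w ≡ map (q +_) (cells R w)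
passes-word q R []      []            = refl , refl
passes-word {k} q R (x ∷ w) ((p , p′) ∷ a) with passes {x} {k} q R p p′
... | e , e′ rewrite e | e′ with passes-word q (inserted R x) w a
...   | f , f′ = f , cong (_ ∷_) f′

shift-replicate : ∀ {A : Set} s (c : A) cs → replicate s c ++ c ∷ cs ≡ replicate (suc s) c ++ cs
shift-replicate zero    c cs = refl
shift-replicate (suc s) c cs = cong (c ∷_) (shift-replicate s c cs)

-- The tableau in the middle of a row of letters `suc k`: `s` columns are already extended, `q` are
-- still waiting.
stage : ℕ → ℕ → ℕ → Tableau → Tableau
stage k s q R = replicate s (seg 1 (suc k)) ++ replicate q (seg 1 k) ++ R

stage-insert : ∀ k s q R →
  inserted (stage k s (suc q) R) (suc k) ≡ stage k (suc s) q R × newColumn (stage k s (suc q) R) (suc k) ≡ s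
stage-insert k s q R with passes {suc k} {suc k} s (replicate (suc q) (seg 1 k) ++ R) (s≤s z≤n) ≤-refl
... | e , e′ rewrite e | e′ | place k (replicate q (seg 1 k) ++ R) =
  shift-replicate s (seg 1 (suc k)) _ , +-identityʳ s

stage-run : ∀ k s q R → run (stage k s q R) (replicate q (suc k)) ≡ replicate (s + q) (seg 1 (suc k)) ++ R
                      × cells (stage k s q R) (replicate q (suc k)) ≡ seg s q
stage-run k s zero    R rewrite +-identityʳ s = refl , refl
stage-run k s (suc q) R with stage-insert k s q R
... | e , e′ rewrite e | e′ | +-suc s q with stage-run k (suc s) q R
...   | f , f′ = f , cong (s ∷_) f′

-- A letter at most k passes all the columns 1, …, k.
stage-forced : ∀ k s q R w → Letters (suc k) w → length w ≡ q → cells (stage k s q R) w ≡ seg s q → w ≡ replicate q (suc k)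
stage-forced k s zero    R []      _              _ _ = refl
stage-forced k s (suc q) R (x ∷ w) ((1≤x , x≤) ∷ a) l e with m≤n⇒m<n∨m≡n x≤
... | inj₂ refl with stage-insert k s q R
...   | f , _ rewrite f = cong (suc k ∷_) (stage-forced k (suc s) q R w a (suc-injective l) (proj₂ (∷-injective e)))
stage-forced k s (suc q) R (x ∷ w) ((1≤x , x≤) ∷ a) l e | inj₁ (s≤s x≤k)
  with passes {x} {suc k} s (replicate (suc q) (seg 1 k) ++ R) 1≤x x≤ | passes {x} {k} (suc q) R 1≤x x≤k
... | _ , f | _ , g = contradiction (trans (sym (trans f (cong (s +_) g))) (proj₁ (∷-injective e))) (m+1+n≢m s)

-- Tableaux starting with `q` columns 1, ..., `k`. Height 0 needs its own constructor because empty
-- columns are not stored.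
data Flat : ℕ → ℕ → Tableau → Set where
  empty : ∀ {q} → Flat 0 q []
  flat  : ∀ {k q} R → Flat (suc k) q (replicate q (seg 1 (suc k)) ++ R)

flat-weaken : ∀ {k p q P} → p ≤ q → Flat k q P → Flat k p P
flat-weaken p≤q empty = empty
flat-weaken {p = p} {q} p≤q (flat {k} R) with m≤n⇒∃[o]m+o≡n p≤q
... | d , refl = subst (Flat (suc k) p) (split p) (flat (replicate d (seg 1 (suc k)) ++ R))
  where
  split : ∀ p → replicate p (seg 1 (suc k)) ++ replicate d (seg 1 (suc k)) ++ R ≡ replicate (p + d) (seg 1 (suc k)) ++ R
  split zero    = refl
  split (suc p) = cong (_ ∷_) (split p)

ones-run : ∀ s q → run (replicate s (seg 1 1) ++ []) (replicate q 1) ≡ replicate (s + q) (seg 1 1) ++ []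
                 × cells (replicate s (seg 1 1) ++ []) (replicate q 1) ≡ seg s q
ones-run s zero    rewrite +-identityʳ s = refl , refl
ones-run s (suc q) with passes {1} {1} s [] ≤-refl ≤-refl
... | e , e′ rewrite e | e′ | shift-replicate s (seg 1 1) [] | +-identityʳ s | +-suc s q with ones-run (suc s) q
...   | f , f′ = f , cong (s ∷_) f′

ones-forced : ∀ {q} w → Letters 1 w → length w ≡ q → w ≡ replicate q 1
ones-forced []      []            refl = refl
ones-forced (x ∷ w) ((p , q) ∷ a) refl = cong₂ _∷_ (≤-antisym q p) (ones-forced w a refl)

flat-run : ∀ {k q P} → Flat k q P →
  Flat (suc k) q (run P (replicate q (suc k))) × cells P (replicate q (suc k)) ≡ seg 0 q
flat-run {q = q} empty with ones-run 0 q
... | e , e′ = subst (Flat 1 q) (sym e) (flat []) , e′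
flat-run {q = q} (flat {k} R) with stage-run (suc k) 0 q R
... | e , e′ = subst (Flat (suc (suc k)) q) (sym e) (flat R) , e′

flat-forced : ∀ {k q P} → Flat k q P → ∀ {w} → Letters (suc k) w → length w ≡ q → cells P w ≡ seg 0 q → w ≡ replicate q (suc k)
flat-forced empty    {w} a l e = ones-forced w a l
flat-forced (flat R) {w} a l e = stage-forced _ 0 _ R w a l e

cells-split : ∀ P u v {J K} → length u ≡ length J → cells P (u ++ v) ≡ J ++ K → cells P u ≡ J × cells (run P u) v ≡ K
cells-split P u v {J} l e =
  ++-injective (cells P u) J (trans (length-cells P u) l) (trans (sym (cells-++ P u v)) e)

firstOf : List ℕ → ℕ → ℕ
firstOf []      p = p
firstOf (b ∷ _) p = b

firstOf-≤ : ∀ {b p} pre → Decreasing (b ∷ pre ++ p ∷ []) → firstOf pre p ≤ b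
firstOf-≤ []      (p≤b ∷ _) = p≤b
firstOf-≤ (_ ∷ _) (c≤b ∷ _) = c≤b

-- Each row is at most as long as the one before, so it finds enough columns 1, ..., k to extend.
-- The final part `p` tells how many such columns are still wanted behind `pre`.
sup-run : ∀ k pre p {P} → Decreasing (pre ++ p ∷ []) → Flat k (firstOf pre p) P →
  Flat (k + length pre) p (run P (sup (suc k) pre)) × cells P (sup (suc k) pre) ≡ keyCells pre
sup-run k []        p d f rewrite +-identityʳ k = f , refl
sup-run k (b ∷ pre) p {P} d f with flat-run f
... | g , e with sup-run (suc k) pre p (Linked.tail d) (flat-weaken (firstOf-≤ pre d) g)
...   | h , e′ rewrite +-suc k (length pre)
        | run-++ P (replicate b (suc k)) (sup (suc (suc k)) pre)
        | cells-++ P (replicate b (suc k)) (sup (suc (suc k)) pre) = h , cong₂ _++_ e e′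

-- Cells in the full columns leave only the largest letter allowed in a row, by `flat-forced`. So
-- the tableau after the row is known and again flat, and the next row is forced in turn.
sup-forced : ∀ k pre p {P cs w} → Decreasing (pre ++ p ∷ []) → Flat k (firstOf pre p) P →
  Rows (suc k) (pre ++ cs) w → cells P w ≡ keyCells (pre ++ cs) →
  ∃ λ v → w ≡ sup (suc k) pre ++ v × Rows (suc k + length pre) cs v × cells (run P (sup (suc k) pre)) v ≡ keyCells cs
sup-forced k []        p {w = w} d f r e rewrite +-identityʳ k = w , refl , r , e
sup-forced k (b ∷ pre) p {P} d f (r , v , refl , (l , _ , a) , rs) e with cells-split P r v {seg 0 b} (trans l (sym (length-seg 0 b))) e
... | e₁ , e₂ with flat-forced f a l e₁
...   | refl with flat-run f
...     | g , _ with sup-forced (suc k) pre p (Linked.tail d) (flat-weaken (firstOf-≤ pre d) g) rs e₂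
...       | v′ , refl , rs′ , e₃ rewrite +-suc k (length pre) =
  v′ , sym (++-assoc (replicate b (suc k)) _ v′) , rs′
     , trans (cong (λ Q → cells Q v′) (run-++ P (replicate b (suc k)) (sup (suc (suc k)) pre))) e₃

keyCells-++ : ∀ bs cs → keyCells (bs ++ cs) ≡ keyCells bs ++ keyCells cs
keyCells-++ []       cs = refl
keyCells-++ (b ∷ bs) cs = trans (cong (seg 0 b ++_) (keyCells-++ bs cs)) (sym (++-assoc (seg 0 b) _ _))

splitLength : ∀ {p q} (r : List ℕ) → p ≤ q → length r ≡ q → ∃₂ λ u v → r ≡ u ++ v × length u ≡ p × length v ≡ q ∸ p
splitLength {p} r p≤q refl = take p r , drop p r , sym (take++drop≡id p r)
  , trans (length-take p r) (m≤n⇒m⊓n≡m p≤q) , length-drop p r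

take-++-length : ∀ {A : Set} (u : List A) {v n} → length u ≡ n → take n (u ++ v) ≡ u × drop n (u ++ v) ≡ v
take-++-length []      refl = refl , refl
take-++-length (x ∷ u) refl with take-++-length u refl
... | e , e′ = cong (x ∷_) e , e′

-- Uses lengths only, so that it is a function on all words and can be mapped over a list without
-- the factorizations of its members.
swapBlocks : ℕ → ℕ → ℕ → Word → Word
swapBlocks n m m′ w =
  take n w ++ take m′ (drop m (drop n w)) ++ take m (drop n w) ++ drop m′ (drop m (drop n w))

swapBlocks-++ : ∀ u v v′ w {n m m′} → length u ≡ n → length v ≡ m → length v′ ≡ m′ →
  swapBlocks n m m′ (u ++ v ++ v′ ++ w) ≡ u ++ v′ ++ v ++ w
swapBlocks-++ u v v′ w e f g
  rewrite proj₁ (take-++-length u {v ++ v′ ++ w} e) | proj₂ (take-++-length u {v ++ v′ ++ w} e)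
        | proj₁ (take-++-length v {v′ ++ w} f) | proj₂ (take-++-length v {v′ ++ w} f)
        | proj₁ (take-++-length v′ {w} g) | proj₂ (take-++-length v′ {w} g) = refl

count-swap : ∀ j u v v′ w → count j (u ++ v ++ v′ ++ w) ≡ count j (u ++ v′ ++ v ++ w)
count-swap j u v v′ w
  rewrite count-++ j u (v ++ v′ ++ w) | count-++ j u (v′ ++ v ++ w) | count-++ j v (v′ ++ w)
        | count-++ j v′ (v ++ w) | count-++ j v w | count-++ j v′ w
        | sym (+-assoc (count j v) (count j v′) (count j w))
        | sym (+-assoc (count j v′) (count j v) (count j w))
        | +-comm (count j v) (count j v′) = refl

-- The exchange at the first ascent

module Exchange (pre : List ℕ) (p q : ℕ) (bs : List ℕ) (p<q : p < q) (decr : Decreasing (pre ++ p ∷ [])) where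

  i : ℕ
  i = suc (length pre)

  front highs : Word
  front = sup 1 pre ++ replicate p i
  highs = replicate p (suc i)

  xWord yWord : Word → Word → Word
  xWord x c = front ++ highs ++ x ++ c
  yWord x c = front ++ x ++ highs ++ c

  record Split (word : Word → Word → Word) (k : ℕ) (w : Word) : Set where
    constructor split
    field
      x c        : Word
      eq         : w ≡ word x c
      length-x   : length x ≡ q ∸ p
      decreasing : Decreasing x
      letters    : Letters k x
      rows       : Rows (suc (suc i)) bs c

  -- `X` and `Y` describe the key words for the weight with the ascent `p < q` and for the exchanged
  -- weight. `G` is the part of `X` that corresponds to `Y` under the exchange.
  X Y G : Word → Set
  X w = Split xWord (suc i) w × cells [] w ≡ keyCells (pre ++ p ∷ q ∷ bs)
  G w = Split xWord i       w × cells [] w ≡ keyCells (pre ++ p ∷ q ∷ bs)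
  Y w = Split yWord i       w × cells [] w ≡ keyCells (pre ++ q ∷ p ∷ bs)

  start : Flat 0 (firstOf pre p) []
  start = empty

  P₀ : Tableau
  P₀ = run [] (sup 1 pre)

  flat₀ : Flat (length pre) p P₀
  flat₀ = proj₁ (sup-run 0 pre p decr start)

  record AfterFront : Set where
    field
      R       : Tableau
      run-eq  : run P₀ (replicate p i) ≡ replicate p (seg 1 i) ++ R
      cell-eq : cells [] front ≡ keyCells pre ++ seg 0 p

  afterFront : AfterFront
  afterFront with flat-run flat₀
  ... | g , e = go g refl
    where
    -- `Flat` can be matched only for a variable tableau; the equation remembers which tableau it
    -- was.
    go : ∀ {Q} → Flat i p Q → Q ≡ run P₀ (replicate p i) → AfterFront
    go (flat R) e′ = record
      { R = R
      ; run-eq = sym e′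
      ; cell-eq = trans (cells-++ [] (sup 1 pre) (replicate p i)) (cong₂ _++_ (proj₂ (sup-run 0 pre p decr start)) e)
      }

  open AfterFront afterFront

  P₁ : Tableau
  P₁ = replicate p (seg 1 i) ++ R

  run-front : run [] front ≡ P₁
  run-front = trans (run-++ [] (sup 1 pre) (replicate p i)) run-eq

  cells-front : ∀ w → cells [] (front ++ w) ≡ (keyCells pre ++ seg 0 p) ++ cells P₁ w
  cells-front w = trans (cells-++ [] front w) (cong₂ _++_ cell-eq (cong (λ Q → cells Q w) run-front))

  seg-q : seg 0 q ≡ seg 0 p ++ seg p (q ∸ p)
  seg-q = trans (cong (seg 0) (sym (m+[n∸m]≡n (<⇒≤ p<q)))) (seg-+ 0 p (q ∸ p))

  keyCells-X : keyCells (pre ++ p ∷ q ∷ bs) ≡ (keyCells pre ++ seg 0 p) ++ seg 0 p ++ seg p (q ∸ p) ++ keyCells bs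
  keyCells-X = begin
    keyCells (pre ++ p ∷ q ∷ bs)                                           ≡⟨ keyCells-++ pre (p ∷ q ∷ bs) ⟩
    keyCells pre ++ seg 0 p ++ seg 0 q ++ keyCells bs                      ≡⟨ cong (λ s → keyCells pre ++ seg 0 p ++ s ++ keyCells bs) seg-q ⟩
    keyCells pre ++ seg 0 p ++ (seg 0 p ++ seg p (q ∸ p)) ++ keyCells bs   ≡⟨ cong (λ s → keyCells pre ++ seg 0 p ++ s) (++-assoc (seg 0 p) _ _) ⟩
    keyCells pre ++ seg 0 p ++ seg 0 p ++ seg p (q ∸ p) ++ keyCells bs     ≡⟨ ++-assoc (keyCells pre) (seg 0 p) _ ⟨
    (keyCells pre ++ seg 0 p) ++ seg 0 p ++ seg p (q ∸ p) ++ keyCells bs   ∎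
    where open ≡-Reasoning

  keyCells-Y : keyCells (pre ++ q ∷ p ∷ bs) ≡ (keyCells pre ++ seg 0 p) ++ seg p (q ∸ p) ++ seg 0 p ++ keyCells bs
  keyCells-Y = begin
    keyCells (pre ++ q ∷ p ∷ bs)                                           ≡⟨ keyCells-++ pre (q ∷ p ∷ bs) ⟩
    keyCells pre ++ seg 0 q ++ seg 0 p ++ keyCells bs                      ≡⟨ cong (λ s → keyCells pre ++ s ++ seg 0 p ++ keyCells bs) seg-q ⟩
    keyCells pre ++ (seg 0 p ++ seg p (q ∸ p)) ++ seg 0 p ++ keyCells bs   ≡⟨ cong (keyCells pre ++_) (++-assoc (seg 0 p) _ _) ⟩
    keyCells pre ++ seg 0 p ++ seg p (q ∸ p) ++ seg 0 p ++ keyCells bs     ≡⟨ ++-assoc (keyCells pre) (seg 0 p) _ ⟨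
    (keyCells pre ++ seg 0 p) ++ seg p (q ∸ p) ++ seg 0 p ++ keyCells bs   ∎
    where open ≡-Reasoning

  -- Both orders of the blocks lead here: `highs` extends the first `p` columns and `x` passes them
  -- into `R`, whether they still have height `i` or already height `suc i`.
  P₃ : Word → Tableau
  P₃ x = replicate p (seg 1 (suc i)) ++ run R x

  cells-x : ∀ x c → Letters i x → cells P₁ (highs ++ x ++ c) ≡ seg 0 p ++ map (p +_) (cells R x) ++ cells (P₃ x) c
  cells-x x c a with stage-run i 0 p R | passes-word p R x (letters-weaken (n≤1+n i) a)
  ... | e , e′ | f , f′
    rewrite cells-++ P₁ highs (x ++ c) | e | e′ | cells-++ (replicate p (seg 1 (suc i)) ++ R) x c | f | f′ = refl

  cells-y : ∀ x c → Letters i x → cells P₁ (x ++ highs ++ c) ≡ map (p +_) (cells R x) ++ seg 0 p ++ cells (P₃ x) c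
  cells-y x c a with stage-run i 0 p (run R x) | passes-word p R x a
  ... | e , e′ | f , f′
    rewrite cells-++ P₁ x (highs ++ c) | f | f′ | cells-++ (replicate p (seg 1 i) ++ run R x) highs c | e | e′ = refl

  length-passed : ∀ x → length x ≡ q ∸ p → length (map (p +_) (cells R x)) ≡ length (seg p (q ∸ p))
  length-passed x l = trans (length-map (p +_) (cells R x)) (trans (length-cells R x) (trans l (sym (length-seg p (q ∸ p)))))

  -- The two orders create the same cells for each block and for `c`, so cancelling the blocks on
  -- one side and assembling them in the other order suffices.
  x⇒y : ∀ x c → length x ≡ q ∸ p → Letters i x →
    cells [] (xWord x c) ≡ keyCells (pre ++ p ∷ q ∷ bs) → cells [] (yWord x c) ≡ keyCells (pre ++ q ∷ p ∷ bs)
  x⇒y x c l a e with ++-cancelˡ (keyCells pre ++ seg 0 p) _ _ (trans (sym (cells-front (highs ++ x ++ c))) (trans e keyCells-X))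
  ... | e₁ with ++-cancelˡ (seg 0 p) _ _ (trans (sym (cells-x x c a)) e₁)
  ...   | e₂ with ++-injective (map (p +_) (cells R x)) (seg p (q ∸ p)) (length-passed x l) e₂
  ...     | e₃ , e₄ = trans (cells-front (x ++ highs ++ c)) (trans (cong ((keyCells pre ++ seg 0 p) ++_)
                        (trans (cells-y x c a) (cong₂ (λ s t → s ++ seg 0 p ++ t) e₃ e₄))) (sym keyCells-Y))

  y⇒x : ∀ x c → length x ≡ q ∸ p → Letters i x →
    cells [] (yWord x c) ≡ keyCells (pre ++ q ∷ p ∷ bs) → cells [] (xWord x c) ≡ keyCells (pre ++ p ∷ q ∷ bs)
  y⇒x x c l a e with ++-cancelˡ (keyCells pre ++ seg 0 p) _ _ (trans (sym (cells-front (x ++ highs ++ c))) (trans e keyCells-Y))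
  ... | e₁ with ++-injective (map (p +_) (cells R x)) (seg p (q ∸ p)) (length-passed x l) (trans (sym (cells-y x c a)) e₁)
  ...   | e₃ , e₂ with ++-cancelˡ (seg 0 p) _ _ e₂
  ...     | e₄ = trans (cells-front (highs ++ x ++ c)) (trans (cong ((keyCells pre ++ seg 0 p) ++_)
                        (trans (cells-x x c a) (cong₂ (λ s t → seg 0 p ++ s ++ t) e₃ e₄))) (sym keyCells-X))

  swap↓ swap↑ : Word → Word
  swap↓ = swapBlocks (length front) (q ∸ p) p
  swap↑ = swapBlocks (length front) p (q ∸ p)

  swap↓-y : ∀ x c → length x ≡ q ∸ p → swap↓ (yWord x c) ≡ xWord x c
  swap↓-y x c l = swapBlocks-++ front x highs c refl l (length-replicate p)

  swap↑-x : ∀ x c → length x ≡ q ∸ p → swap↑ (xWord x c) ≡ yWord x c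
  swap↑-x x c l = swapBlocks-++ front highs x c refl (length-replicate p) l

  Y⇒G : ∀ {w} → Y w → G (swap↓ w)
  Y⇒G (split x c refl l d a r , e) rewrite swap↓-y x c l = split x c refl l d a r , y⇒x x c l a e

  G⇒Y : ∀ {w} → G w → Y (swap↑ w)
  G⇒Y (split x c refl l d a r , e) rewrite swap↑-x x c l = split x c refl l d a r , x⇒y x c l a e

  swap↑∘swap↓ : ∀ {w} → Y w → swap↑ (swap↓ w) ≡ w
  swap↑∘swap↓ (split x c refl l d a r , e) rewrite swap↓-y x c l = swap↑-x x c l

  swap↓∘swap↑ : ∀ {w} → G w → swap↓ (swap↑ w) ≡ w
  swap↓∘swap↑ (split x c refl l d a r , e) rewrite swap↑-x x c l = swap↓-y x c l

  count-swap↓ : ∀ j {w} → Y w → count j (swap↓ w) ≡ count j w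
  count-swap↓ j (split x c refl l d a r , e) rewrite swap↓-y x c l = count-swap j front highs x c

  G⇒X : ∀ {w} → G w → X w
  G⇒X (split x c eq l d a r , e) = split x c eq l d (letters-weaken (n≤1+n i) a) r , e

  X⇒KeyWord : ∀ {w} → X w → KeyWord (pre ++ p ∷ q ∷ bs) w
  X⇒KeyWord (split x c refl l d a r , e) = subst (Rows 1 _) (sym (++-assoc (sup 1 pre) (replicate p i) _))
    (sup-rows 0 pre (replicate p i , _ , refl , row-replicate p (length pre) ,
      highs ++ x , c , sym (++-assoc highs x c) ,
      (trans (length-++ highs) (trans (cong₂ _+_ (length-replicate p) l) (m+[n∸m]≡n (<⇒≤ p<q)))
      , decreasing-replicate-++ p (suc i) (All.map proj₂ a) d
      , All.++⁺ (letters-replicate p (s≤s z≤n) ≤-refl) a) , r)) , e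

  Y⇒KeyWord : ∀ {w} → Y w → KeyWord (pre ++ q ∷ p ∷ bs) w
  Y⇒KeyWord (split x c refl l d a r , e) = subst (Rows 1 _) (sym (++-assoc (sup 1 pre) (replicate p i) _))
    (sup-rows 0 pre (replicate p i ++ x , _ , sym (++-assoc (replicate p i) x _) ,
      (trans (length-++ (replicate p i)) (trans (cong₂ _+_ (length-replicate p) l) (m+[n∸m]≡n (<⇒≤ p<q)))
      , decreasing-replicate-++ p i (All.map proj₂ a) d
      , All.++⁺ (letters-replicate p (s≤s z≤n) ≤-refl) a) ,
      highs , c , refl , row-replicate p i , r)) , e

  -- The first `p` letters of row `suc i` extend the `p` columns of height `i`, hence are forced by
  -- `stage-forced`; what remains of this row is `x`.
  KeyWord⇒X : ∀ {w} → KeyWord (pre ++ p ∷ q ∷ bs) w → X w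
  KeyWord⇒X (rows , e) with sup-forced 0 pre p decr start rows e
  ... | _ , refl , (r₁ , _ , refl , (l₁ , _ , a₁) , r₂ , c , refl , (l₂ , d₂ , a₂) , rs) , e₁
    with cells-split P₀ r₁ (r₂ ++ c) {seg 0 p} (trans l₁ (sym (length-seg 0 p))) e₁
  ...   | e₂ , e₃ with splitLength {p} {q} r₂ (<⇒≤ p<q) l₂
  ...     | u , x , refl , lu , lx with flat-forced flat₀ a₁ l₁ e₂
  ...       | refl
    with cells-split P₁ u (x ++ c) {seg 0 p} (trans lu (sym (length-seg 0 p)))
           (trans (cong (cells P₁) (sym (++-assoc u x c))) (trans (sym (cong (λ Q → cells Q _) run-eq))
           (trans e₃ (trans (cong (_++ keyCells bs) seg-q) (++-assoc (seg 0 p) _ _)))))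
  ...         | e₄ , _ with stage-forced i 0 p R u (All.++⁻ˡ u a₂) lu e₄
  ...           | refl = split x c regroup lx (decreasing-drop highs d₂) (All.++⁻ʳ highs a₂) rs , e
    where
    regroup : sup 1 pre ++ replicate p i ++ (highs ++ x) ++ c ≡ xWord x c
    regroup = trans (cong (λ v → sup 1 pre ++ replicate p i ++ v) (++-assoc highs x c))
                    (sym (++-assoc (sup 1 pre) (replicate p i) _))

  -- Row `i` is forced in its first `p` letters and continues with `x`. As `x` passes the first `p`
  -- columns, these still have height `i` when row `suc i` arrives, and all of that row is forced.
  KeyWord⇒Y : ∀ {w} → KeyWord (pre ++ q ∷ p ∷ bs) w → Y w
  KeyWord⇒Y (rows , e) with sup-forced 0 pre p decr start rows e
  ... | _ , refl , (r₁ , _ , refl , (l₁ , d₁ , a₁) , r₂ , c , refl , (l₂ , d₂ , a₂) , rs) , e₁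
    with splitLength r₁ (<⇒≤ p<q) l₁
  ...   | u , x , refl , lu , lx
    with cells-split P₀ u (x ++ r₂ ++ c) {seg 0 p} (trans lu (sym (length-seg 0 p)))
           (trans (cong (cells P₀) (sym (++-assoc u x (r₂ ++ c))))
           (trans e₁ (trans (cong (_++ (seg 0 p ++ keyCells bs)) seg-q) (++-assoc (seg 0 p) _ _))))
  ...     | e₂ , e₃ with flat-forced flat₀ (All.++⁻ˡ u a₁) lu e₂ | All.++⁻ʳ u a₁
  ...       | refl | ax with cells-split P₁ x (r₂ ++ c) {seg p (q ∸ p)} (trans lx (sym (length-seg p (q ∸ p))))
                             (trans (sym (cong (λ Q → cells Q _) run-eq)) e₃)
  ...         | _ , e₄ with cells-split (run P₁ x) r₂ c {seg 0 p} (trans l₂ (sym (length-seg 0 p))) e₄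
  ...           | e₅ , _ with stage-forced i 0 p (run R x) r₂ a₂ l₂
                               (trans (cong (λ Q → cells Q r₂) (sym (proj₁ (passes-word p R x ax)))) e₅)
  ...             | refl = split x c regroup lx (decreasing-drop (replicate p i) d₁) ax rs , e
    where
    regroup : sup 1 pre ++ (replicate p i ++ x) ++ highs ++ c ≡ yWord x c
    regroup = trans (cong (sup 1 pre ++_) (++-assoc (replicate p i) x _))
                    (sym (++-assoc (sup 1 pre) (replicate p i) _))

-- Crystal operators on factored words

module CrystalRows (i : ℕ) where
  open Crystal i

  -- A letter `i` directly in front of the raised one would be an unmatched opening bracket on its
  -- left.
  decreasing-raise : ∀ {k l r r′} → Step k l r r′ → Decreasing r → Decreasing r′
  decreasing-raise (here {v = []} _ _) _ = [-]
  decreasing-raise (here {v = _ ∷ _} _ _) (p ∷ d) = m≤n⇒m≤1+n p ∷ d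
  decreasing-raise (there {w = []} ()) d
  decreasing-raise (there {x = x} (here e q)) (i≤x ∷ d) with m≤n⇒m<n∨m≡n i≤x
  ... | inj₁ i<x = i<x ∷ decreasing-raise (here refl q) d
  ... | inj₂ refl = contradiction e (suc≢0 (open-opening _))
  decreasing-raise (there s@(there _)) (p ∷ d) = p ∷ decreasing-raise s d

  -- A letter `suc i` directly behind the lowered one would be an unmatched closing bracket on its
  -- right.
  decreasing-lower : ∀ {k l r r′} → Step k l r′ r → Decreasing r → Decreasing r′
  decreasing-lower (here {v = []} _ _) _ = [-]
  decreasing-lower (here {v = y ∷ v} _ q) (p ∷ d) with m≤n⇒m<n∨m≡n p
  ... | inj₁ y<si = s≤s⁻¹ y<si ∷ d
  ... | inj₂ refl = contradiction q (suc≢0 (close-closing _))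
  decreasing-lower (there {w′ = []} ()) d
  decreasing-lower (there s@(here _ _)) (p ∷ d) = ≤-trans (n≤1+n i) p ∷ decreasing-lower s d
  decreasing-lower (there s@(there _)) (p ∷ d) = p ∷ decreasing-lower s d

  letters-raise : ∀ {k l m r r′} → suc i ≤ m → Step k l r r′ → Letters m r → Letters m r′
  letters-raise si≤m (here _ _) (_ ∷ a) = (s≤s z≤n , si≤m) ∷ a
  letters-raise si≤m (there s)  (p ∷ a) = p ∷ letters-raise si≤m s a

  letters-lower : ∀ {k l m r r′} → 1 ≤ i → Step k l r′ r → Letters m r → Letters m r′
  letters-lower 1≤i (here _ _) ((_ , q) ∷ a) = (1≤i , <⇒≤ q) ∷ a
  letters-lower 1≤i (there s)  (p ∷ a) = p ∷ letters-lower 1≤i s a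

  -- The bound `suc i ≤ m` restricts this to rows in which `suc i` is allowed. The rows in front of
  -- them are protected by being matched, see `prefix-fixed↑`.
  rows-raise : ∀ {k l m w w′} bs → suc i ≤ m → Step k l w w′ → Rows m bs w → Rows m bs w′
  rows-raise [] _ () refl
  rows-raise (b ∷ bs) si≤m s (r , v , refl , (e , d , a) , rs) with split↑ r s
  ... | inj₁ (r′ , refl , t) = r′ , v , refl ,
          (trans (sym (step-length t)) e , decreasing-raise t d , letters-raise si≤m t a) , rs
  ... | inj₂ (v′ , refl , t) = r , v′ , refl , (e , d , a) , rows-raise bs (m≤n⇒m≤1+n si≤m) t rs

  rows-lower : ∀ {k l m w w′} bs → 1 ≤ i → Step k l w′ w → Rows m bs w → Rows m bs w′
  rows-lower [] _ () refl
  rows-lower (b ∷ bs) 1≤i s (r , v , refl , (e , d , a) , rs) with split↓ r s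
  ... | inj₁ (r′ , refl , t) = r′ , v , refl ,
          (trans (step-length t) e , decreasing-lower t d , letters-lower 1≤i t a) , rs
  ... | inj₂ (v′ , refl , t) = r , v′ , refl , (e , d , a) , rows-lower bs 1≤i t rs

  -- Strings

  infix 4 _⟶*_
  data _⟶*_ (t : Word) : Word → Set where
    stop : t ⟶* t
    _▸_  : ∀ {w w′} → t ⟶* w → Step 0 0 w w′ → t ⟶* w′

  _◂_ : ∀ {t t′ w} → Step 0 0 t t′ → t′ ⟶* w → t ⟶* w
  s ◂ stop    = stop ▸ s
  s ◂ (c ▸ u) = (s ◂ c) ▸ u

  IsTop : Word → Set
  IsTop w = ε w 0 ≡ 0

  notTop : ∀ {w w′} → Step 0 0 w w′ → ¬ IsTop w′
  notTop s e = contradiction (trans (sym (proj₂ (ε-step s))) e) λ ()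

  top-unique : ∀ {t t′ w} → IsTop t → IsTop t′ → t ⟶* w → t′ ⟶* w → t ≡ t′
  top-unique e e′ stop    stop    = refl
  top-unique e e′ stop    (c ▸ s) = contradiction e (notTop s)
  top-unique e e′ (c ▸ s) stop    = contradiction e′ (notTop s)
  top-unique e e′ (c ▸ s) (d ▸ s′) with step-injective s s′
  ... | refl = top-unique e e′ c d

  top : ∀ w → ∃ λ t → IsTop t × t ⟶* w
  top w = go (ε w 0) w refl
    where
    go : ∀ n w → ε w 0 ≡ n → ∃ λ t → IsTop t × t ⟶* w
    go zero    w e = w , e , stop
    go (suc n) w e with lower 0 w (subst (0 <_) (sym e) (s≤s z≤n))
    ... | w′ , s with go n w′ (suc-injective (trans (sym (proj₂ (ε-step s))) e))
    ...   | t , p , c = t , p , c ▸ s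

  ⟶*-closed : ∀ {P : Word → Set} → (∀ {w w′} → Step 0 0 w w′ → P w → P w′) → ∀ {t w} → t ⟶* w → P t → P w
  ⟶*-closed f stop    p = p
  ⟶*-closed f (c ▸ s) p = f s (⟶*-closed f c p)

  ⟶*-closed⁻ : ∀ {P : Word → Set} → (∀ {w w′} → Step 0 0 w w′ → P w′ → P w) → ∀ {t w} → t ⟶* w → P w → P t
  ⟶*-closed⁻ f stop    p = p
  ⟶*-closed⁻ {P} f (c ▸ s) p = ⟶*-closed⁻ {P} f c (f s p)

  -- Each raising lowers `φ 0` by one, so `n` counts the raisings left and makes the recursion
  -- structural.
  string : ∀ n w → φ 0 w ≡ n → List Word
  string zero    w e = w ∷ []
  string (suc n) w e with raise 0 w z≤n (subst (0 <_) (sym e) (s≤s z≤n))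
  ... | w′ , s = w ∷ string n w′ (suc-injective (trans (sym (φ-step s)) e))

  string-reached : ∀ n t e {w} → w ∈ string n t e → t ⟶* w
  string-reached zero    t e (here refl) = stop
  string-reached (suc n) t e w∈ with raise 0 t z≤n (subst (0 <_) (sym e) (s≤s z≤n)) | w∈
  ... | _      | here refl = stop
  ... | t′ , s | there w∈′ = s ◂ string-reached n t′ _ w∈′

  head-∈-string : ∀ n t e → t ∈ string n t e
  head-∈-string zero    t e = here refl
  head-∈-string (suc n) t e with raise 0 t z≤n (subst (0 <_) (sym e) (s≤s z≤n))
  ... | _ = here refl

  string-closed : ∀ n t e {w w′} → w ∈ string n t e → Step 0 0 w w′ → w′ ∈ string n t e
  string-closed zero    t e (here refl) s = contradiction (trans (sym (φ-step s)) e) λ ()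
  string-closed (suc n) t e w∈ s with raise 0 t z≤n (subst (0 <_) (sym e) (s≤s z≤n)) | w∈
  ... | t′ , s′ | here refl with step-functional s s′
  ...   | refl = there (head-∈-string n t′ _)
  string-closed (suc n) t e w∈ s | t′ , s′ | there w∈′ = there (string-closed n t′ _ w∈′ s)

  reached-string : ∀ n t e {w} → t ⟶* w → w ∈ string n t e
  reached-string n t e stop    = head-∈-string n t e
  reached-string n t e (c ▸ s) = string-closed n t e (reached-string n t e c) s

  ε-reached : ∀ {t w} → t ⟶* w → ε t 0 ≤ ε w 0
  ε-reached stop    = ≤-refl
  ε-reached (c ▸ s) = ≤-trans (ε-reached c) (≤-trans (n≤1+n _) (≤-reflexive (sym (proj₂ (ε-step s)))))

  string-unique : ∀ n t e → Unique (string n t e)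
  string-unique zero    t e = [] ∷ []
  string-unique (suc n) t e with raise 0 t z≤n (subst (0 <_) (sym e) (s≤s z≤n))
  ... | t′ , s = All.tabulate (λ {w} w∈ → λ { refl →
          contradiction (≤-trans (≤-reflexive (sym (proj₂ (ε-step s)))) (ε-reached (string-reached n t′ _ w∈))) (<-irrefl refl) })
        ∷ string-unique n t′ _

  fullString : Word → List Word
  fullString t = string (φ 0 t) t refl

  -- A word determines the top of its string, so pieces belonging to different tops are disjoint.
  -- The function `f` is arbitrary in order to cover both whole strings and their parts in `L`.
  concatMap-unique : ∀ {ts} (f : Word → List Word) → All IsTop ts → Unique ts → (∀ {t} → t ∈ ts → Unique (f t)) →
    (∀ {t w} → t ∈ ts → w ∈ f t → t ⟶* w) → Unique (concatMap f ts)
  concatMap-unique {[]} f _ _ _ _ = []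
  concatMap-unique {t ∷ ts} f (p ∷ ps) (a ∷ u) uf r =
    Unique.++⁺ (uf (here refl)) (concatMap-unique f ps u (uf ∘ there) (r ∘ there)) disjoint
    where
    disjoint : Disjoint (f t) (concatMap f ts)
    disjoint (w∈ , w∈′) with find (∈-concatMap⁻ f {xs = ts} w∈′)
    ... | t′ , t′∈ , w∈t′ = All.lookup a t′∈ (top-unique p (All.lookup ps t′∈) (r (here refl) w∈) (r (there t′∈) w∈t′))

  -- The hypotheses say that X is a union of strings and that G contains the top of each
  -- of them, together with all or none of its other elements.
  module Completion (X G : Word → Set)
    (raise-X : ∀ {w w′} → Step 0 0 w w′ → X w → X w′) (lower-X : ∀ {w w′} → Step 0 0 w w′ → X w′ → X w)
    (G⇒X : ∀ {w} → G w → X w) (top-G : ∀ {w} → X w → IsTop w → G w)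
    (lower-G : ∀ {w w′} → Step 0 0 w w′ → G w′ → G w) (raise-G : ∀ {w w′} → Step 0 0 w w′ → ¬ IsTop w → G w → G w′)
    (L : List Word) (L-unique : Unique L) (∈L⇒G : ∀ {w} → w ∈ L → G w) (G⇒∈L : ∀ {w} → G w → w ∈ L) where

    isTop? : Decidable IsTop
    isTop? w = ε w 0 ≟ 0

    tops : List Word
    tops = filter isTop? L

    tops-top : All IsTop tops
    tops-top = All.all-filter isTop? L

    tops-unique : Unique tops
    tops-unique = Unique.filter⁺ isTop? L-unique

    completed : List Word
    completed = concatMap fullString tops

    completed-unique : Unique completed
    completed-unique = concatMap-unique fullString tops-top tops-unique
      (λ {t} _ → string-unique _ t refl) (λ {t} _ → string-reached _ t refl)

    top-of : ∀ {w} → X w → ∃ λ t → t ∈ tops × t ⟶* w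
    top-of {w} x with top w
    ... | t , p , c = t , ∈-filter⁺ isTop? (G⇒∈L (top-G (⟶*-closed⁻ {X} lower-X c x) p)) p , c

    ∈completed⇒X : ∀ {w} → w ∈ completed → X w
    ∈completed⇒X w∈ with find (∈-concatMap⁻ fullString {xs = tops} w∈)
    ... | t , t∈ , w∈t = ⟶*-closed raise-X (string-reached _ t refl w∈t) (G⇒X (∈L⇒G (proj₁ (∈-filter⁻ isTop? t∈))))

    X⇒∈completed : ∀ {w} → X w → w ∈ completed
    X⇒∈completed x with top-of x
    ... | t , t∈ , c = ∈-concatMap⁺ fullString (lose t∈ (reached-string _ t refl c))

    _∈L? : Decidable (_∈ L)
    w ∈L? = Any.any? (≡-dec _≟_ w) L

    whole? : ∀ t → Dec (All (_∈ L) (fullString t))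
    whole? t = All.all? _∈L? (fullString t)

    -- What `L` contains of the string of a top. The distinction is made through `L`, for which
    -- membership is decidable, while `G` is only a predicate.
    part : Word → List Word
    part t with whole? t
    ... | yes _ = fullString t
    ... | no _  = t ∷ []

    partitioned : List Word
    partitioned = concatMap part tops

    part-reached : ∀ t {w} → w ∈ part t → t ⟶* w
    part-reached t w∈ with whole? t
    part-reached t w∈          | yes _ = string-reached _ t refl w∈
    part-reached t (here refl) | no _  = stop

    part-unique : ∀ t → Unique (part t)
    part-unique t with whole? t
    ... | yes _ = string-unique _ t refl
    ... | no _  = [] ∷ []

    partitioned-unique : Unique partitioned
    partitioned-unique = concatMap-unique part tops-top tops-unique (λ {t} _ → part-unique t) (λ {t} _ → part-reached t)

    ∈partitioned⇒∈L : ∀ {w} → w ∈ partitioned → w ∈ L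
    ∈partitioned⇒∈L w∈ with find (∈-concatMap⁻ part {xs = tops} w∈)
    ... | t , t∈ , w∈t with whole? t
    ...   | yes a = All.lookup a w∈t
    ∈partitioned⇒∈L w∈ | t , t∈ , here refl | no _ = proj₁ (∈-filter⁻ isTop? t∈)

    -- One word of `G` beyond the top is enough: `lower-G` leads from it back to the second word of
    -- the string, and `raise-G`, which does not apply to the top, leads from there to all later
    -- words.
    whole : ∀ {t w w′} → G t → t ⟶* w → Step 0 0 w w′ → G w′ → All (_∈ L) (fullString t)
    whole {t} Gt c s Gw′ = All.tabulate λ w∈ → G⇒∈L (reached-G (string-reached _ t refl w∈))
      where
      second : ∀ {w w′} → t ⟶* w → Step 0 0 w w′ → G w′ → ∃ λ t′ → Step 0 0 t t′ × G t′
      second stop    s g = _ , s , g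
      second (c ▸ r) s g = second c r (lower-G s g)
      reached-G : ∀ {u} → t ⟶* u → G u
      reached-G stop = Gt
      reached-G (stop ▸ r) with second c s Gw′
      ... | t′ , r′ , g with step-functional r r′
      ...   | refl = g
      reached-G (c′@(_ ▸ r₀) ▸ r) = raise-G r (notTop r₀) (reached-G c′)

    ∈L⇒∈partitioned : ∀ {w} → w ∈ L → w ∈ partitioned
    ∈L⇒∈partitioned {w} w∈ with top-of (G⇒X (∈L⇒G w∈))
    ... | t , t∈ , c = ∈-concatMap⁺ part (lose t∈ (w∈part c))
      where
      w∈part : t ⟶* w → w ∈ part t
      w∈part c with whole? t
      ... | yes _ = reached-string _ t refl c
      w∈part stop    | no _ = here refl
      w∈part (c ▸ s) | no n = contradiction (whole (∈L⇒G (proj₁ (∈-filter⁻ isTop? t∈))) c s (∈L⇒G w∈)) n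

sup-bounded : ∀ k bs → All (_< k + length bs) (sup k bs)
sup-bounded k []       = []
sup-bounded k (b ∷ bs) rewrite +-suc k (length bs) =
  All.++⁺ (All.replicate⁺ b (s≤s (m≤m+n k (length bs)))) (sup-bounded (suc k) bs)

-- Strings of the words at the first ascent

module ExchangeStrings (pre : List ℕ) (p q : ℕ) (bs : List ℕ) (p<q : p < q) (decr : Decreasing (pre ++ p ∷ [])) where
  open Exchange pre p q bs p<q decr
  open Crystal i
  open CrystalRows i

  prefix : Word
  prefix = front ++ highs

  xWord≡ : ∀ x c → xWord x c ≡ prefix ++ x ++ c
  xWord≡ x c = sym (++-assoc front highs (x ++ c))

  ε-opens : ∀ m l → ε (replicate m i) l ≡ l ∸ m
  ε-opens zero    l = refl
  ε-opens (suc m) l = trans (close-opening _) (trans (cong (_∸ 1) (ε-opens m l))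
    (trans (∸-+-assoc l m 1) (cong (l ∸_) (+-comm m 1))))

  ε-closes : ∀ m l → ε (replicate m (suc i)) l ≡ m + l
  ε-closes zero    l = refl
  ε-closes (suc m) l = trans (close-closing _) (cong suc (ε-closes m l))

  φ-opens : ∀ m k → φ k (replicate m i) ≡ m + k
  φ-opens zero    k = refl
  φ-opens (suc m) k = trans (cong (λ k → φ k (replicate m i)) (open-opening k)) (trans (φ-opens m (suc k)) (+-suc m k))

  φ-closes : ∀ m k → φ k (replicate m (suc i)) ≡ k ∸ m
  φ-closes zero    k = refl
  φ-closes (suc m) k = trans (cong (λ k → φ k (replicate m (suc i))) (open-closing k))
    (trans (φ-closes m (k ∸ 1)) (∸-+-assoc k 1 m))

  sup-neutral : All Neutral (sup 1 pre)
  sup-neutral = All.map small-neutral (sup-bounded 1 pre)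

  -- The `p` letters `i` in `front` are closed by the `p` letters of `highs`, and the letters before
  -- them are smaller; so the prefix is invisible to the brackets behind it.
  ε-prefix : ∀ l → ε prefix l ≡ l
  ε-prefix l = begin
    ε prefix l                                     ≡⟨ ε-++ front highs l ⟩
    ε front (ε highs l)                            ≡⟨ ε-++ (sup 1 pre) (replicate p i) _ ⟩
    ε (sup 1 pre) (ε (replicate p i) (ε highs l))  ≡⟨ ε-neutral sup-neutral _ ⟩
    ε (replicate p i) (ε highs l)                  ≡⟨ ε-opens p _ ⟩
    ε highs l ∸ p                                  ≡⟨ cong (_∸ p) (ε-closes p l) ⟩
    p + l ∸ p                                      ≡⟨ m+n∸m≡n p l ⟩
    l                                              ∎
    where open ≡-Reasoning

  φ-prefix : φ 0 prefix ≡ 0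
  φ-prefix = begin
    φ 0 prefix                                     ≡⟨ φ-++ 0 front highs ⟩
    φ (φ 0 front) highs                            ≡⟨ φ-closes p _ ⟩
    φ 0 front ∸ p                                  ≡⟨ cong (_∸ p) (φ-++ 0 (sup 1 pre) (replicate p i)) ⟩
    φ (φ 0 (sup 1 pre)) (replicate p i) ∸ p        ≡⟨ cong (_∸ p) (φ-opens p _) ⟩
    p + φ 0 (sup 1 pre) ∸ p                        ≡⟨ m+n∸m≡n p _ ⟩
    φ 0 (sup 1 pre)                                ≡⟨ φ-neutral sup-neutral 0 ⟩
    0                                              ∎
    where open ≡-Reasoning

  closeBy-mono : ∀ {x} (κ : Kind x) {l l′} → l ≤ l′ → closeBy κ l ≤ closeBy κ l′
  closeBy-mono opening       = ∸-monoˡ-≤ 1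
  closeBy-mono closing       = s≤s
  closeBy-mono (neutral _ _) l≤ = l≤

  ε-mono : ∀ v {l l′} → l ≤ l′ → ε v l ≤ ε v l′
  ε-mono []      l≤ = l≤
  ε-mono (x ∷ v) l≤ = closeBy-mono (kind x) (ε-mono v l≤)

  -- Fewer closing brackets on the right leave fewer unmatched ones, by `ε-mono`. This gives a step
  -- of the prefix the form that `φ-step` requires.
  step-uncontext : ∀ {k l w w′} → Step k l w w′ → Step k 0 w w′
  step-uncontext (here {v = v} e e′) = here e (n≤0⇒n≡0 (≤-trans (ε-mono v z≤n) (≤-reflexive e′)))
  step-uncontext (there s)           = there (step-uncontext s)

  prefix-fixed↑ : ∀ {l U} → ¬ Step 0 l prefix U
  prefix-fixed↑ s = contradiction (trans (sym φ-prefix) (φ-step (step-uncontext s))) λ ()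

  prefix-fixed↓ : ∀ {l U} → ¬ Step 0 l U prefix
  prefix-fixed↓ s = contradiction (trans (sym (ε-prefix 0)) (proj₂ (ε-step (step-uncontext s)))) λ ()

  data Raised (x c w′ : Word) : Set where
    raised-x : ∀ {x′} → w′ ≡ xWord x′ c → Step 0 (ε c 0) x x′ → Raised x c w′
    raised-c : ∀ {c′} → w′ ≡ xWord x c′ → Step (φ 0 x) 0 c c′ → Raised x c w′

  raised : ∀ x c {w′} → Step 0 0 (xWord x c) w′ → Raised x c w′
  raised x c {w′} s with split↑ prefix (subst (λ w → Step 0 0 w w′) (xWord≡ x c) s)
  ... | inj₁ (_ , _ , t) = contradiction t prefix-fixed↑
  ... | inj₂ (_ , refl , t) with split↑ x (Step-cong φ-prefix refl t)
  ...   | inj₁ (x′ , refl , r) = raised-x (sym (xWord≡ x′ c)) r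
  ...   | inj₂ (c′ , refl , r) = raised-c (sym (xWord≡ x c′)) r

  data Lowered (x c w′ : Word) : Set where
    lowered-x : ∀ {x′} → w′ ≡ xWord x′ c → Step 0 (ε c 0) x′ x → Lowered x c w′
    lowered-c : ∀ {c′} → w′ ≡ xWord x c′ → Step (φ 0 x) 0 c′ c → Lowered x c w′

  lowered : ∀ x c {w′} → Step 0 0 w′ (xWord x c) → Lowered x c w′
  lowered x c {w′} s with split↓ prefix (subst (λ w → Step 0 0 w′ w) (xWord≡ x c) s)
  ... | inj₁ (_ , _ , t) = contradiction t prefix-fixed↓
  ... | inj₂ (_ , refl , t) with split↓ x (Step-cong φ-prefix refl t)
  ...   | inj₁ (x′ , refl , r) = lowered-x (sym (xWord≡ x′ c)) r
  ...   | inj₂ (c′ , refl , r) = lowered-c (sym (xWord≡ x c′)) r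

  ε-xWord : ∀ x c → ε (xWord x c) 0 ≡ ε x (ε c 0)
  ε-xWord x c = trans (cong (λ w → ε w 0) (xWord≡ x c)) (trans (ε-++ prefix (x ++ c) 0)
    (trans (ε-prefix _) (ε-++ x c 0)))

  raise-X : ∀ {w w′} → Step 0 0 w w′ → X w → X w′
  raise-X s (split x c refl l d a r , e) with raised x c s
  ... | raised-x refl t = split _ c refl (trans (sym (step-length t)) l) (decreasing-raise t d)
                            (letters-raise ≤-refl t a) r , trans (sym (step-cells s)) e
  ... | raised-c refl t = split x _ refl l d a (rows-raise bs (n≤1+n _) t r) , trans (sym (step-cells s)) e

  lower-X : ∀ {w w′} → Step 0 0 w w′ → X w′ → X w
  lower-X s (split x c refl l d a r , e) with lowered x c s
  ... | lowered-x refl t = split _ c refl (trans (step-length t) l) (decreasing-lower t d)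
                             (letters-lower (s≤s z≤n) t a) r , trans (step-cells s) e
  ... | lowered-c refl t = split x _ refl l d a (rows-lower bs (s≤s z≤n) t r) , trans (step-cells s) e

  decreasing-head : ∀ {m y v} → y ≤ m → Decreasing (y ∷ v) → All (_≤ m) (y ∷ v)
  decreasing-head y≤m [-]     = y≤m ∷ []
  decreasing-head y≤m (p ∷ d) = y≤m ∷ decreasing-head (≤-trans p y≤m) d

  -- If a decreasing `x` contains `suc i`, it starts with it, and this bracket stays unmatched
  -- because the prefix leaves none open.
  top-G : ∀ {w} → X w → IsTop w → G w
  top-G (split x c refl l d a r , e) p = split x c refl l d (bounded x d a (trans (sym (ε-xWord x c)) p)) r , e
    where
    bounded : ∀ x → Decreasing x → Letters (suc i) x → ε x (ε c 0) ≡ 0 → Letters i x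
    bounded []      _ _ _ = []
    bounded (y ∷ x) d a@((_ , y≤si) ∷ _) p with m≤n⇒m<n∨m≡n y≤si
    ... | inj₂ refl      = contradiction p (suc≢0 (close-closing _))
    ... | inj₁ (s≤s y≤i) = All.zipWith (λ { ((q , _) , q′) → q , q′ }) (a , decreasing-head y≤i d)

  -- The letter to be lowered is a `suc i`, which does not occur in `x`; so it lies in `c`.
  lower-G : ∀ {w w′} → Step 0 0 w w′ → G w′ → G w
  lower-G s (split x c refl l d a r , e) with lowered x c s
  ... | lowered-x refl t = contradiction t (no-closing a)
    where
    no-closing : ∀ {k l u v} → Letters i v → ¬ Step k l u v
    no-closing ((_ , si≤i) ∷ _) (here _ _) = <-irrefl refl si≤i
    no-closing (_ ∷ a)          (there s)  = no-closing a s
  ... | lowered-c refl t = split x _ refl l d a (rows-lower bs (s≤s z≤n) t r) , trans (step-cells s) e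

  -- If the raised letter lay in `x`, no closing bracket right of it would be unmatched, and `x` has
  -- no closing bracket of its own: the word would be a top. So only `c` changes.
  raise-G : ∀ {w w′} → Step 0 0 w w′ → ¬ IsTop w → G w → G w′
  raise-G s nt (split x c refl l d a r , e) with raised x c s
  ... | raised-x refl t = contradiction (trans (ε-xWord x c) (no-closing a t)) nt
    where
    closeBy-0 : ∀ {x} (κ : Kind x) → x ≤ i → closeBy κ 0 ≡ 0
    closeBy-0 opening       _    = refl
    closeBy-0 closing       si≤i = contradiction si≤i (<-irrefl refl)
    closeBy-0 (neutral _ _) _    = refl
    no-closing : ∀ {k l u v} → Letters i u → Step k l u v → ε u l ≡ 0
    no-closing _ (here {l = l} {v} _ q) = trans (close-opening (ε v l)) (cong (_∸ 1) q)
    no-closing ((_ , x≤i) ∷ a) (there {x = x} s) = trans (cong (closeBy (kind x)) (no-closing a s)) (closeBy-0 (kind x) x≤i)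
  ... | raised-c refl t = split x _ refl l d a (rows-raise bs (n≤1+n _) t r) , trans (sym (step-cells s)) e

-- Polynomials

≡ᵇ-refl : ∀ x → (x ≡ᵇ x) ≡ true
≡ᵇ-refl zero    = refl
≡ᵇ-refl (suc x) = ≡ᵇ-refl x

eqList-refl : ∀ e → eqList e e ≡ true
eqList-refl []      = refl
eqList-refl (x ∷ e) rewrite ≡ᵇ-refl x = eqList-refl e

eqList⇒≡ : ∀ e f → eqList e f ≡ true → e ≡ f
eqList⇒≡ []      []      _ = refl
eqList⇒≡ (x ∷ e) (y ∷ f) p with x ≡ᵇ y in q
... | true = cong₂ _∷_ (≡ᵇ⇒≡ x y (subst T (sym q) _)) (eqList⇒≡ e f p)

eqList-iff : ∀ {e f e′ f′} → (e ≡ f → e′ ≡ f′) → (e′ ≡ f′ → e ≡ f) → eqList e f ≡ eqList e′ f′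
eqList-iff {e} {f} {e′} {f′} g h with eqList e f in q | eqList e′ f′ in q′
... | true  | true  = refl
... | false | false = refl
... | true  | false = trans (sym (eqList-refl f′)) (trans (cong (λ z → eqList z f′) (sym (g (eqList⇒≡ e f q)))) q′)
... | false | true  = trans (sym q) (trans (cong (λ z → eqList z f) (h (eqList⇒≡ e′ f′ q′))) (eqList-refl f))

Term : Set
Term = ℤ × List ℕ

coeff-∷ : ∀ t p f → coeff (t ∷ p) f ≡ coeff (t ∷ []) f +ℤ coeff p f
coeff-∷ (c , e) p f with eqList e f
... | true  = cong (_+ℤ coeff p f) (sym (ℤ.+-identityʳ c))
... | false = sym (ℤ.+-identityˡ (coeff p f))

coeff-++ : ∀ p q f → coeff (p ++ q) f ≡ coeff p f +ℤ coeff q f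
coeff-++ []      q f = sym (ℤ.+-identityˡ (coeff q f))
coeff-++ (t ∷ p) q f = begin
  coeff (t ∷ p ++ q) f                               ≡⟨ coeff-∷ t (p ++ q) f ⟩
  coeff (t ∷ []) f +ℤ coeff (p ++ q) f               ≡⟨ cong (coeff (t ∷ []) f +ℤ_) (coeff-++ p q f) ⟩
  coeff (t ∷ []) f +ℤ (coeff p f +ℤ coeff q f)       ≡⟨ ℤ.+-assoc (coeff (t ∷ []) f) _ _ ⟨
  (coeff (t ∷ []) f +ℤ coeff p f) +ℤ coeff q f       ≡⟨ cong (_+ℤ coeff q f) (coeff-∷ t p f) ⟨
  coeff (t ∷ p) f +ℤ coeff q f                       ∎
  where open ≡-Reasoning

coeff-map : ∀ c (g : ℕ → List ℕ) ks f → coeff (map (λ k → c , g k) ks) f ≡ c *ℤ coeff (map (λ k → 1ℤ , g k) ks) f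
coeff-map c g []       f = sym (ℤ.*-zeroʳ c)
coeff-map c g (k ∷ ks) f with eqList (g k) f
... | false = coeff-map c g ks f
... | true  = begin
  c +ℤ coeff (map (λ k → c , g k) ks) f              ≡⟨ cong₂ _+ℤ_ (sym (ℤ.*-identityʳ c)) (coeff-map c g ks f) ⟩
  c *ℤ 1ℤ +ℤ c *ℤ coeff (map (λ k → 1ℤ , g k) ks) f  ≡⟨ ℤ.*-distribˡ-+ c 1ℤ _ ⟨
  c *ℤ (1ℤ +ℤ coeff (map (λ k → 1ℤ , g k) ks) f)     ∎
  where open ≡-Reasoning

coeff-↭ : ∀ {A : Set} (g : A → Term) {xs ys} → xs ↭ ys → ∀ f → coeff (map g xs) f ≡ coeff (map g ys) f
coeff-↭ g Perm.refl f = refl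
coeff-↭ g (Perm.prep {xs} {ys} x p) f = begin
  coeff (g x ∷ map g xs) f                       ≡⟨ coeff-∷ (g x) (map g xs) f ⟩
  coeff (g x ∷ []) f +ℤ coeff (map g xs) f       ≡⟨ cong (coeff (g x ∷ []) f +ℤ_) (coeff-↭ g p f) ⟩
  coeff (g x ∷ []) f +ℤ coeff (map g ys) f       ≡⟨ coeff-∷ (g x) (map g ys) f ⟨
  coeff (g x ∷ map g ys) f                       ∎
  where open ≡-Reasoning
coeff-↭ g (Perm.swap {xs} {ys} x y p) f = begin
  coeff (g x ∷ g y ∷ map g xs) f                                        ≡⟨ coeff-++ (g x ∷ g y ∷ []) (map g xs) f ⟩
  coeff (g x ∷ g y ∷ []) f +ℤ coeff (map g xs) f                        ≡⟨ cong₂ _+ℤ_ flip (coeff-↭ g p f) ⟩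
  coeff (g y ∷ g x ∷ []) f +ℤ coeff (map g ys) f                        ≡⟨ coeff-++ (g y ∷ g x ∷ []) (map g ys) f ⟨
  coeff (g y ∷ g x ∷ map g ys) f                                        ∎
  where
  open ≡-Reasoning
  flip : coeff (g x ∷ g y ∷ []) f ≡ coeff (g y ∷ g x ∷ []) f
  flip = trans (coeff-∷ (g x) (g y ∷ []) f) (trans (ℤ.+-comm (coeff (g x ∷ []) f) _) (sym (coeff-∷ (g y) (g x ∷ []) f)))
coeff-↭ g (Perm.trans p q) f = trans (coeff-↭ g p f) (coeff-↭ g q f)

-- The linear extension of `κ` to formal sums; every coefficient of `piOp i p` has this form, see
-- `coeff-piOp`.
linear : (List ℕ → ℤ) → Poly → ℤ
linear κ []            = 0ℤ
linear κ ((c , e) ∷ p) = c *ℤ κ e +ℤ linear κ p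

remove : List ℕ → Poly → Poly
remove e []             = []
remove e ((c , e′) ∷ p) = if eqList e′ e then remove e p else (c , e′) ∷ remove e p

length-remove : ∀ e p → length (remove e p) ≤ length p
length-remove e []             = z≤n
length-remove e ((c , e′) ∷ p) with eqList e′ e
... | true  = m≤n⇒m≤1+n (length-remove e p)
... | false = s≤s (length-remove e p)

linear-remove : ∀ κ e p → linear κ p ≡ coeff p e *ℤ κ e +ℤ linear κ (remove e p)
linear-remove κ e []             = sym (cong (_+ℤ 0ℤ) (ℤ.*-zeroˡ (κ e)))
linear-remove κ e ((c , e′) ∷ p) with eqList e′ e in q
... | true rewrite eqList⇒≡ e′ e q | linear-remove κ e p | ℤ.*-distribʳ-+ (κ e) c (coeff p e) =
  sym (ℤ.+-assoc (c *ℤ κ e) _ _)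
... | false rewrite linear-remove κ e p = begin
  c *ℤ κ e′ +ℤ (coeff p e *ℤ κ e +ℤ linear κ (remove e p))   ≡⟨ ℤ.+-assoc (c *ℤ κ e′) _ _ ⟨
  (c *ℤ κ e′ +ℤ coeff p e *ℤ κ e) +ℤ linear κ (remove e p)   ≡⟨ cong (_+ℤ _) (ℤ.+-comm (c *ℤ κ e′) _) ⟩
  (coeff p e *ℤ κ e +ℤ c *ℤ κ e′) +ℤ linear κ (remove e p)   ≡⟨ ℤ.+-assoc (coeff p e *ℤ κ e) _ _ ⟩
  coeff p e *ℤ κ e +ℤ (c *ℤ κ e′ +ℤ linear κ (remove e p))   ∎
  where open ≡-Reasoning

coeff-remove : ∀ e p f → coeff (remove e p) f ≡ (if eqList e f then 0ℤ else coeff p f)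
coeff-remove e [] f with eqList e f
... | true  = refl
... | false = refl
coeff-remove e ((c , e′) ∷ p) f with eqList e′ e in q
... | true with coeff-remove e p f
...   | r rewrite eqList⇒≡ e′ e q with eqList e f
...     | true  = r
...     | false = r
coeff-remove e ((c , e′) ∷ p) f | false with eqList e′ f in q′ | coeff-remove e p f
... | false | r = r
... | true  | r with eqList e f in q″
...   | false = cong (c +ℤ_) r
...   | true  = case trans (sym q) (trans (cong (eqList e′) (trans (eqList⇒≡ e f q″) (sym (eqList⇒≡ e′ f q′)))) (eqList-refl e′)) of λ ()

-- All terms with the exponent of the first one contribute its total coefficient, that is nothing.
-- Without them the sum is shorter and its coefficients still vanish; `n` bounds the length for this
-- recursion.
linear-zero : ∀ κ n p → length p ≤ n → (∀ f → coeff p f ≡ 0ℤ) → linear κ p ≡ 0ℤ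
linear-zero κ n       []            _ z = refl
linear-zero κ (suc n) p@((c , e) ∷ p′) (s≤s l) z = begin
  linear κ p                                        ≡⟨ linear-remove κ e p ⟩
  coeff p e *ℤ κ e +ℤ linear κ (remove e p)         ≡⟨ cong₂ (λ a b → a *ℤ κ e +ℤ b) (z e) (linear-zero κ n (remove e p) shorter zero-remove) ⟩
  0ℤ *ℤ κ e +ℤ 0ℤ                                   ≡⟨ cong (_+ℤ 0ℤ) (ℤ.*-zeroˡ (κ e)) ⟩
  0ℤ                                                ∎
  where
  open ≡-Reasoning
  shorter : length (remove e p) ≤ n
  shorter rewrite eqList-refl e = ≤-trans (length-remove e p′) l
  zero-remove : ∀ f → coeff (remove e p) f ≡ 0ℤ
  zero-remove f = trans (coeff-remove e p f) (choose (eqList e f))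
    where
    choose : ∀ b → (if b then 0ℤ else coeff p f) ≡ 0ℤ
    choose true  = refl
    choose false = z f

negate : Poly → Poly
negate = map λ { (c , e) → - c , e }

coeff-negate : ∀ p f → coeff (negate p) f ≡ - coeff p f
coeff-negate []            f = refl
coeff-negate ((c , e) ∷ p) f with eqList e f
... | true  = trans (cong (- c +ℤ_) (coeff-negate p f)) (sym (ℤ.neg-distrib-+ c (coeff p f)))
... | false = coeff-negate p f

linear-++ : ∀ κ p q → linear κ (p ++ q) ≡ linear κ p +ℤ linear κ q
linear-++ κ []            q = sym (ℤ.+-identityˡ _)
linear-++ κ ((c , e) ∷ p) q = trans (cong (c *ℤ κ e +ℤ_) (linear-++ κ p q)) (sym (ℤ.+-assoc (c *ℤ κ e) _ _))

linear-negate : ∀ κ p → linear κ (negate p) ≡ - linear κ p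
linear-negate κ []            = refl
linear-negate κ ((c , e) ∷ p) = trans (cong₂ _+ℤ_ (sym (ℤ.neg-distribˡ-* c (κ e))) (linear-negate κ p))
  (sym (ℤ.neg-distrib-+ (c *ℤ κ e) (linear κ p)))

linear-cong : ∀ κ p q → p ≈P q → linear κ p ≡ linear κ q
linear-cong κ p q p≈q = ℤ.i-j≡0⇒i≡j (linear κ p) (linear κ q) (begin
  linear κ p +ℤ - linear κ q             ≡⟨ cong (linear κ p +ℤ_) (linear-negate κ q) ⟨
  linear κ p +ℤ linear κ (negate q)      ≡⟨ linear-++ κ p (negate q) ⟨
  linear κ (p ++ negate q)               ≡⟨ linear-zero κ _ (p ++ negate q) ≤-refl zeros ⟩
  0ℤ                                     ∎)
  where
  open ≡-Reasoning
  zeros : ∀ f → coeff (p ++ negate q) f ≡ 0ℤ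
  zeros f = trans (coeff-++ p (negate q) f)
    (trans (cong₂ _+ℤ_ (p≈q f) (coeff-negate q f)) (ℤ.+-inverseʳ (coeff q f)))

coeff-piTerm : ∀ i c e f → coeff (piTerm i (c , e)) f ≡ c *ℤ coeff (piTerm i (1ℤ , e)) f
coeff-piTerm i c e f with at e (suc i) Data.Nat.≤ᵇ at e i
... | true  = coeff-map c (λ k → set2 e i (at e i ∸ k) (at e (suc i) + k)) (upTo (suc (at e i ∸ at e (suc i)))) f
... | false = begin
  coeff (map (λ k → - c , g k) ks) f                  ≡⟨ coeff-map (- c) g ks f ⟩
  - c *ℤ coeff (map (λ k → 1ℤ , g k) ks) f            ≡⟨ cong (_*ℤ m) (ℤ.-1*i≡-i c) ⟨
  (- 1ℤ *ℤ c) *ℤ m                                    ≡⟨ cong (_*ℤ m) (ℤ.*-comm (- 1ℤ) c) ⟩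
  (c *ℤ - 1ℤ) *ℤ m                                    ≡⟨ ℤ.*-assoc c (- 1ℤ) m ⟩
  c *ℤ (- 1ℤ *ℤ m)                                    ≡⟨ cong (c *ℤ_) (coeff-map (- 1ℤ) g ks f) ⟨
  c *ℤ coeff (map (λ k → - 1ℤ , g k) ks) f            ∎
  where
  open ≡-Reasoning
  g : ℕ → List ℕ
  g k = set2 e i (at e i + suc k) (at e (suc i) ∸ suc k)
  ks = upTo (at e (suc i) ∸ at e i ∸ 1)
  m = coeff (map (λ k → 1ℤ , g k) ks) f

coeff-piOp : ∀ i p f → coeff (piOp i p) f ≡ linear (λ e → coeff (piTerm i (1ℤ , e)) f) p
coeff-piOp i []            f = refl
coeff-piOp i ((c , e) ∷ p) f =
  trans (coeff-++ (piTerm i (c , e)) (piOp i p) f) (cong₂ _+ℤ_ (coeff-piTerm i c e f) (coeff-piOp i p f))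

-- `piOp` acts on single terms, while equal polynomials may be different lists with repetitions and
-- cancellations; linear functionals do not see the difference.
piOp-cong : ∀ i p q → p ≈P q → piOp i p ≈P piOp i q
piOp-cong i p q p≈q f = trans (coeff-piOp i p f) (trans (linear-cong _ p q p≈q) (sym (coeff-piOp i q f)))

-- π_i on the sum of a string

set2-set2 : ∀ e i {u v u′ v′} → set2 (set2 e i u v) i u′ v′ ≡ set2 e i u′ v′
set2-set2 []          zero    = refl
set2-set2 []          (suc i) = refl
set2-set2 (x ∷ [])    zero    = refl
set2-set2 (x ∷ y ∷ e) zero    = refl
set2-set2 (x ∷ e)     (suc i) = cong (x ∷_) (set2-set2 e i)

at-set2 : ∀ e i {u v} → suc i < length e → at (set2 e i u v) i ≡ u × at (set2 e i u v) (suc i) ≡ v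
at-set2 (x ∷ y ∷ e) zero    _       = refl , refl
at-set2 (x ∷ [])    zero    (s≤s ())
at-set2 (x ∷ e)     (suc i) (s≤s l) = at-set2 e i l

-- falling: (r + m , v), …, (r , v + m);  rising: (r , v + m), …, (r + m , v)
falling rising : ℤ → List ℕ → ℕ → ℕ → ℕ → ℕ → Poly
falling c e i r v zero    = (c , set2 e i r v) ∷ []
falling c e i r v (suc m) = (c , set2 e i (r + suc m) v) ∷ falling c e i r (suc v) m
rising c e i r v zero    = (c , set2 e i r v) ∷ []
rising c e i r v (suc m) = (c , set2 e i r (v + suc m)) ∷ rising c e i (suc r) v m

falling-snoc : ∀ c e i r v m → falling c e i r v (suc m) ≡ falling c e i (suc r) v m ++ (c , set2 e i r (v + suc m)) ∷ []
falling-snoc c e i r v zero    rewrite +-comm r 1 | +-comm v 1 = refl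
falling-snoc c e i r v (suc m) rewrite +-suc r (suc m) | +-suc v (suc m) = cong ((c , set2 e i (suc (r + suc m)) v) ∷_) (falling-snoc c e i r (suc v) m)

coeff-rising : ∀ c e i r v m f → coeff (rising c e i r v m) f ≡ coeff (falling c e i r v m) f
coeff-rising c e i r v zero    f = refl
coeff-rising c e i r v (suc m) f = begin
  coeff (t ∷ rising c e i (suc r) v m) f                        ≡⟨ coeff-∷ t (rising c e i (suc r) v m) f ⟩
  coeff (t ∷ []) f +ℤ coeff (rising c e i (suc r) v m) f        ≡⟨ cong (coeff (t ∷ []) f +ℤ_) (coeff-rising c e i (suc r) v m f) ⟩
  coeff (t ∷ []) f +ℤ coeff (falling c e i (suc r) v m) f       ≡⟨ ℤ.+-comm (coeff (t ∷ []) f) _ ⟩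
  coeff (falling c e i (suc r) v m) f +ℤ coeff (t ∷ []) f       ≡⟨ coeff-++ (falling c e i (suc r) v m) (t ∷ []) f ⟨
  coeff (falling c e i (suc r) v m ++ t ∷ []) f                 ≡⟨ cong (λ p → coeff p f) (falling-snoc c e i r v m) ⟨
  coeff (falling c e i r v (suc m)) f                           ∎
  where
  open ≡-Reasoning
  t = (c , set2 e i r (v + suc m))

negate-falling : ∀ c e i r v m → falling (- c) e i r v m ≡ negate (falling c e i r v m)
negate-falling c e i r v zero    = refl
negate-falling c e i r v (suc m) = cong ((- c , set2 e i (r + suc m) v) ∷_) (negate-falling c e i r (suc v) m)

applyUpTo-falling : ∀ c e i r v m (g : ℕ → Term) → (∀ k → g k ≡ (c , set2 e i (r + m ∸ k) (v + k))) →
  applyUpTo g (suc m) ≡ falling c e i r v m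
applyUpTo-falling c e i r v zero    g h rewrite h 0 | +-identityʳ r | +-identityʳ v = refl
applyUpTo-falling c e i r v (suc m) g h = cong₂ _∷_ (trans (h 0) (cong (λ y → c , set2 e i (r + suc m) y) (+-identityʳ v)))
  (applyUpTo-falling c e i r (suc v) m (g ∘ suc) λ k → trans (h (suc k))
    (cong₂ (λ x y → c , set2 e i x y) (cong (_∸ suc k) (+-suc r m)) (+-suc v k)))

applyUpTo-rising : ∀ c e i r v m (g : ℕ → Term) → (∀ k → g k ≡ (c , set2 e i (r + k) (v + m ∸ k))) →
  applyUpTo g (suc m) ≡ rising c e i r v m
applyUpTo-rising c e i r v zero    g h rewrite h 0 | +-identityʳ r | +-identityʳ v = refl
applyUpTo-rising c e i r v (suc m) g h = cong₂ _∷_ (trans (h 0) (cong (λ y → c , set2 e i y (v + suc m)) (+-identityʳ r)))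
  (applyUpTo-rising c e i (suc r) v m (g ∘ suc) λ k → trans (h (suc k))
    (cong₂ (λ x y → c , set2 e i x y) (+-suc r k) (cong (_∸ suc k) (+-suc v m))))

piTerm-≥ : ∀ i c e {a b} → at e i ≡ a → at e (suc i) ≡ b → b ≤ a →
  piTerm i (c , e) ≡ map (λ k → c , set2 e i (a ∸ k) (b + k)) (upTo (suc (a ∸ b)))
piTerm-≥ i c e refl refl b≤a rewrite ≤⇒≤ᵇ≡true b≤a = refl

piTerm-< : ∀ i c e {a b} → at e i ≡ a → at e (suc i) ≡ b → a < b →
  piTerm i (c , e) ≡ map (λ k → - c , set2 e i (a + suc k) (b ∸ suc k)) (upTo (b ∸ a ∸ 1))
piTerm-< i c e refl refl a<b rewrite >⇒≤ᵇ≡false a<b = refl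

piTerm-falling : ∀ i c e q m → suc i < length e → piTerm i (c , set2 e i (q + m) q) ≡ falling c e i q q m
piTerm-falling i c e q m l with at-set2 e i {q + m} {q} l
... | a , b = trans (piTerm-≥ i c (set2 e i (q + m) q) a b (m≤m+n q m))
  (trans (cong (λ d → map g (upTo (suc d))) (m+n∸m≡n q m))
  (trans (map-upTo g (suc m)) (applyUpTo-falling c e i q q m g λ k → cong (c ,_) (set2-set2 e i))))
  where
  g : ℕ → Term
  g k = c , set2 (set2 e i (q + m) q) i (q + m ∸ k) (q + k)

piTerm-rising : ∀ i c e p m → suc i < length e → piTerm i (c , set2 e i p (suc p + suc m)) ≡ rising (- c) e i (suc p) (suc p) m
piTerm-rising i c e p m l with at-set2 e i {p} {suc p + suc m} l
... | a , b = trans (piTerm-< i c (set2 e i p (suc p + suc m)) a b (s≤s (m≤m+n p (suc m))))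
  (trans (cong (λ d → map g (upTo (d ∸ 1))) gap)
  (trans (map-upTo g (suc m)) (applyUpTo-rising (- c) e i (suc p) (suc p) m g λ k → cong (- c ,_)
    (trans (set2-set2 e i) (cong₂ (set2 e i) (+-suc p k) (cong (_∸ k) (+-suc p m)))))))
  where
  g : ℕ → Term
  g k = - c , set2 (set2 e i p (suc p + suc m)) i (p + suc k) (suc p + suc m ∸ suc k)
  gap : suc p + suc m ∸ p ≡ suc (suc m)
  gap = trans (cong (_∸ p) (sym (+-suc p (suc m)))) (m+n∸m≡n p (suc (suc m)))

-- Multiplied by the first of the two variables, the monomial has equal exponents in them, so the
-- divided difference vanishes.
piTerm-equal : ∀ i c e p → suc i < length e → piTerm i (c , set2 e i p (suc p)) ≡ []
piTerm-equal i c e p l with at-set2 e i {p} {suc p} l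
... | a , b = trans (piTerm-< i c (set2 e i p (suc p)) a b (n<1+n p))
  (cong (λ d → map g (upTo (d ∸ 1))) (m+n∸n≡m 1 p))
  where
  g : ℕ → Term
  g k = - c , set2 (set2 e i p (suc p)) i (p + suc k) (suc p ∸ suc k)

piOp-++ : ∀ i p q → piOp i (p ++ q) ≡ piOp i p ++ piOp i q
piOp-++ i p q = concatMap-++ (piTerm i) p q

-- The sum is symmetric in the two variables. Removing both end terms gives the induction: the first
-- term yields the whole sum, the last one yields minus the inner sum, and the inner sum is fixed.
piOp-falling : ∀ i c e q m → suc i < length e → piOp i (falling c e i q q m) ≈P falling c e i q q m
piOp-falling i c e q zero l f = cong (λ p → coeff p f) (trans (++-identityʳ _)
  (trans (cong (λ r → piTerm i (c , set2 e i r q)) (sym (+-identityʳ q))) (piTerm-falling i c e q 0 l)))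
piOp-falling i c e q (suc zero) l f = cong (λ p → coeff p f) (trans
  (cong₂ (λ s t → s ++ t ++ []) (piTerm-falling i c e q 1 l) (piTerm-equal i c e q l)) (++-identityʳ _))
piOp-falling i c e q (suc (suc m)) l f = begin
  coeff (piOp i (falling c e i q q (suc (suc m)))) f
    ≡⟨ cong (λ p → coeff (piTerm i first ++ piOp i p) f) (falling-snoc c e i q (suc q) m) ⟩
  coeff (piTerm i first ++ piOp i (inner ++ last ∷ [])) f
    ≡⟨ cong₂ (λ s t → coeff (s ++ t) f) (piTerm-falling i c e q (suc (suc m)) l) (piOp-++ i inner (last ∷ [])) ⟩
  coeff (whole ++ piOp i inner ++ piTerm i last ++ []) f
    ≡⟨ cong (λ s → coeff (whole ++ piOp i inner ++ s) f) (trans (++-identityʳ _) (piTerm-rising i c e q m l)) ⟩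
  coeff (whole ++ piOp i inner ++ rising (- c) e i (suc q) (suc q) m) f
    ≡⟨ trans (coeff-++ whole _ f) (cong (coeff whole f +ℤ_) (coeff-++ (piOp i inner) _ f)) ⟩
  coeff whole f +ℤ (coeff (piOp i inner) f +ℤ coeff (rising (- c) e i (suc q) (suc q) m) f)
    ≡⟨ cong₂ (λ s t → coeff whole f +ℤ (s +ℤ t)) (piOp-falling i c e (suc q) m l f)
         (trans (coeff-rising (- c) e i (suc q) (suc q) m f)
         (trans (cong (λ p → coeff p f) (negate-falling c e i (suc q) (suc q) m)) (coeff-negate inner f))) ⟩
  coeff whole f +ℤ (coeff inner f +ℤ - coeff inner f)
    ≡⟨ cong (coeff whole f +ℤ_) (ℤ.+-inverseʳ (coeff inner f)) ⟩
  coeff whole f +ℤ 0ℤ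
    ≡⟨ ℤ.+-identityʳ _ ⟩
  coeff whole f ∎
  where
  open ≡-Reasoning
  first last : Term
  first = (c , set2 e i (q + suc (suc m)) q)
  last  = (c , set2 e i q (suc q + suc m))
  inner whole : Poly
  inner = falling c e i (suc q) (suc q) m
  whole = falling c e i q q (suc (suc m))

-- Monomials of words

sumMonomials-map : ∀ n L → sumMonomials n L ≡ map (λ w → 1ℤ , content n w) L
sumMonomials-map n []      = refl
sumMonomials-map n (w ∷ L) = cong (_ ∷_) (sumMonomials-map n L)

sumMonomials-↭ : ∀ n {L L′} → L ↭ L′ → sumMonomials n L ≈P sumMonomials n L′
sumMonomials-↭ n {L} {L′} p f rewrite sumMonomials-map n L | sumMonomials-map n L′ = coeff-↭ _ p f

content-applyUpTo : ∀ n w → content n w ≡ applyUpTo (λ k → count (suc k) w) n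
content-applyUpTo n w = trans (cong (map (λ j → count j w)) (map-upTo suc n)) (map-applyUpTo suc (λ j → count j w) n)

length-content : ∀ n w → length (content n w) ≡ n
length-content n w = trans (length-map _ (oneTo n)) (trans (length-map suc (upTo n)) (length-upTo n))

applyUpTo-cong : ∀ {A : Set} {f g : ℕ → A} n → (∀ k → f k ≡ g k) → applyUpTo f n ≡ applyUpTo g n
applyUpTo-cong zero    h = refl
applyUpTo-cong (suc n) h = cong₂ _∷_ (h 0) (applyUpTo-cong n (h ∘ suc))

content-cong : ∀ n w w′ → (∀ j → count j w ≡ count j w′) → content n w ≡ content n w′
content-cong n w w′ h = map-cong (λ j → h j) (oneTo n)

applyUpTo-set2 : ∀ n i (f g : ℕ → ℕ) → suc i < n → (∀ k → k ≢ i → k ≢ suc i → g k ≡ f k) →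
  applyUpTo g n ≡ set2 (applyUpTo f n) i (g i) (g (suc i))
applyUpTo-set2 (suc (suc n)) zero f g _ h =
  cong (λ t → g 0 ∷ g 1 ∷ t) (applyUpTo-cong n λ k → h (suc (suc k)) (λ ()) (λ ()))
applyUpTo-set2 (suc zero) zero f g (s≤s ()) h
applyUpTo-set2 (suc n) (suc i) f g (s≤s l) h =
  cong₂ _∷_ (h 0 (λ ()) (λ ())) (applyUpTo-set2 n i (f ∘ suc) (g ∘ suc) l λ k a b → h (suc k) (a ∘ suc-injective) (b ∘ suc-injective))

content-set2 : ∀ n i w t → suc i < n → (∀ {j} → j ≢ suc i → j ≢ suc (suc i) → count j w ≡ count j t) →
  content n w ≡ set2 (content n t) i (count (suc i) w) (count (suc (suc i)) w)
content-set2 n i w t l h rewrite content-applyUpTo n w | content-applyUpTo n t =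
  applyUpTo-set2 n i _ _ l λ k a b → h (a ∘ suc-injective) (b ∘ suc-injective)

-- Recording tableaux

addCells : List ℕ → ℕ → Tableau → Tableau
addCells []       k Q = Q
addCells (j ∷ js) k Q = addCells js (suc k) (addCell Q j k)

insertAll-cells : ∀ w k P Q → proj₂ (insertAll w k P Q) ≡ addCells (cells P w) k Q
insertAll-cells []      k P Q = refl
insertAll-cells (x ∷ w) k P Q with colInsert P x
... | P′ , j = insertAll-cells w (suc k) P′ (addCell Q j k)

addCells-++ : ∀ js js′ k Q → addCells (js ++ js′) k Q ≡ addCells js′ (length js + k) (addCells js k Q)
addCells-++ []       js′ k Q = refl
addCells-++ (j ∷ js) js′ k Q = trans (addCells-++ js js′ (suc k) (addCell Q j k))
  (cong (λ m → addCells js′ m (addCells js (suc k) (addCell Q j k))) (+-suc (length js) k))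

columnAt : Tableau → ℕ → List ℕ
columnAt []       _       = []
columnAt (q ∷ Q) zero    = q
columnAt (q ∷ Q) (suc c) = columnAt Q c

-- The columns of new cells are valid when a tableau with L columns is
-- never extended by more than one column at a time.
data Valid : ℕ → List ℕ → Set where
  []  : ∀ {L} → Valid L []
  _∷_ : ∀ {L j js} → j ≤ L → Valid (L ⊔ suc j) js → Valid L (j ∷ js)

newColumn-valid : ∀ P x → newColumn P x ≤ length P × length (inserted P x) ≡ length P ⊔ suc (newColumn P x)
newColumn-valid []       x = z≤n , refl
newColumn-valid (c ∷ cs) x with columnView x c
... | fits a rewrite colInsert-fits cs a = z≤n , cong suc (sym (⊔-identityʳ (length cs)))
... | bumps c₁ h c₂ a p rewrite colInsert-bumps {c₂ = c₂} c₁ cs a p with newColumn-valid cs h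
...   | v , e = s≤s v , cong suc e

cells-valid : ∀ P w → Valid (length P) (cells P w)
cells-valid P []      = []
cells-valid P (x ∷ w) with newColumn-valid P x
... | v , e = v ∷ subst (λ L → Valid L (cells (inserted P x) w)) e (cells-valid (inserted P x) w)

seg-valid : ∀ {L s} m {js} → s ≤ L → (∀ L → Valid L js) → Valid L (seg s m ++ js)
seg-valid         zero    s≤L v = v _
seg-valid {L} {s} (suc m) s≤L v = s≤L ∷ seg-valid m (m≤n⊔m L (suc s)) v

keyCells-valid : ∀ b L → Valid L (keyCells b)
keyCells-valid []       L = []
keyCells-valid (b ∷ bs) L = seg-valid b z≤n (keyCells-valid bs)

length-addCell : ∀ Q j k → j ≤ length Q → length (addCell Q j k) ≡ length Q ⊔ suc j
length-addCell []      zero    k _       = refl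
length-addCell (q ∷ Q) zero    k _       = cong suc (sym (⊔-identityʳ (length Q)))
length-addCell (q ∷ Q) (suc j) k (s≤s p) = cong suc (length-addCell Q j k p)

addCell-keeps : ∀ Q j k {c x} → x ∈ columnAt Q c → x ∈ columnAt (addCell Q j k) c
addCell-keeps (q ∷ Q) zero    k {zero}  x∈ = ∈-++⁺ˡ x∈
addCell-keeps (q ∷ Q) zero    k {suc c} x∈ = x∈
addCell-keeps (q ∷ Q) (suc j) k {zero}  x∈ = x∈
addCell-keeps (q ∷ Q) (suc j) k {suc c} x∈ = addCell-keeps Q j k x∈

addCell-new : ∀ Q j k → j ≤ length Q → k ∈ columnAt (addCell Q j k) j
addCell-new []      zero    k _       = here refl
addCell-new (q ∷ Q) zero    k _       = ∈-++⁺ʳ q (here refl)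
addCell-new (q ∷ Q) (suc j) k (s≤s p) = addCell-new Q j k p

addCell-old : ∀ Q j k {c x} → j ≤ length Q → x ∈ columnAt (addCell Q j k) c → x ∈ columnAt Q c ⊎ (x ≡ k × c ≡ j)
addCell-old []      zero    k {zero}  _ (here e) = inj₂ (e , refl)
addCell-old (q ∷ Q) zero    k {zero}  _ x∈ with ∈-++⁻ q x∈
... | inj₁ p        = inj₁ p
... | inj₂ (here e) = inj₂ (e , refl)
addCell-old (q ∷ Q) zero    k {suc c} _ x∈ = inj₁ x∈
addCell-old (q ∷ Q) (suc j) k {zero}  _ x∈ = inj₁ x∈
addCell-old (q ∷ Q) (suc j) k {suc c} (s≤s p) x∈ with addCell-old Q j k p x∈
... | inj₁ y∈      = inj₁ y∈
... | inj₂ (e , f) = inj₂ (e , cong suc f)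

addCells-keeps : ∀ js k Q {c x} → x ∈ columnAt Q c → x ∈ columnAt (addCells js k Q) c
addCells-keeps []       k Q x∈ = x∈
addCells-keeps (j ∷ js) k Q x∈ = addCells-keeps js (suc k) (addCell Q j k) (addCell-keeps Q j k x∈)

addCells-old : ∀ js k Q {c x} → Valid (length Q) js → x < k → x ∈ columnAt (addCells js k Q) c → x ∈ columnAt Q c
addCells-old []       k Q _ _ x∈ = x∈
addCells-old (j ∷ js) k Q (p ∷ v) x<k x∈
  with addCell-old Q j k p (addCells-old js (suc k) (addCell Q j k)
         (subst (λ L → Valid L js) (sym (length-addCell Q j k p)) v) (m<n⇒m<1+n x<k) x∈)
... | inj₁ y∈         = y∈
... | inj₂ (refl , _) = contradiction x<k (<-irrefl refl)

-- Later additions neither move old entries nor create another `k`, so the column of the entry `k`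
-- in the final tableau is the one chosen at time `k`.
addCells-injective : ∀ js js′ k Q → length js ≡ length js′ → Valid (length Q) js → Valid (length Q) js′ →
  (∀ {c x} → x ∈ columnAt Q c → x < k) → addCells js k Q ≡ addCells js′ k Q → js ≡ js′
addCells-injective []       []         k Q _ _ _ _ _ = refl
addCells-injective (j ∷ js) (j′ ∷ js′) k Q l (p ∷ v) (p′ ∷ v′) old e
  with addCell-old Q j′ k p′ (addCells-old js′ (suc k) (addCell Q j′ k)
         (subst (λ L → Valid L js′) (sym (length-addCell Q j′ k p′)) v′) ≤-refl
         (subst (λ R → k ∈ columnAt R j) e (addCells-keeps js (suc k) (addCell Q j k) (addCell-new Q j k p))))
... | inj₁ k∈         = contradiction (old k∈) (<-irrefl refl)
... | inj₂ (_ , refl) = cong (j ∷_) (addCells-injective js js′ (suc k) (addCell Q j k) (suc-injective l)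
        (subst (λ L → Valid L js) (sym (length-addCell Q j k p)) v)
        (subst (λ L → Valid L js′) (sym (length-addCell Q j k p)) v′) old′ e)
  where
  old′ : ∀ {c x} → x ∈ columnAt (addCell Q j k) c → x < suc k
  old′ x∈ with addCell-old Q j k p x∈
  ... | inj₁ y∈         = m<n⇒m<1+n (old y∈)
  ... | inj₂ (refl , _) = ≤-refl

-- The entry in column c of a row  o + 1, …, o + m
entry : ℕ → ℕ → ℕ → List ℕ
entry o zero    c       = []
entry o (suc m) zero    = suc o ∷ []
entry o (suc m) (suc c) = entry (suc o) m c

-- Column c of the standardized key tableau, with all entries raised by o
standardColumn : ℕ → List ℕ → ℕ → List ℕ
standardColumn o []       c = []
standardColumn o (b ∷ bs) c = entry o b c ++ standardColumn (o + b) bs c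

entry-inside : ∀ o {m c} → c < m → entry o m c ≡ (o + suc c) ∷ []
entry-inside o {suc m} {zero}  _       = cong (_∷ []) (sym (+-comm o 1))
entry-inside o {suc m} {suc c} (s≤s p) = trans (entry-inside (suc o) p) (cong (_∷ []) (sym (+-suc o (suc c))))

entry-outside : ∀ o {m c} → m ≤ c → entry o m c ≡ []
entry-outside o {zero}          _       = refl
entry-outside o {suc m} {suc c} (s≤s p) = entry-outside (suc o) p

addRow : ℕ → ℕ → Tableau → Tableau
addRow zero    k Q       = Q
addRow (suc m) k []      = (k ∷ []) ∷ addRow m (suc k) []
addRow (suc m) k (q ∷ Q) = (q ++ k ∷ []) ∷ addRow m (suc k) Q

seg-suc : ∀ s m → seg (suc s) m ≡ map suc (seg s m)
seg-suc s zero    = refl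
seg-suc s (suc m) = cong (suc s ∷_) (seg-suc (suc s) m)

addCells-suc : ∀ js k q Q → addCells (map suc js) k (q ∷ Q) ≡ q ∷ addCells js k Q
addCells-suc []       k q Q = refl
addCells-suc (j ∷ js) k q Q = addCells-suc js (suc k) q (addCell Q j k)

addCells-seg : ∀ m k Q → addCells (seg 0 m) k Q ≡ addRow m k Q
addCells-seg zero    k Q       = refl
addCells-seg (suc m) k []      rewrite seg-suc 0 m | addCells-suc (seg 0 m) (suc k) (k ∷ []) [] =
  cong (_ ∷_) (addCells-seg m (suc k) [])
addCells-seg (suc m) k (q ∷ Q) rewrite seg-suc 0 m | addCells-suc (seg 0 m) (suc k) (q ++ k ∷ []) Q =
  cong (_ ∷_) (addCells-seg m (suc k) Q)

length-addRow : ∀ m k Q → length (addRow m k Q) ≡ length Q ⊔ m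
length-addRow zero    k Q       = sym (⊔-identityʳ (length Q))
length-addRow (suc m) k []      = cong suc (length-addRow m (suc k) [])
length-addRow (suc m) k (q ∷ Q) = cong suc (length-addRow m (suc k) Q)

columnAt-addRow : ∀ m o Q c → columnAt (addRow m (suc o) Q) c ≡ columnAt Q c ++ entry o m c
columnAt-addRow zero    o Q       c       = sym (++-identityʳ _)
columnAt-addRow (suc m) o []      zero    = refl
columnAt-addRow (suc m) o []      (suc c) = columnAt-addRow m (suc o) [] c
columnAt-addRow (suc m) o (q ∷ Q) zero    = refl
columnAt-addRow (suc m) o (q ∷ Q) (suc c) = columnAt-addRow m (suc o) Q c

map-columnAt : ∀ Q → map (columnAt Q) (seg 0 (length Q)) ≡ Q
map-columnAt []      = refl
map-columnAt (q ∷ Q) rewrite seg-suc 0 (length Q) =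
  cong (q ∷_) (trans (sym (map-∘ (seg 0 (length Q)))) (map-columnAt Q))

-- A row with `b` cells puts one entry at the bottom of each of the first `b` columns. The start `Q`
-- and the offset `o` record the rows already added.
addCells-keyCells : ∀ b o Q → addCells (keyCells b) (suc o) Q ≡
  map (λ c → columnAt Q c ++ standardColumn o b c) (seg 0 (length Q ⊔ maxList b))
addCells-keyCells [] o Q rewrite ⊔-identityʳ (length Q) =
  sym (trans (map-cong (λ c → ++-identityʳ (columnAt Q c)) (seg 0 (length Q))) (map-columnAt Q))
addCells-keyCells (b ∷ bs) o Q = begin
  addCells (seg 0 b ++ keyCells bs) (suc o) Q
    ≡⟨ addCells-++ (seg 0 b) (keyCells bs) (suc o) Q ⟩
  addCells (keyCells bs) (length (seg 0 b) + suc o) (addCells (seg 0 b) (suc o) Q)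
    ≡⟨ cong₂ (addCells (keyCells bs)) index (addCells-seg b (suc o) Q) ⟩
  addCells (keyCells bs) (suc (o + b)) Q′
    ≡⟨ addCells-keyCells bs (o + b) Q′ ⟩
  map (λ c → columnAt Q′ c ++ standardColumn (o + b) bs c) (seg 0 (length Q′ ⊔ maxList bs))
    ≡⟨ cong (λ L → map (λ c → columnAt Q′ c ++ standardColumn (o + b) bs c) (seg 0 L))
         (trans (cong (_⊔ maxList bs) (length-addRow b (suc o) Q)) (⊔-assoc (length Q) b (maxList bs))) ⟩
  map (λ c → columnAt Q′ c ++ standardColumn (o + b) bs c) (seg 0 (length Q ⊔ (b ⊔ maxList bs)))
    ≡⟨ map-cong (λ c → trans (cong (_++ standardColumn (o + b) bs c) (columnAt-addRow b o Q c))
         (++-assoc (columnAt Q c) (entry o b c) _)) (seg 0 (length Q ⊔ (b ⊔ maxList bs))) ⟩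
  map (λ c → columnAt Q c ++ standardColumn o (b ∷ bs) c) (seg 0 (length Q ⊔ maxList (b ∷ bs))) ∎
  where
  open ≡-Reasoning
  Q′ : Tableau
  Q′ = addRow b (suc o) Q
  index : length (seg 0 b) + suc o ≡ suc (o + b)
  index = trans (cong (_+ suc o) (length-seg 0 b)) (trans (+-suc b o) (cong suc (+-comm b o)))

-- Standardization of the key tableau

-- `keyColumn` as a recursion over the weight, without the lookups.
keyColumnFrom : ℕ → List ℕ → ℕ → List ℕ
keyColumnFrom s []       c = []
keyColumnFrom s (b ∷ bs) c with c ≤? b
... | yes _ = s ∷ keyColumnFrom (suc s) bs c
... | no _  = keyColumnFrom (suc s) bs c

filter-keyColumn : ∀ b c s (g h : ℕ → ℕ) → (∀ k → g k ≡ s + k) → (∀ k → h (g k) ≡ at b k) →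
  filter (λ j → c ≤? h j) (applyUpTo g (length b)) ≡ keyColumnFrom s b c
filter-keyColumn []       c s g h p q = refl
filter-keyColumn (b ∷ bs) c s g h p q with filter-keyColumn bs c (suc s) (g ∘ suc) h (λ k → trans (p (suc k)) (+-suc s k)) (q ∘ suc) | c ≤? b
... | e | yes c≤b = trans (filter-accept (λ j → c ≤? h j) (subst (c ≤_) (sym (q 0)) c≤b)) (cong₂ _∷_ (trans (p 0) (+-identityʳ s)) e)
... | e | no c≰b  = trans (filter-reject (λ j → c ≤? h j) (c≰b ∘ subst (c ≤_) (q 0))) e

keyColumn≡ : ∀ b c → keyColumn b c ≡ keyColumnFrom 1 b c
keyColumn≡ b c = trans (cong (filter (λ j → c ≤? at b (j ∸ 1))) (map-upTo suc (length b)))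
  (filter-keyColumn b c 1 suc (λ j → at b (j ∸ 1)) (λ _ → refl) (λ _ → refl))

applyUpTo-seg : ∀ s m (g : ℕ → ℕ) → (∀ k → g k ≡ s + k) → applyUpTo g m ≡ seg s m
applyUpTo-seg s zero    g p = refl
applyUpTo-seg s (suc m) g p = cong₂ _∷_ (trans (p 0) (+-identityʳ s)) (applyUpTo-seg (suc s) m (g ∘ suc) λ k → trans (p (suc k)) (+-suc s k))

oneTo≡seg : ∀ m → oneTo m ≡ seg 1 m
oneTo≡seg m = trans (map-upTo suc m) (applyUpTo-seg 1 m suc λ _ → refl)

keyColumns : List ℕ → ℕ → ℕ → Tableau
keyColumns b s m = map (keyColumnFrom 1 b) (seg s m)

keyTableau≡ : ∀ b → keyTableau b ≡ keyColumns b 1 (maxList b)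
keyTableau≡ b = trans (map-cong (keyColumn≡ b) (oneTo (maxList b))) (cong (map (keyColumnFrom 1 b)) (oneTo≡seg (maxList b)))

count-keyColumn-below : ∀ s b c {v} → v < s → count v (keyColumnFrom s b c) ≡ 0
count-keyColumn-below s []       c v<s = refl
count-keyColumn-below s (b ∷ bs) c v<s with c ≤? b
... | yes _ = trans (count-≢ _ (>⇒≢ v<s)) (count-keyColumn-below (suc s) bs c (m<n⇒m<1+n v<s))
... | no _  = count-keyColumn-below (suc s) bs c (m<n⇒m<1+n v<s)

count-keyColumn-in : ∀ s b c d → 1 ≤ c → c ≤ at b d → count (s + d) (keyColumnFrom s b c) ≡ 1
count-keyColumn-in s []       c d 1≤c c≤ = contradiction (≤-trans 1≤c c≤) λ ()
count-keyColumn-in s (b ∷ bs) c zero 1≤c c≤b with c ≤? b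
... | no c≰b = contradiction c≤b c≰b
... | yes _ rewrite +-identityʳ s = trans (count-≡ s _) (cong suc (count-keyColumn-below (suc s) bs c ≤-refl))
count-keyColumn-in s (b ∷ bs) c (suc d) 1≤c c≤ with c ≤? b
... | yes _ = trans (count-≢ _ (≢-sym (m+1+n≢m s))) (trans (cong (λ v → count v (keyColumnFrom (suc s) bs c)) (+-suc s d))
                (count-keyColumn-in (suc s) bs c d 1≤c c≤))
... | no _  = trans (cong (λ v → count v (keyColumnFrom (suc s) bs c)) (+-suc s d)) (count-keyColumn-in (suc s) bs c d 1≤c c≤)

count-keyColumn-out : ∀ s b c d → at b d < c → count (s + d) (keyColumnFrom s b c) ≡ 0
count-keyColumn-out s []       c d _ = refl
count-keyColumn-out s (b ∷ bs) c zero b<c with c ≤? b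
... | yes c≤b = contradiction b<c (≤⇒≯ c≤b)
... | no _    = count-keyColumn-below (suc s) bs c (subst (_< suc s) (sym (+-identityʳ s)) ≤-refl)
count-keyColumn-out s (b ∷ bs) c (suc d) <c with c ≤? b
... | yes _ = trans (count-≢ _ (≢-sym (m+1+n≢m s))) (trans (cong (λ v → count v (keyColumnFrom (suc s) bs c)) (+-suc s d))
                (count-keyColumn-out (suc s) bs c d <c))
... | no _  = trans (cong (λ v → count v (keyColumnFrom (suc s) bs c)) (+-suc s d)) (count-keyColumn-out (suc s) bs c d <c)

-- In a key tableau the entry `suc d` fills exactly the first `at b d` columns; of these, those
-- numbered from `suc s` to `s + m` are counted.
countEqual-keyColumns : ∀ b s m d → countEqual (keyColumns b (suc s) m) (suc d) ≡ (at b d ∸ s) ⊓ m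
countEqual-keyColumns b s zero    d = sym (⊓-zeroʳ (at b d ∸ s))
countEqual-keyColumns b s (suc m) d with suc s ≤? at b d
... | yes p = trans (count-++ (suc d) (keyColumnFrom 1 b (suc s)) _)
                (trans (cong₂ _+_ (count-keyColumn-in 1 b (suc s) d (s≤s z≤n) p) (countEqual-keyColumns b (suc s) m d))
                       (cong (_⊓ suc m) (sym (+-∸-assoc 1 p))))
... | no ¬p = trans (count-++ (suc d) (keyColumnFrom 1 b (suc s)) _)
                (trans (cong₂ _+_ (count-keyColumn-out 1 b (suc s) d (≰⇒> ¬p)) (countEqual-keyColumns b (suc s) m d))
                       both-zero)
  where
  both-zero : (at b d ∸ suc s) ⊓ m ≡ (at b d ∸ s) ⊓ suc m
  both-zero rewrite m≤n⇒m∸n≡0 (≮⇒≥ ¬p) | m≤n⇒m∸n≡0 (m≤n⇒m≤1+n (≮⇒≥ ¬p)) = refl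

countEqual-zero : ∀ b s m → countEqual (keyColumns b s m) 0 ≡ 0
countEqual-zero b s zero    = refl
countEqual-zero b s (suc m) = trans (count-++ 0 (keyColumnFrom 1 b s) _)
  (cong₂ _+_ (count-keyColumn-below 1 b s ≤-refl) (countEqual-zero b (suc s) m))

filter-<-suc : ∀ v l → length (filter (_<? suc v) l) ≡ length (filter (_<? v) l) + count v l
filter-<-suc v []      = refl
filter-<-suc v (x ∷ l) with <-cmp x v
... | tri< x<v x≢v _ rewrite filter-accept (_<? suc v) {x} {l} (m<n⇒m<1+n x<v) | filter-accept (_<? v) {x} {l} x<v | count-≢ l x≢v =
  cong suc (filter-<-suc v l)
... | tri≈ x≮v refl _ rewrite filter-accept (_<? suc v) {x} {l} ≤-refl | filter-reject (_<? v) {x} {l} x≮v | count-≡ v l =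
  trans (cong suc (filter-<-suc v l)) (sym (+-suc _ _))
... | tri> x≮v x≢v v<x rewrite filter-reject (_<? suc v) {x} {l} (≤⇒≯ v<x) | filter-reject (_<? v) {x} {l} x≮v | count-≢ l x≢v =
  filter-<-suc v l

filter-<-zero : ∀ l → length (filter (_<? 0) l) ≡ 0
filter-<-zero []      = refl
filter-<-zero (x ∷ l) = filter-<-zero l

partialSum : List ℕ → ℕ → ℕ
partialSum b        zero    = 0
partialSum []       (suc d) = 0
partialSum (b ∷ bs) (suc d) = b + partialSum bs d

partialSum-suc : ∀ b d → partialSum b (suc d) ≡ partialSum b d + at b d
partialSum-suc []       zero    = refl
partialSum-suc []       (suc d) = refl
partialSum-suc (b ∷ bs) zero    = +-identityʳ b
partialSum-suc (b ∷ bs) (suc d) = trans (cong (b +_) (partialSum-suc bs d)) (sym (+-assoc b _ _))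

at≤maxList : ∀ b d → at b d ≤ maxList b
at≤maxList []       d       = z≤n
at≤maxList (b ∷ bs) zero    = m≤m⊔n b (maxList bs)
at≤maxList (b ∷ bs) (suc d) = ≤-trans (at≤maxList bs d) (m≤n⊔m b (maxList bs))

countLess-key : ∀ b d → countLess (keyColumns b 1 (maxList b)) (suc d) ≡ partialSum b d
countLess-key b zero = trans (filter-<-suc 0 (concat (keyColumns b 1 (maxList b)))) (cong₂ _+_ (filter-<-zero (concat (keyColumns b 1 (maxList b)))) (countEqual-zero b 1 (maxList b)))
countLess-key b (suc d) = trans (filter-<-suc (suc d) (concat (keyColumns b 1 (maxList b)))) (trans (cong₂ _+_ (countLess-key b d)
    (trans (countEqual-keyColumns b 0 (maxList b) d) (m≤n⇒m⊓n≡m (at≤maxList b d)))) (sym (partialSum-suc b d)))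

map-keyColumnFrom : ∀ (f : ℕ → ℕ) s o b c → (∀ d → c < at b d → f (s + d) ≡ o + partialSum b d + suc c) →
  map f (keyColumnFrom s b (suc c)) ≡ standardColumn o b c
map-keyColumnFrom f s o []       c h = refl
map-keyColumnFrom f s o (b ∷ bs) c h with suc c ≤? b | map-keyColumnFrom f (suc s) (o + b) bs c (λ d p →
    trans (cong f (sym (+-suc s d))) (trans (h (suc d) p) (cong (_+ suc c) (sym (+-assoc o b _)))))
... | yes p | e rewrite entry-inside o p = cong₂ _∷_ (trans (cong f (sym (+-identityʳ s))) (trans (h 0 p) (cong (_+ suc c) (+-identityʳ o)))) e
... | no ¬p | e rewrite entry-outside o (≮⇒≥ ¬p) = e

take-keyColumns : ∀ b {s j m} → j ≤ m → take j (keyColumns b s m) ≡ keyColumns b s j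
take-keyColumns b {s} {j} {m} j≤m with m≤n⇒∃[o]m+o≡n j≤m
... | r , refl rewrite seg-+ s j r | map-++ (keyColumnFrom 1 b) (seg s j) (seg (s + j) r) =
  proj₁ (take-++-length (keyColumns b s j) (trans (length-map _ (seg s j)) (length-seg s j)))

stdAux-key : ∀ b j r → j + r ≡ maxList b →
  stdAux (keyColumns b 1 (maxList b)) (keyColumns b (suc j) r) ≡ map (standardColumn 0 b) (seg j r)
stdAux-key b j zero    e = refl
stdAux-key b j (suc r) e = cong₂ _∷_ (map-keyColumnFrom _ 1 0 b j label) (stdAux-key b (suc j) r (trans (sym (+-suc j r)) e))
  where
  K = keyColumns b 1 (maxList b)
  position : length K ∸ length (keyColumns b (suc j) (suc r)) ≡ j
  position = trans (cong₂ _∸_ (trans (length-map (keyColumnFrom 1 b) (seg 1 (maxList b))) (trans (length-seg 1 (maxList b)) (sym e)))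
    (trans (length-map (keyColumnFrom 1 b) (seg (suc j) (suc r))) (length-seg (suc j) (suc r)))) (m+n∸n≡m j (suc r))
  left : take (length K ∸ length (keyColumns b (suc j) (suc r))) K ≡ keyColumns b 1 j
  left = trans (cong (λ k → take k K) position) (take-keyColumns b (≤-trans (m≤m+n j (suc r)) (≤-reflexive e)))
  label : ∀ d → j < at b d → countLess K (suc d) + suc (countEqual (take (length K ∸ length (keyColumns b (suc j) (suc r))) K) (suc d))
                           ≡ partialSum b d + suc j
  label d p = cong₂ (λ x y → x + suc y) (countLess-key b d)
    (trans (cong (λ U → countEqual U (suc d)) left) (trans (countEqual-keyColumns b 0 j d) (m≥n⇒m⊓n≡n (<⇒≤ p))))

recording-key : ∀ b → addCells (keyCells b) 1 [] ≡ std (keyTableau b)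
recording-key b = trans (addCells-keyCells b 0 [])
  (trans (sym (stdAux-key b 0 (maxList b) refl)) (cong std (sym (keyTableau≡ b))))

length-keyCells : ∀ b → length (keyCells b) ≡ sum b
length-keyCells []       = refl
length-keyCells (b ∷ bs) = trans (length-++ (seg 0 b)) (cong₂ _+_ (length-seg 0 b) (length-keyCells bs))

rows-length : ∀ k bs {w} → Rows k bs w → length w ≡ sum bs
rows-length k []       refl = refl
rows-length k (b ∷ bs) (r , v , refl , (e , _) , rs) = trans (length-++ r) (cong₂ _+_ e (rows-length (suc k) bs rs))

cells⇒recording : ∀ b w → cells [] w ≡ keyCells b → proj₂ (insertAll w 1 [] []) ≡ std (keyTableau b)
cells⇒recording b w e = trans (insertAll-cells w 1 [] []) (trans (cong (λ js → addCells js 1 []) e) (recording-key b))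

recording⇒cells : ∀ b w → Rows 1 b w → proj₂ (insertAll w 1 [] []) ≡ std (keyTableau b) → cells [] w ≡ keyCells b
recording⇒cells b w rs e = addCells-injective (cells [] w) (keyCells b) 1 []
  (trans (length-cells [] w) (trans (rows-length 1 b rs) (sym (length-keyCells b))))
  (cells-valid [] w) (keyCells-valid b 0) (λ ())
  (trans (sym (insertAll-cells w 1 [] [])) (trans e (sym (recording-key b))))

-- Enumerations of key words and their sums

unique-map : ∀ {f : Word → Word} (g : Word → Word) {L} → All (λ x → g (f x) ≡ x) L → Unique L → Unique (map f L)
unique-map {f} g {L} a u = AllPairs.map⁺ (go a u)
  where
  go : ∀ {L} → All (λ x → g (f x) ≡ x) L → Unique L → AllPairs.AllPairs (λ x y → f x ≢ f y) L
  go []      []      = []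
  go (e ∷ a) (n ∷ u) = All.zipWith (λ { (x≢y , e′) fx≡fy → x≢y (trans (sym e) (trans (cong g fx≡fy) e′)) }) (n , a) ∷ go a u

unique-↭ : {L L′ : List Word} → Unique L → Unique L′ → (∀ {w} → w ∈ L → w ∈ L′) → (∀ {w} → w ∈ L′ → w ∈ L) → L ↭ L′
unique-↭ u u′ f g = ∼bag⇒↭ (unique∧set⇒bag u u′ (mk⇔ f g))

-- The first three properties determine `words` up to permutation, so `sums` speaks of the sum over
-- the set of key words.
record Enumeration (b : List ℕ) (P : Poly) : Set where
  field
    words    : List Word
    unique   : Unique words
    sound    : ∀ {w} → w ∈ words → KeyWord b w
    complete : ∀ {w} → KeyWord b w → w ∈ words
    sums     : P ≈P sumMonomials (length b) words

sumMonomials-++ : ∀ n L L′ → sumMonomials n (L ++ L′) ≡ sumMonomials n L ++ sumMonomials n L′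
sumMonomials-++ n L L′ = concatMap-++ (monomialOf n) L L′

module ExchangeSum (pre : List ℕ) (p q : ℕ) (bs : List ℕ) (p<q : p < q) (decr : Decreasing (pre ++ p ∷ []))
  {P : Poly} (enum : Enumeration (pre ++ q ∷ p ∷ bs) P) where

  open Exchange pre p q bs p<q decr
  open Crystal i
  open CrystalRows i
  open ExchangeStrings pre p q bs p<q decr
  open Enumeration enum

  n i₀ : ℕ
  n  = length (pre ++ q ∷ p ∷ bs)
  i₀ = length pre

  i<n : suc i₀ < n
  i<n rewrite length-++ pre {q ∷ p ∷ bs} | +-suc i₀ (suc (length bs)) | +-suc i₀ (length bs) = s≤s (s≤s (m≤m+n i₀ (length bs)))

  inY : All Y words
  inY = All.tabulate (KeyWord⇒Y ∘ sound)

  G-words : List Word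
  G-words = map swap↓ words

  G-unique : Unique G-words
  G-unique = unique-map swap↑ (All.map swap↑∘swap↓ inY) unique

  ∈G-words⇒G : ∀ {w} → w ∈ G-words → G w
  ∈G-words⇒G w∈ with ∈-map⁻ swap↓ w∈
  ... | y , y∈ , refl = Y⇒G (All.lookup inY y∈)

  G⇒∈G-words : ∀ {w} → G w → w ∈ G-words
  G⇒∈G-words g = subst (_∈ G-words) (swap↓∘swap↑ g) (∈-map⁺ swap↓ (complete (Y⇒KeyWord (G⇒Y g))))

  open Completion X G raise-X lower-X G⇒X top-G lower-G raise-G G-words G-unique ∈G-words⇒G G⇒∈G-words

  sum-G : sumMonomials n words ≡ sumMonomials n G-words
  sum-G = trans (sumMonomials-map n words) (trans
    (map-cong-local (All.map (λ {w} y → cong (1ℤ ,_) (content-cong n w (swap↓ w) (λ j → sym (count-swap↓ j {w} y)))) inY))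
    (trans (map-∘ words) (sym (sumMonomials-map n G-words))))

  -- Raising moves one unit from the exponent of `i` to that of `suc i`. The fixed word `t` supplies
  -- all other exponents, so the terms are updates of one vector as in `falling`.
  string-sum : ∀ m {t w} r v (e : φ 0 w ≡ m) → count i w ≡ r + m → count (suc i) w ≡ v →
    (∀ {j} → j ≢ i → j ≢ suc i → count j w ≡ count j t) →
    map (λ w → 1ℤ , content n w) (string m w e) ≡ falling 1ℤ (content n t) i₀ r v m
  string-sum zero {t} {w} r v e c c′ h =
    cong (λ f → (1ℤ , f) ∷ []) (trans (content-set2 n i₀ w t i<n h) (cong₂ (set2 (content n t) i₀) (trans c (+-identityʳ r)) c′))
  string-sum (suc m) {t} {w} r v e c c′ h with raise 0 w z≤n (subst (0 <_) (sym e) (s≤s z≤n))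
  ... | w′ , s = cong₂ _∷_
    (cong (1ℤ ,_) (trans (content-set2 n i₀ w t i<n h) (cong₂ (set2 (content n t) i₀) c c′)))
    (string-sum m {t} {w′} r (suc v) _
      (suc-injective (trans (sym (proj₁ (count-step s))) (trans c (+-suc r m))))
      (trans (proj₁ (proj₂ (count-step s))) (cong suc c′))
      (λ a b → trans (proj₂ (proj₂ (count-step s)) a b) (h a b)))

  balanced : ∀ t → IsTop t → count i t ≡ count (suc i) t + φ 0 t
  balanced t top = trans (sym (+-identityʳ (count i t))) (trans (cong (count i t +_) (sym top)) (balance 0 t))

  fullString-sum : ∀ t → IsTop t →
    sumMonomials n (fullString t) ≡ falling 1ℤ (content n t) i₀ (count (suc i) t) (count (suc i) t) (φ 0 t)
  fullString-sum t top = trans (sumMonomials-map n (fullString t))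
    (string-sum (φ 0 t) {t} (count (suc i) t) (count (suc i) t) refl (balanced t top) refl (λ _ _ → refl))

  part-sum : ∀ t → IsTop t → piOp i₀ (sumMonomials n (part t)) ≈P sumMonomials n (fullString t)
  part-sum t top f with whole? t
  ... | yes _ rewrite fullString-sum t top =
    piOp-falling i₀ 1ℤ (content n t) (count (suc i) t) (φ 0 t) (subst (suc i₀ <_) (sym (length-content n t)) i<n) f
  ... | no _ = cong (λ Q → coeff Q f) (begin
    piTerm i₀ (1ℤ , content n t) ++ []     ≡⟨ ++-identityʳ _ ⟩
    -- At a top `ε` vanishes, so the exponent of `i` exceeds that of `suc i` by `φ 0 t`.
    piTerm i₀ (1ℤ , content n t)           ≡⟨ cong (λ e → piTerm i₀ (1ℤ , e)) (trans (content-set2 n i₀ t t i<n (λ _ _ → refl)) (cong (λ x → set2 (content n t) i₀ x h) (balanced t top))) ⟩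
    piTerm i₀ (1ℤ , set2 (content n t) i₀ (h + φ 0 t) h)
      ≡⟨ piTerm-falling i₀ 1ℤ (content n t) h (φ 0 t) (subst (suc i₀ <_) (sym (length-content n t)) i<n) ⟩
    falling 1ℤ (content n t) i₀ h h (φ 0 t)  ≡⟨ fullString-sum t top ⟨
    sumMonomials n (fullString t)          ∎)
    where
    open ≡-Reasoning
    h = count (suc i) t

  parts-sum : ∀ ts → All IsTop ts → piOp i₀ (sumMonomials n (concatMap part ts)) ≈P sumMonomials n (concatMap fullString ts)
  parts-sum []       _         f = refl
  parts-sum (t ∷ ts) (p ∷ ps)  f
    rewrite sumMonomials-++ n (part t) (concatMap part ts) | sumMonomials-++ n (fullString t) (concatMap fullString ts)
          | piOp-++ i₀ (sumMonomials n (part t)) (sumMonomials n (concatMap part ts))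
          | coeff-++ (piOp i₀ (sumMonomials n (part t))) (piOp i₀ (sumMonomials n (concatMap part ts))) f
          | coeff-++ (sumMonomials n (fullString t)) (sumMonomials n (concatMap fullString ts)) f
    = cong₂ _+ℤ_ (part-sum t p f) (parts-sum ts ps f)

  completed-sum : piOp i₀ P ≈P sumMonomials n completed
  completed-sum f = begin
    coeff (piOp i₀ P) f                              ≡⟨ piOp-cong i₀ P (sumMonomials n words) sums f ⟩
    coeff (piOp i₀ (sumMonomials n words)) f         ≡⟨ cong (λ Q → coeff (piOp i₀ Q) f) sum-G ⟩
    coeff (piOp i₀ (sumMonomials n G-words)) f       ≡⟨ piOp-cong i₀ (sumMonomials n G-words) (sumMonomials n partitioned)
                                                          (sumMonomials-↭ n (unique-↭ G-unique
                                                            partitioned-unique ∈L⇒∈partitioned ∈partitioned⇒∈L)) f ⟩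
    coeff (piOp i₀ (sumMonomials n partitioned)) f   ≡⟨ parts-sum tops tops-top f ⟩
    coeff (sumMonomials n completed) f               ∎
    where open ≡-Reasoning

  exchanged : Enumeration (pre ++ p ∷ q ∷ bs) (piOp i₀ P)
  exchanged = record
    { words    = completed
    ; unique   = completed-unique
    ; sound    = X⇒KeyWord ∘ ∈completed⇒X
    ; complete = X⇒∈completed ∘ KeyWord⇒X
    ; sums     = subst (λ m → piOp i₀ P ≈P sumMonomials m completed)
                   (trans (length-++ pre) (sym (length-++ pre))) completed-sum
    }

-- Weakly decreasing weights

-- A final part 0 asks for no further columns; with it `sup-run` and `sup-forced` apply to the whole
-- of `b`.
decreasing-snoc : ∀ b → Decreasing b → Decreasing (b ++ 0 ∷ [])
decreasing-snoc []          _       = [-]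
decreasing-snoc (x ∷ [])    _       = z≤n ∷ [-]
decreasing-snoc (x ∷ y ∷ b) (p ∷ d) = p ∷ decreasing-snoc (y ∷ b) d

keyWord-sup : ∀ b → Decreasing b → KeyWord b (sup 1 b)
keyWord-sup b d = subst₂ (Rows 1) (++-identityʳ b) (++-identityʳ (sup 1 b)) (sup-rows 0 b refl)
                , proj₂ (sup-run 0 b 0 (decreasing-snoc b d) empty)

keyWord-decreasing : ∀ b {w} → Decreasing b → KeyWord b w → w ≡ sup 1 b
keyWord-decreasing b {w} d (rs , e)
  with sup-forced 0 b 0 {cs = []} (decreasing-snoc b d) empty
         (subst (λ b → Rows 1 b w) (sym (++-identityʳ b)) rs) (trans e (cong keyCells (sym (++-identityʳ b))))
... | _ , refl , refl , _ = ++-identityʳ (sup 1 b)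

count-replicate-≡ : ∀ m j → count j (replicate m j) ≡ m
count-replicate-≡ zero    j = refl
count-replicate-≡ (suc m) j = trans (count-≡ j _) (cong suc (count-replicate-≡ m j))

count-replicate-≢ : ∀ m {x j} → x ≢ j → count j (replicate m x) ≡ 0
count-replicate-≢ zero    x≢j = refl
count-replicate-≢ (suc m) x≢j = trans (count-≢ _ x≢j) (count-replicate-≢ m x≢j)

count-sup-below : ∀ s bs {j} → j < s → count j (sup s bs) ≡ 0
count-sup-below s []       j<s = refl
count-sup-below s (b ∷ bs) {j} j<s = trans (count-++ j (replicate b s) _)
  (cong₂ _+_ (count-replicate-≢ b (>⇒≢ j<s)) (count-sup-below (suc s) bs (m<n⇒m<1+n j<s)))

applyUpTo-count-sup : ∀ s b (g : ℕ → ℕ) → (∀ k → g k ≡ s + k) → applyUpTo (λ k → count (g k) (sup s b)) (length b) ≡ b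
applyUpTo-count-sup s []       g h = refl
applyUpTo-count-sup s (b ∷ bs) g h = cong₂ _∷_ first
  (trans (applyUpTo-cong (length bs) later) (applyUpTo-count-sup (suc s) bs (g ∘ suc) λ k → trans (h (suc k)) (+-suc s k)))
  where
  first : count (g 0) (sup s (b ∷ bs)) ≡ b
  first rewrite trans (h 0) (+-identityʳ s) | count-++ s (replicate b s) (sup (suc s) bs)
              | count-replicate-≡ b s | count-sup-below (suc s) bs {s} ≤-refl = +-identityʳ b
  later : ∀ k → count (g (suc k)) (sup s (b ∷ bs)) ≡ count (g (suc k)) (sup (suc s) bs)
  later k = trans (count-++ (g (suc k)) (replicate b s) _)
    (cong (_+ _) (count-replicate-≢ b (λ e → m+1+n≢m s (trans (sym (h (suc k))) (sym e)))))

content-sup : ∀ b → content (length b) (sup 1 b) ≡ b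
content-sup b = trans (content-applyUpTo (length b) (sup 1 b)) (applyUpTo-count-sup 1 b suc λ _ → refl)

decreasing-enumeration : ∀ b → Decreasing b → Enumeration b ((1ℤ , b) ∷ [])
decreasing-enumeration b d = record
  { words    = sup 1 b ∷ []
  ; unique   = [] ∷ []
  ; sound    = λ { (here refl) → keyWord-sup b d }
  ; complete = λ k → here (keyWord-decreasing b d k)
  ; sums     = λ f → cong (λ e → coeff ((1ℤ , e) ∷ []) f) (sym (content-sup b))
  }

-- The recursion of the key polynomials

data AscentView : List ℕ → Maybe ℕ → Set where
  none  : ∀ {b} → Decreasing b → AscentView b nothing
  first : ∀ pre p q bs → Decreasing (pre ++ p ∷ []) → p < q → AscentView (pre ++ p ∷ q ∷ bs) (just (length pre))

-- The equation leaves the list of the view a variable, so that the view can be matched.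
extendAscent : ∀ {x y zs b m} → y ≤ x → AscentView b m → b ≡ y ∷ zs → AscentView (x ∷ b) (Maybe.map suc m)
extendAscent y≤x (none d)                       refl = none (y≤x ∷ d)
extendAscent y≤x (first []        p q bs d p<q) refl = first (_ ∷ []) p q bs (y≤x ∷ [-]) p<q
extendAscent y≤x (first (y ∷ pre) p q bs d p<q) refl = first (_ ∷ y ∷ pre) p q bs (y≤x ∷ d) p<q

ascentFrom : ∀ x xs → AscentView (x ∷ xs) (firstAscentFrom x xs)
ascentFrom x []       = none [-]
ascentFrom x (y ∷ zs) with x <ᵇ y in eq
... | true  = first [] x y zs [-] (<ᵇ⇒< x y (subst T (sym eq) _))
... | false = extendAscent (≮⇒≥ λ x<y → subst T eq (<⇒<ᵇ x<y)) (ascentFrom y zs) refl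

ascent : ∀ b → AscentView b (firstAscent b)
ascent []       = none []
ascent (x ∷ xs) = ascentFrom x xs

swapAt-++ : ∀ pre p q bs → swapAt (length pre) (pre ++ p ∷ q ∷ bs) ≡ pre ++ q ∷ p ∷ bs
swapAt-++ []        p q bs = refl
swapAt-++ (x ∷ pre) p q bs = cong (x ∷_) (swapAt-++ pre p q bs)

greater : ℕ → List ℕ → ℕ
greater x l = length (filter (x <?_) l)

-- The number of steps of the recursion: an exchange at an adjacent ascent removes exactly that one
-- pair.
ascents : List ℕ → ℕ
ascents []       = 0
ascents (x ∷ xs) = greater x xs + ascents xs

greater-++ : ∀ x u v → greater x (u ++ v) ≡ greater x u + greater x v
greater-++ x u v = trans (cong length (filter-++ (x <?_) u v)) (length-++ (filter (x <?_) u))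

greater-swap : ∀ x pre p q bs → greater x (pre ++ p ∷ q ∷ bs) ≡ greater x (pre ++ q ∷ p ∷ bs)
greater-swap x pre p q bs
  rewrite greater-++ x pre (p ∷ q ∷ bs) | greater-++ x pre (q ∷ p ∷ bs)
        | greater-++ x (p ∷ []) (q ∷ bs) | greater-++ x (q ∷ []) (p ∷ bs)
        | greater-++ x (q ∷ []) bs | greater-++ x (p ∷ []) bs
        | sym (+-assoc (greater x (p ∷ [])) (greater x (q ∷ [])) (greater x bs))
        | sym (+-assoc (greater x (q ∷ [])) (greater x (p ∷ [])) (greater x bs))
        | +-comm (greater x (p ∷ [])) (greater x (q ∷ [])) = refl

greater-< : ∀ {x y} l → x < y → greater x (y ∷ l) ≡ suc (greater x l)
greater-< {x} {y} l x<y with x <? y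
... | yes _  = cong length (filter-accept (x <?_) {y} {l} x<y)
... | no x≮y = contradiction x<y x≮y

greater-≥ : ∀ {x y} l → y ≤ x → greater x (y ∷ l) ≡ greater x l
greater-≥ {x} {y} l y≤x = cong length (filter-reject (x <?_) {y} {l} (≤⇒≯ y≤x))

ascents-swap : ∀ pre p q bs → p < q → ascents (pre ++ p ∷ q ∷ bs) ≡ suc (ascents (pre ++ q ∷ p ∷ bs))
ascents-swap (x ∷ pre) p q bs p<q =
  trans (cong₂ _+_ (greater-swap x pre p q bs) (ascents-swap pre p q bs p<q)) (+-suc _ _)
ascents-swap [] p q bs p<q rewrite greater-< bs p<q | greater-≥ bs (<⇒≤ p<q) = cong suc (begin
  greater p bs + (greater q bs + ascents bs)   ≡⟨ +-assoc (greater p bs) _ _ ⟨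
  greater p bs + greater q bs + ascents bs     ≡⟨ cong (_+ ascents bs) (+-comm (greater p bs) _) ⟩
  greater q bs + greater p bs + ascents bs     ≡⟨ +-assoc (greater q bs) _ _ ⟩
  greater q bs + (greater p bs + ascents bs)   ∎)
  where open ≡-Reasoning

ascents-bound : ∀ b → ascents b ≤ length b * length b
ascents-bound []       = z≤n
ascents-bound (x ∷ xs) = ≤-trans (+-mono-≤ (length-filter (x <?_) xs) (ascents-bound xs))
  (m≤n⇒m≤1+n (+-monoʳ-≤ (length xs) (*-monoʳ-≤ (length xs) (n≤1+n (length xs)))))

keyPolyFuel-enumeration : ∀ fuel b → ascents b ≤ fuel → Enumeration b (keyPolyFuel fuel b)
keyPolyFuel-enumeration zero b a with firstAscent b | ascent b
... | _ | none d = decreasing-enumeration b d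
-- When the fuel is used up there is no ascent left, so the default branch is the decreasing case.
... | _ | first pre p q bs d p<q = contradiction (subst (_≤ 0) (ascents-swap pre p q bs p<q) a) λ ()
keyPolyFuel-enumeration (suc fuel) b a with firstAscent b | ascent b
... | _ | none d = decreasing-enumeration b d
... | _ | first pre p q bs d p<q rewrite swapAt-++ pre p q bs =
  ExchangeSum.exchanged pre p q bs p<q d (keyPolyFuel-enumeration fuel (pre ++ q ∷ p ∷ bs)
    (s≤s⁻¹ (subst (_≤ suc fuel) (ascents-swap pre p q bs p<q) a)))

keyPoly-enumeration : ∀ b → Enumeration b (keyPoly b)
keyPoly-enumeration b = keyPolyFuel-enumeration (length b * length b) b (ascents-bound b)

-- Complementation

complement : ℕ → Word → Word
complement n = map (λ j → suc n ∸ j)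

complement-involutive : ∀ n {w} → All (_≤ n) w → complement n (complement n w) ≡ w
complement-involutive n {w} a = trans (sym (map-∘ w)) (map-id-local (All.map (λ x≤n → m∸[m∸n]≡n (m≤n⇒m≤1+n x≤n)) a))

rows-≤ : ∀ k bs {w m} → k + length bs ≤ suc m → Rows k bs w → All (_≤ m) w
rows-≤ k []       _ refl = []
rows-≤ k (b ∷ bs) {m = m} l (r , v , refl , (_ , _ , a) , rs) =
  All.++⁺ (All.map (λ { (_ , x≤k) → ≤-trans x≤k k≤m }) a) (rows-≤ (suc k) bs l′ rs)
  where
  l′ : suc k + length bs ≤ suc m
  l′ = subst (_≤ suc m) (+-suc k (length bs)) l
  k≤m : k ≤ m
  k≤m = s≤s⁻¹ (≤-trans (s≤s (m≤m+n k (length bs))) l′)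

rows-snoc : ∀ k bs {b w r} → Rows k bs w → Row (k + length bs) b r → Rows k (bs ++ b ∷ []) (w ++ r)
rows-snoc k []       {b} {r = r} refl row = r , [] , sym (++-identityʳ r) , subst (λ m → Row m b r) (+-identityʳ k) row , refl
rows-snoc k (_ ∷ bs) {b} {r = r} (r′ , v , refl , row′ , rs) row =
  r′ , v ++ r , ++-assoc r′ v r , row′ , rows-snoc (suc k) bs rs (subst (λ m → Row m b r) (+-suc k (length bs)) row)

rows-unsnoc : ∀ k bs {b v} → Rows k (bs ++ b ∷ []) v → ∃₂ λ w r → v ≡ w ++ r × Rows k bs w × Row (k + length bs) b r
rows-unsnoc k []       {b} (r , _ , refl , row , refl) = [] , r , ++-identityʳ r , refl , subst (λ m → Row m b r) (sym (+-identityʳ k)) row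
rows-unsnoc k (_ ∷ bs) {b} (r′ , v , refl , row′ , rs) with rows-unsnoc (suc k) bs rs
... | w , r , refl , rs′ , row =
  r′ ++ w , r , sym (++-assoc r′ w r) , (r′ , w , refl , row′ , rs′) , subst (λ m → Row m b r) (sym (+-suc k (length bs))) row

-- Complementation maps the letters i, ..., n to 1, ..., n + 1 - i, so the lower bound on a factor
-- becomes the bound of a row by its own index.
factor⇒row : ∀ {n i b f} → FactorOK n i b f → Row (suc n ∸ i) b (complement n f)
factor⇒row {n} {f = f} (l , d , a) = trans (length-map _ f) l
  , Linked.map⁺ (Linked.map (∸-monoʳ-≤ (suc n)) d)
  , All.map⁺ (All.map (λ { (i≤j , j≤n) → m<n⇒0<n∸m (s≤s j≤n) , ∸-monoʳ-≤ (suc n) i≤j }) a)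

row⇒factor : ∀ {n i b r} → i ≤ suc n → Row (suc n ∸ i) b r → FactorOK n i b (complement n r)
row⇒factor {n} {i} {r = r} i≤ (l , d , a) = trans (length-map _ r) l
  , Linked.map⁺ (Linked.map (∸-monoʳ-≤ (suc n)) d)
  , All.map⁺ (All.map (λ { {x} (1≤x , x≤) → subst (_≤ suc n ∸ x) (m∸[m∸n]≡n i≤) (∸-monoʳ-≤ (suc n) x≤) , ∸-monoʳ-≤ (suc n) 1≤x }) a)

concat-reverse-∷ : ∀ (f : Word) fs → concat (reverse (f ∷ fs)) ≡ concat (reverse fs) ++ f
concat-reverse-∷ f fs rewrite unfold-reverse f fs | sym (concat-++ (reverse fs) (f ∷ [])) | ++-identityʳ f = refl

module _ {n : ℕ} where

  index : ∀ {i} (as : List ℕ) {x} → length (x ∷ as) + i ≡ suc n → suc n ∸ i ≡ 1 + length (reverse as)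
  index {i} as {x} e rewrite length-reverse as = trans (cong (_∸ i) (sym e)) (m+n∸n≡m (suc (length as)) i)

  factors⇒rows : ∀ i as fs → length as + i ≡ suc n → GoodFactors n i as fs →
    Rows 1 (reverse as) (complement n (concat (reverse fs)))
  factors⇒rows i []       []       e _        = refl
  factors⇒rows i (b ∷ as) (f ∷ fs) e (ok , gs) =
    subst₂ (Rows 1) (sym (unfold-reverse b as))
      (sym (trans (cong (complement n) (concat-reverse-∷ f fs)) (map-++ (λ j → suc n ∸ j) (concat (reverse fs)) f)))
      (rows-snoc 1 (reverse as) (factors⇒rows (suc i) as fs (trans (+-suc (length as) i) e) gs)
        (subst (λ m → Row m b (complement n f)) (index as {b} e) (factor⇒row ok)))

  rows⇒factors : ∀ i as {v} → length as + i ≡ suc n → Rows 1 (reverse as) v →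
    ∃ λ fs → GoodFactors n i as fs × complement n v ≡ concat (reverse fs)
  rows⇒factors i []       e refl = [] , _ , refl
  rows⇒factors i (b ∷ as) {v} e rs with rows-unsnoc 1 (reverse as) {b} (subst (λ bs → Rows 1 bs v) (unfold-reverse b as) rs)
  ... | w , r , refl , rs′ , row with rows⇒factors (suc i) as (trans (+-suc (length as) i) e) rs′
  ...   | fs , gs , e′ = complement n r ∷ fs
        , (row⇒factor (≤-trans (m≤n+m i (suc (length as))) (≤-reflexive e)) (subst (λ m → Row m b r) (sym (index as {b} e)) row) , gs)
        , trans (map-++ (λ j → suc n ∸ j) w r) (trans (cong (_++ complement n r) e′) (sym (concat-reverse-∷ (complement n r) fs)))

  factors-≤ : ∀ i as fs → GoodFactors n i as fs → All (_≤ n) (concat (reverse fs))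
  factors-≤ i []       []       _              = []
  factors-≤ i (b ∷ as) (f ∷ fs) ((_ , _ , a) , gs) =
    subst (All (_≤ n)) (sym (concat-reverse-∷ f fs)) (All.++⁺ (factors-≤ (suc i) as fs gs) (All.map proj₂ a))

-- `frev` reverses the complement and the insertion reads from the right; the reversals cancel and
-- the complement is inserted from left to right.
recording-frev : ∀ n u → recordingTableau (frev n u) ≡ proj₂ (insertAll (complement n u) 1 [] [])
recording-frev n u = cong (λ w → proj₂ (insertAll w 1 [] [])) (reverse-involutive (complement n u))

inYW⇒keyWord : ∀ a u → InYW a u → KeyWord (reverse a) (complement (length a) u) × complement (length a) (complement (length a) u) ≡ u
inYW⇒keyWord a u (fs , gs , refl , e) = (rs , recording⇒cells (reverse a) _ rs (trans (sym (recording-frev n u)) e))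
  , complement-involutive n (factors-≤ 1 a fs gs)
  where
  n  = length a
  rs = factors⇒rows 1 a fs (+-comm n 1) gs

keyWord-≤ : ∀ a {v} → KeyWord (reverse a) v → All (_≤ length a) v
keyWord-≤ a (rs , _) = rows-≤ 1 (reverse a) (≤-reflexive (cong suc (length-reverse a))) rs

keyWord⇒inYW : ∀ a {v} → KeyWord (reverse a) v → InYW a (complement (length a) v)
keyWord⇒inYW a {v} k@(rs , e) with rows⇒factors 1 a (+-comm (length a) 1) rs
... | fs , gs , e′ = fs , gs , e′ , trans (recording-frev (length a) (complement (length a) v))
  (trans (cong (λ w → proj₂ (insertAll w 1 [] [])) (complement-involutive (length a) (keyWord-≤ a k)))
         (cells⇒recording (reverse a) v e))

count-complement : ∀ n k {v} → k < n → All (_≤ n) v → count (suc k) (complement n v) ≡ count (n ∸ k) v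
count-complement n k k<n [] = refl
count-complement n k {x ∷ v} k<n (x≤n ∷ a) with x ≟ n ∸ k
... | yes refl = trans (cong (λ y → count (suc k) (y ∷ complement n v)) self)
                   (trans (count-≡ (suc k) (complement n v)) (trans (cong suc (count-complement n k k<n a)) (sym (count-≡ (n ∸ k) v))))
  where
  self : suc n ∸ (n ∸ k) ≡ suc k
  self = trans (+-∸-assoc 1 (m∸n≤m n k)) (cong suc (m∸[m∸n]≡n (<⇒≤ k<n)))
... | no x≢ = trans (count-≢ {suc n ∸ x} (complement n v) λ e → x≢ (trans (sym (m∸[m∸n]≡n (m≤n⇒m≤1+n x≤n))) (cong (suc n ∸_) e)))
                (trans (count-complement n k k<n a) (sym (count-≢ v x≢)))

applyUpTo-reversed : ∀ {A : Set} n (f g : ℕ → A) → (∀ k → k < n → g k ≡ f (n ∸ suc k)) → applyUpTo g n ≡ applyDownFrom f n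
applyUpTo-reversed zero    f g h = refl
applyUpTo-reversed (suc n) f g h = cong₂ _∷_ (h 0 (s≤s z≤n)) (applyUpTo-reversed n f (g ∘ suc) λ k k<n → h (suc k) (s≤s k<n))

content-complement : ∀ n {v} → All (_≤ n) v → content n (complement n v) ≡ reverse (content n v)
content-complement n {v} a rewrite content-applyUpTo n (complement n v) | content-applyUpTo n v
  | reverse-applyUpTo (λ k → count (suc k) v) n =
  applyUpTo-reversed n (λ k → count (suc k) v) _ λ k k<n →
    trans (count-complement n k k<n a) (cong (λ j → count j v) (+-∸-assoc 1 k<n))

-- The function is described pointwise because the pattern-matching lambda in `youngKeyPoly` is not
-- definitionally equal to any other one.
coeff-reverse : ∀ (g : Term → Term) → (∀ c e → g (c , e) ≡ (c , reverse e)) → ∀ p f → coeff (map g p) f ≡ coeff p (reverse f)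
coeff-reverse g h []            f = refl
coeff-reverse g h ((c , e) ∷ p) f rewrite h c e | coeff-reverse g h p f
  | eqList-iff {reverse e} {f} {e} {reverse f} (λ q → trans (sym (reverse-involutive e)) (cong reverse q))
                                               (λ q → trans (cong reverse q) (reverse-involutive f)) = refl

mainTheorem4 : (a : List ℕ) →
    Σ[ L ∈ List Word ]
    ( Unique L
    × (∀ (u : Word) → (u ∈ L) ⇔ InYW a u)
    × (youngKeyPoly a ≈P sumMonomials (length a) L) )
mainTheorem4 a = map (complement n) words
  , unique-map (complement n) (All.map (complement-involutive n) bounded) unique
  , (λ u → mk⇔ sound′ (λ y → let (k , e) = inYW⇒keyWord a u y in subst (_∈ map (complement n) words) e (∈-map⁺ (complement n) (complete k))))
  , sums′
  where
  n = length a
  open Enumeration (keyPoly-enumeration (reverse a))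
  bounded : All (All (_≤ n)) words
  bounded = All.tabulate (keyWord-≤ a ∘ sound)
  sound′ : ∀ {u} → u ∈ map (complement n) words → InYW a u
  sound′ u∈ with ∈-map⁻ (complement n) u∈
  ... | v , v∈ , refl = keyWord⇒inYW a (sound v∈)
  reversed : Term → Term
  reversed (c , e) = c , reverse e
  -- Reversing the order of the variables amounts to complementing the letters of every word.
  sumMonomials-complement : map reversed (sumMonomials n words) ≡ sumMonomials n (map (complement n) words)
  sumMonomials-complement = begin
    map reversed (sumMonomials n words)                            ≡⟨ cong (map reversed) (sumMonomials-map n words) ⟩
    map reversed (map (λ w → 1ℤ , content n w) words)              ≡⟨ map-∘ words ⟨
    map (λ w → 1ℤ , reverse (content n w)) words                   ≡⟨ map-cong-local (All.map (λ b → cong (1ℤ ,_) (sym (content-complement n b))) bounded) ⟩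
    map (λ w → 1ℤ , content n (complement n w)) words              ≡⟨ map-∘ words ⟩
    map (λ w → 1ℤ , content n w) (map (complement n) words)        ≡⟨ sumMonomials-map n (map (complement n) words) ⟨
    sumMonomials n (map (complement n) words)                      ∎
    where open ≡-Reasoning
  sums′ : youngKeyPoly a ≈P sumMonomials n (map (complement n) words)
  sums′ f = begin
    coeff (youngKeyPoly a) f                                       ≡⟨ coeff-reverse _ (λ _ _ → refl) (keyPoly (reverse a)) f ⟩
    coeff (keyPoly (reverse a)) (reverse f)                        ≡⟨ sums (reverse f) ⟩
    coeff (sumMonomials (length (reverse a)) words) (reverse f)    ≡⟨ cong (λ m → coeff (sumMonomials m words) (reverse f)) (length-reverse a) ⟩
    coeff (sumMonomials n words) (reverse f)                       ≡⟨ coeff-reverse reversed (λ _ _ → refl) (sumMonomials n words) f ⟨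
    coeff (map reversed (sumMonomials n words)) f                  ≡⟨ cong (λ p → coeff p f) sumMonomials-complement ⟩
    coeff (sumMonomials n (map (complement n) words)) f            ∎
    where open ≡-Reasoning
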